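{- Let $p$ be an odd prime and let $\alpha$ be an indeterminate over $\mathbb F_p$. There is a unique polynomial $G^{(\alpha)}(X)\in\mathbb F_p(\alpha)[X]$ of degree less than $p$ such that \[ G^{(\alpha)}\bigl(L_{p-1}^{(\alpha)}(X)\bigr)\equiv X \pmod{X^p-(\alpha^p-\alpha)} \] in $\mathbb F_p(\alpha)[X]$, and it is given by \[ G^{(\alpha)}(X)=-\sum_{k=1}^{p-1}\frac{1}{k}\,\frac{X^{k}}{\prod_{s=1}^{k-1}b_{1,s}(\alpha)}, \] where the empty product (for $k=1$) equals $1$.
   Context: $p$ is an odd prime and $\mathbb F_p$ the field of $p$ elements. The (generalized Laguerre) polynomial $L_{p-1}^{(\alpha)}(X)\in\mathbb F_p[\alpha,X]$ is defined by $L_{p-1}^{(\alpha)}(X)=\sum_{k=0}^{p-1}\binom{\alpha-1}{p-1-k}\frac{(-X)^k}{k!}$, where $\binom{x}{m}=x(x-1)\cdots(x-m+1)/m!$. For integers $0<r,s<p$ (integers are freely interpreted as elements of $\mathbb F_p$), the polynomial $b_{r,s}(\alpha)\in\mathbb F_p[\alpha]$ is defined by $b_{r,s}(\alpha)=\sum_{k=0}^{p-1}(-r/s)^k\binom{r\alpha-1}{p-1-k}\binom{s\alpha-1}{k}$. -}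

module Defs where

open import Algebra.Bundles using (AbelianGroup; CommutativeRing; Semiring)
import Algebra.Definitions.RawSemiring
import Algebra.Properties.CommutativeSemigroup
import Algebra.Properties.Ring
open import Data.Empty using (⊥-elim)
open import Data.Fin.Base using (toℕ)
open import Data.Integer.Base as ℤ using (ℤ; +_)
import Data.Integer.Divisibility.Signed as ℤ∣
import Data.Integer.DivMod as ℤ
import Data.Integer.Properties as ℤ
open import Data.Integer.Tactic.RingSolver using (solve-∀)
open import Data.List.Base using (List; []; _∷_; map)
open import Data.Nat.Base as ℕ using (ℕ; zero; suc; _∸_; _!)
import Data.Nat.Coprimality as ℕ
import Data.Nat.Divisibility as ℕ∣
open import Data.Nat.GCD using (module Bézout)
import Data.Nat.Properties as ℕ
open import Data.Nat.Primality using (Prime; prime⇒nonZero; prime⇒nonTrivial)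
open import Data.Product.Base using (_×_; _,_; proj₁; proj₂; ∃)
open import Data.Sum.Base using (_⊎_; inj₁; inj₂; [_,_]′)
open import Function.Base using (_∘_)
open import Level using (_⊔_) renaming (zero to 0ℓ; suc to lsuc)
open import Relation.Binary.Definitions using (Decidable)
open import Relation.Binary.PropositionalEquality.Core as ≡ using (_≡_)
import Relation.Binary.Reasoning.Setoid
open import Relation.Nullary using (¬_; Dec; yes; no)
open import Relation.Nullary.Decidable using (map′)

record Domain c ℓ : Set (lsuc (c ⊔ ℓ)) where
  field
    commutativeRing : CommutativeRing c ℓ
  open CommutativeRing commutativeRing public
  field
    _≟_            : Decidable _≈_
    1≉0            : ¬ 1# ≈ 0#
    noZeroDivisors : ∀ {x y} → x * y ≈ 0# → x ≈ 0# ⊎ y ≈ 0#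

-- The reciprocal is a total function, with the convention 0 ⁻¹ ≈ 0.

record Field c ℓ : Set (lsuc (c ⊔ ℓ)) where
  infix 9 _⁻¹
  field
    commutativeRing : CommutativeRing c ℓ
  open CommutativeRing commutativeRing public
  field
    _≟_       : Decidable _≈_
    1≉0       : ¬ 1# ≈ 0#
    _⁻¹       : Carrier → Carrier
    *-inverse : ∀ {x} → ¬ x ≈ 0# → x * x ⁻¹ ≈ 1#
    ⁻¹-zero   : ∀ {x} → x ≈ 0# → x ⁻¹ ≈ 0#

  private
    noZeroDivisors : ∀ {x y} → x * y ≈ 0# → x ≈ 0# ⊎ y ≈ 0#
    noZeroDivisors {x} {y} xy≈0 with x ≟ 0#
    ... | yes x≈0 = inj₁ x≈0
    ... | no  x≉0 = inj₂ (begin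
      y                ≈⟨ *-identityˡ y ⟨
      1# * y           ≈⟨ *-congʳ (*-inverse x≉0) ⟨
      x * x ⁻¹ * y     ≈⟨ *-congʳ (*-comm x (x ⁻¹)) ⟩
      x ⁻¹ * x * y     ≈⟨ *-assoc (x ⁻¹) x y ⟩
      x ⁻¹ * (x * y)   ≈⟨ *-congˡ xy≈0 ⟩
      x ⁻¹ * 0#        ≈⟨ zeroʳ (x ⁻¹) ⟩
      0#               ∎)
      where open Relation.Binary.Reasoning.Setoid setoid

  domain : Domain c ℓ
  domain = record
    { commutativeRing = commutativeRing
    ; _≟_             = _≟_
    ; 1≉0             = 1≉0
    ; noZeroDivisors  = noZeroDivisors
    }

-- The ranges are half-open:
-- ∑ m n f = f m + ⋯ + f (n - 1)  and  ∏ m n f = f m * ⋯ * f (n - 1).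

module Ranges {c ℓ} (R : CommutativeRing c ℓ) where
  open CommutativeRing R
  open Algebra.Definitions.RawSemiring (Semiring.rawSemiring semiring) public
    using (sum; product; _^_; _∣_)

  ∑ ∏ : ℕ → ℕ → (ℕ → Carrier) → Carrier
  ∑ m n f = sum     {n ∸ m} (λ i → f (m ℕ.+ toℕ i))
  ∏ m n f = product {n ∸ m} (λ i → f (m ℕ.+ toℕ i))

-- Lists of coefficients, constant term first.  Trailing zeros are allowed,
-- and _≋_ compares all coefficients.

module Polynomial {c ℓ} (R : CommutativeRing c ℓ) where
  open CommutativeRing R
  private
    module RP = Algebra.Properties.Ring ring

  Poly : Set c
  Poly = List Carrier

  coeff : Poly → ℕ → Carrier
  coeff []      _       = 0#
  coeff (a ∷ _) zero    = a
  coeff (_ ∷ f) (suc n) = coeff f n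

  infix 4 _≋_
  record _≋_ (f g : Poly) : Set ℓ where
    constructor mk
    field at : ∀ n → coeff f n ≈ coeff g n
  open _≋_ public

  DegreeBelow : ℕ → Poly → Set ℓ
  DegreeBelow n f = ∀ i → n ℕ.≤ i → coeff f i ≈ 0#

  C : Carrier → Poly
  C a = a ∷ []

  X : Poly
  X = 0# ∷ 1# ∷ []

  infixl 6 _⊕_
  infixl 7 _⊛_ _·_
  infix  8 ⊖_

  _⊕_ : Poly → Poly → Poly
  []      ⊕ g       = g
  (a ∷ f) ⊕ []      = a ∷ f
  (a ∷ f) ⊕ (b ∷ g) = (a + b) ∷ (f ⊕ g)

  ⊖_ : Poly → Poly
  ⊖_ = map (-_)

  _·_ : Carrier → Poly → Poly
  a · f = map (a *_) f

  _⊛_ : Poly → Poly → Poly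
  []      ⊛ g = []
  (a ∷ f) ⊛ g = a · g ⊕ (0# ∷ f ⊛ g)

  -- f ⟨ g ⟩ is f(g(X)), by Horner's rule.
  infixr 9 _⟨_⟩
  _⟨_⟩ : Poly → Poly → Poly
  []      ⟨ g ⟩ = []
  (a ∷ f) ⟨ g ⟩ = C a ⊕ g ⊛ f ⟨ g ⟩

  coeff-⊕ : ∀ f g n → coeff (f ⊕ g) n ≈ coeff f n + coeff g n
  coeff-⊕ []      g       n       = sym (+-identityˡ _)
  coeff-⊕ (a ∷ f) []      n       = sym (+-identityʳ _)
  coeff-⊕ (a ∷ f) (b ∷ g) zero    = refl
  coeff-⊕ (a ∷ f) (b ∷ g) (suc n) = coeff-⊕ f g n

  coeff-⊖ : ∀ f n → coeff (⊖ f) n ≈ - coeff f n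
  coeff-⊖ []      n       = sym RP.-0#≈0#
  coeff-⊖ (a ∷ f) zero    = refl
  coeff-⊖ (a ∷ f) (suc n) = coeff-⊖ f n

  coeff-· : ∀ a f n → coeff (a · f) n ≈ a * coeff f n
  coeff-· a []      n       = sym (zeroʳ a)
  coeff-· a (b ∷ f) zero    = refl
  coeff-· a (b ∷ f) (suc n) = coeff-· a f n

  private
    ≋-refl : ∀ {f} → f ≋ f
    ≋-refl = mk λ _ → refl

    ≋-sym : ∀ {f g} → f ≋ g → g ≋ f
    ≋-sym f≋g = mk λ n → sym (at f≋g n)

    ≋-trans : ∀ {f g h} → f ≋ g → g ≋ h → f ≋ h
    ≋-trans f≋g g≋h = mk λ n → trans (at f≋g n) (at g≋h n)

    ⊕-cong : ∀ {f g h k} → f ≋ g → h ≋ k → f ⊕ h ≋ g ⊕ k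
    ⊕-cong {f} {g} {h} {k} f≋g h≋k = mk λ n →
      trans (coeff-⊕ f h n)
        (trans (+-cong (at f≋g n) (at h≋k n)) (sym (coeff-⊕ g k n)))

    ⊕-assoc : ∀ f g h → (f ⊕ g) ⊕ h ≋ f ⊕ (g ⊕ h)
    ⊕-assoc f g h = mk λ n → begin
      coeff ((f ⊕ g) ⊕ h) n                 ≈⟨ coeff-⊕ (f ⊕ g) h n ⟩
      coeff (f ⊕ g) n + coeff h n           ≈⟨ +-congʳ (coeff-⊕ f g n) ⟩
      coeff f n + coeff g n + coeff h n     ≈⟨ +-assoc _ _ _ ⟩
      coeff f n + (coeff g n + coeff h n)   ≈⟨ +-congˡ (coeff-⊕ g h n) ⟨
      coeff f n + coeff (g ⊕ h) n           ≈⟨ coeff-⊕ f (g ⊕ h) n ⟨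
      coeff (f ⊕ (g ⊕ h)) n                 ∎
      where open Relation.Binary.Reasoning.Setoid setoid

    ⊕-comm : ∀ f g → f ⊕ g ≋ g ⊕ f
    ⊕-comm f g = mk λ n →
      trans (coeff-⊕ f g n) (trans (+-comm _ _) (sym (coeff-⊕ g f n)))

    ⊕-identityʳ : ∀ f → f ⊕ [] ≋ f
    ⊕-identityʳ f = ⊕-comm f []

    ⊖-cong : ∀ {f g} → f ≋ g → ⊖ f ≋ ⊖ g
    ⊖-cong {f} {g} f≋g = mk λ n →
      trans (coeff-⊖ f n) (trans (-‿cong (at f≋g n)) (sym (coeff-⊖ g n)))

    ⊖-inverseˡ : ∀ f → ⊖ f ⊕ f ≋ []
    ⊖-inverseˡ f = mk λ n →
      trans (coeff-⊕ (⊖ f) f n)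
        (trans (+-congʳ (coeff-⊖ f n)) (-‿inverseˡ _))

    ⊕-abelianGroup : AbelianGroup c ℓ
    ⊕-abelianGroup = record
      { Carrier = Poly ; _≈_ = _≋_ ; _∙_ = _⊕_ ; ε = [] ; _⁻¹ = ⊖_
      ; isAbelianGroup = record
        { isGroup = record
          { isMonoid = record
            { isSemigroup = record
              { isMagma = record
                { isEquivalence = record
                  { refl = ≋-refl ; sym = ≋-sym ; trans = ≋-trans }
                ; ∙-cong = ⊕-cong
                }
              ; assoc = ⊕-assoc
              }
            ; identity = (λ _ → ≋-refl) , ⊕-identityʳ
            }
          ; inverse = ⊖-inverseˡ , λ f → ≋-trans (⊕-comm f (⊖ f)) (⊖-inverseˡ f)
          ; ⁻¹-cong = ⊖-cong
          }
        ; comm = ⊕-comm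
        }
      }

    module P = AbelianGroup ⊕-abelianGroup
    module PS = Algebra.Properties.CommutativeSemigroup P.commutativeSemigroup
    open Relation.Binary.Reasoning.Setoid P.setoid

    ∷-cong : ∀ {a b f g} → a ≈ b → f ≋ g → (a ∷ f) ≋ (b ∷ g)
    ∷-cong a≈b f≋g = mk λ { zero → a≈b ; (suc n) → at f≋g n }

    ∷-zero : ∀ {a f} → a ≈ 0# → f ≋ [] → (a ∷ f) ≋ []
    ∷-zero a≈0 f≋0 = mk λ { zero → a≈0 ; (suc n) → at f≋0 n }

    0∷-⊕ : ∀ f g → (0# ∷ (f ⊕ g)) ≋ (0# ∷ f) ⊕ (0# ∷ g)
    0∷-⊕ f g = ∷-cong (sym (+-identityˡ 0#)) ≋-refl

    ·-cong : ∀ {a b f g} → a ≈ b → f ≋ g → a · f ≋ b · g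
    ·-cong {a} {b} {f} {g} a≈b f≋g = mk λ n →
      trans (coeff-· a f n) (trans (*-cong a≈b (at f≋g n)) (sym (coeff-· b g n)))

    ·-distrib-⊕ : ∀ a f g → a · (f ⊕ g) ≋ a · f ⊕ a · g
    ·-distrib-⊕ a []      g       = ≋-refl
    ·-distrib-⊕ a (b ∷ f) []      = ≋-refl
    ·-distrib-⊕ a (b ∷ f) (d ∷ g) = ∷-cong (distribˡ a b d) (·-distrib-⊕ a f g)

    ·-assoc : ∀ a b f → (a * b) · f ≋ a · (b · f)
    ·-assoc a b []      = ≋-refl
    ·-assoc a b (d ∷ f) = ∷-cong (*-assoc a b d) (·-assoc a b f)

    1·f≋f : ∀ f → 1# · f ≋ f
    1·f≋f []      = ≋-refl
    1·f≋f (a ∷ f) = ∷-cong (*-identityˡ a) (1·f≋f f)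

    0·f≋0 : ∀ {a} f → a ≈ 0# → a · f ≋ []
    0·f≋0 []      a≈0 = ≋-refl
    0·f≋0 (b ∷ f) a≈0 = ∷-zero (trans (*-congʳ a≈0) (zeroˡ b)) (0·f≋0 f a≈0)

    ⊛-congˡ : ∀ f {g h} → g ≋ h → f ⊛ g ≋ f ⊛ h
    ⊛-congˡ []      g≋h = ≋-refl
    ⊛-congˡ (a ∷ f) g≋h =
      ⊕-cong (·-cong refl g≋h) (∷-cong refl (⊛-congˡ f g≋h))

    ⊛-zeroʳ : ∀ f → f ⊛ [] ≋ []
    ⊛-zeroʳ []      = ≋-refl
    ⊛-zeroʳ (a ∷ f) = ∷-zero refl (⊛-zeroʳ f)

    ⊛-∷ʳ : ∀ f b g → f ⊛ (b ∷ g) ≋ b · f ⊕ (0# ∷ f ⊛ g)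
    ⊛-∷ʳ []      b g = ≋-sym (∷-zero refl ≋-refl)
    ⊛-∷ʳ (a ∷ f) b g = ∷-cong (+-congʳ (*-comm a b)) (begin
      a · g ⊕ f ⊛ (b ∷ g)             ≈⟨ P.∙-congˡ (⊛-∷ʳ f b g) ⟩
      a · g ⊕ (b · f ⊕ (0# ∷ f ⊛ g))  ≈⟨ PS.x∙yz≈y∙xz (a · g) (b · f) _ ⟩
      b · f ⊕ (a · g ⊕ (0# ∷ f ⊛ g))  ∎)

    ⊛-comm : ∀ f g → f ⊛ g ≋ g ⊛ f
    ⊛-comm []      g = ≋-sym (⊛-zeroʳ g)
    ⊛-comm (a ∷ f) g = begin
      a · g ⊕ (0# ∷ f ⊛ g)  ≈⟨ P.∙-congˡ (∷-cong refl (⊛-comm f g)) ⟩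
      a · g ⊕ (0# ∷ g ⊛ f)  ≈⟨ ⊛-∷ʳ g a f ⟨
      g ⊛ (a ∷ f)           ∎

    ⊛-congʳ : ∀ h {f g} → f ≋ g → f ⊛ h ≋ g ⊛ h
    ⊛-congʳ h {f} {g} f≋g =
      ≋-trans (⊛-comm f h) (≋-trans (⊛-congˡ h f≋g) (⊛-comm h g))

    ⊛-cong : ∀ {f g h k} → f ≋ g → h ≋ k → f ⊛ h ≋ g ⊛ k
    ⊛-cong {f} {g} {h} {k} f≋g h≋k = ≋-trans (⊛-congʳ h f≋g) (⊛-congˡ g h≋k)

    ⊛-distribˡ : ∀ f g h → f ⊛ (g ⊕ h) ≋ f ⊛ g ⊕ f ⊛ h
    ⊛-distribˡ []      g h = ≋-refl
    ⊛-distribˡ (a ∷ f) g h = begin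
      a · (g ⊕ h) ⊕ (0# ∷ f ⊛ (g ⊕ h))
        ≈⟨ P.∙-cong (·-distrib-⊕ a g h) (∷-cong refl (⊛-distribˡ f g h)) ⟩
      (a · g ⊕ a · h) ⊕ (0# ∷ (f ⊛ g ⊕ f ⊛ h))
        ≈⟨ P.∙-congˡ (0∷-⊕ (f ⊛ g) (f ⊛ h)) ⟩
      (a · g ⊕ a · h) ⊕ ((0# ∷ f ⊛ g) ⊕ (0# ∷ f ⊛ h))
        ≈⟨ PS.interchange (a · g) (a · h) _ _ ⟩
      (a · g ⊕ (0# ∷ f ⊛ g)) ⊕ (a · h ⊕ (0# ∷ f ⊛ h)) ∎

    ⊛-distribʳ : ∀ f g h → (g ⊕ h) ⊛ f ≋ g ⊛ f ⊕ h ⊛ f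
    ⊛-distribʳ f g h = begin
      (g ⊕ h) ⊛ f      ≈⟨ ⊛-comm (g ⊕ h) f ⟩
      f ⊛ (g ⊕ h)      ≈⟨ ⊛-distribˡ f g h ⟩
      f ⊛ g ⊕ f ⊛ h    ≈⟨ P.∙-cong (⊛-comm f g) (⊛-comm f h) ⟩
      g ⊛ f ⊕ h ⊛ f    ∎

    ·-⊛ : ∀ a f g → (a · f) ⊛ g ≋ a · (f ⊛ g)
    ·-⊛ a []      g = ≋-refl
    ·-⊛ a (b ∷ f) g = begin
      (a * b) · g ⊕ (0# ∷ (a · f) ⊛ g)
        ≈⟨ P.∙-cong (·-assoc a b g) (∷-cong (sym (zeroʳ a)) (·-⊛ a f g)) ⟩
      a · (b · g) ⊕ a · (0# ∷ f ⊛ g)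
        ≈⟨ ·-distrib-⊕ a (b · g) (0# ∷ f ⊛ g) ⟨
      a · (b · g ⊕ (0# ∷ f ⊛ g)) ∎

  0∷-⊛ : ∀ {a} f g → a ≈ 0# → (a ∷ f) ⊛ g ≋ (0# ∷ f ⊛ g)
  0∷-⊛ f g a≈0 = P.∙-congʳ (0·f≋0 g a≈0)

  private
    ⊛-assoc : ∀ f g h → (f ⊛ g) ⊛ h ≋ f ⊛ (g ⊛ h)
    ⊛-assoc []      g h = ≋-refl
    ⊛-assoc (a ∷ f) g h = begin
      (a · g ⊕ (0# ∷ f ⊛ g)) ⊛ h
        ≈⟨ ⊛-distribʳ h (a · g) (0# ∷ f ⊛ g) ⟩
      (a · g) ⊛ h ⊕ (0# ∷ f ⊛ g) ⊛ h
        ≈⟨ P.∙-cong (·-⊛ a g h) (0∷-⊛ (f ⊛ g) h refl) ⟩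
      a · (g ⊛ h) ⊕ (0# ∷ (f ⊛ g) ⊛ h)
        ≈⟨ P.∙-congˡ (∷-cong refl (⊛-assoc f g h)) ⟩
      a · (g ⊛ h) ⊕ (0# ∷ f ⊛ (g ⊛ h)) ∎

    ⊛-identityˡ : ∀ f → C 1# ⊛ f ≋ f
    ⊛-identityˡ f = begin
      1# · f ⊕ (0# ∷ [])  ≈⟨ P.∙-cong (1·f≋f f) (∷-zero refl ≋-refl) ⟩
      f ⊕ []              ≈⟨ ⊕-identityʳ f ⟩
      f                   ∎

  polynomialRing : CommutativeRing c ℓ
  polynomialRing = record
    { Carrier = Poly ; _≈_ = _≋_ ; _+_ = _⊕_ ; _*_ = _⊛_ ; -_ = ⊖_
    ; 0# = [] ; 1# = C 1#
    ; isCommutativeRing = record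
      { isRing = record
        { +-isAbelianGroup = P.isAbelianGroup
        ; *-cong = ⊛-cong
        ; *-assoc = ⊛-assoc
        ; *-identity =
            ⊛-identityˡ , λ f → ≋-trans (⊛-comm f (C 1#)) (⊛-identityˡ f)
        ; distrib = ⊛-distribˡ , ⊛-distribʳ
        }
      ; *-comm = ⊛-comm
      }
    }

module PolynomialDomain {c ℓ} (D : Domain c ℓ) where
  open Domain D
  open Polynomial commutativeRing
  private
    module P = CommutativeRing polynomialRing

    ∷-dec : ∀ {f g} → Dec (coeff f 0 ≈ coeff g 0) →
            Dec (∀ n → coeff f (suc n) ≈ coeff g (suc n)) → Dec (f ≋ g)
    ∷-dec (no  h) _       = no λ e → h (at e 0)
    ∷-dec (yes _) (no  t) = no λ e → t (at e ∘ suc)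
    ∷-dec (yes h) (yes t) = yes (mk λ { zero → h ; (suc n) → t n })

    _≋?_ : Decidable _≋_
    []      ≋? []      = yes P.refl
    []      ≋? (b ∷ g) = ∷-dec (0# ≟ b) (map′ at mk ([] ≋? g))
    (a ∷ f) ≋? []      = ∷-dec (a ≟ 0#) (map′ at mk (f ≋? []))
    (a ∷ f) ≋? (b ∷ g) = ∷-dec (a ≟ b) (map′ at mk (f ≋? g))

    -- If the constant term a of the first factor is nonzero, the second
    -- factor vanishes, coefficient by coefficient.
    cancel : ∀ {a} f g → ¬ a ≈ 0# → (a ∷ f) ⊛ g ≋ [] → g ≋ []
    cancel         f []      a≉0 e = P.refl
    cancel {a}     f (b ∷ g) a≉0 e =
      mk λ { zero → b≈0 ; (suc n) → at (cancel f g a≉0 (mk tail)) n }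
      where
      b≈0 : b ≈ 0#
      b≈0 with noZeroDivisors (trans (sym (+-identityʳ (a * b))) (at e 0))
      ... | inj₁ a≈0 = ⊥-elim (a≉0 a≈0)
      ... | inj₂ b≈0 = b≈0

      g≋ : (b ∷ g) P.≈ (0# ∷ g)
      g≋ = mk λ { zero → b≈0 ; (suc n) → refl }

      shift : (a ∷ f) ⊛ (b ∷ g) ≋ (0# ∷ (a ∷ f) ⊛ g)
      shift = P.trans (P.*-congˡ {a ∷ f} g≋) (P.trans
        (P.*-comm (a ∷ f) (0# ∷ g))
        (P.trans (0∷-⊛ g (a ∷ f) refl)
          (mk λ { zero → refl ; (suc n) → at (P.*-comm g (a ∷ f)) n })))

      tail : ∀ n → coeff ((a ∷ f) ⊛ g) n ≈ 0#
      tail n = trans (sym (at shift (suc n))) (at e (suc n))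

    ⊛-noZeroDivisors : ∀ f g → f ⊛ g ≋ [] → f ≋ [] ⊎ g ≋ []
    ⊛-noZeroDivisors []      g e = inj₁ P.refl
    ⊛-noZeroDivisors (a ∷ f) g e with a ≟ 0#
    ... | no  a≉0 = inj₂ (cancel f g a≉0 e)
    ... | yes a≈0 with ⊛-noZeroDivisors f g
            (mk (at (P.trans (P.sym (0∷-⊛ f g a≈0)) e) ∘ suc))
    ...   | inj₁ f≋0 = inj₁ (mk λ { zero → a≈0 ; (suc n) → at f≋0 n })
    ...   | inj₂ g≋0 = inj₂ g≋0

  polynomialDomain : Domain c ℓ
  polynomialDomain = record
    { commutativeRing = polynomialRing
    ; _≟_             = _≋?_
    ; 1≉0             = λ e → 1≉0 (at e 0)
    ; noZeroDivisors  = λ {f} {g} → ⊛-noZeroDivisors f g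
    }

module Fractions {c ℓ} (D : Domain c ℓ) where
  open Domain D
  private
    module M = Algebra.Properties.CommutativeSemigroup *-commutativeSemigroup
    module RP = Algebra.Properties.Ring ring
    open Relation.Binary.Reasoning.Setoid setoid

  record Fraction : Set (c ⊔ ℓ) where
    constructor frac
    field
      num   : Carrier
      den   : Carrier
      den≉0 : ¬ den ≈ 0#
  open Fraction public

  infix 4 _≃_
  record _≃_ (x y : Fraction) : Set ℓ where
    constructor mk
    field cross : num x * den y ≈ num y * den x
  open _≃_ public

  ι : Carrier → Fraction
  ι a = frac a 1# 1≉0

  private
    *-nonzero : ∀ {a b} → ¬ a ≈ 0# → ¬ b ≈ 0# → ¬ a * b ≈ 0#
    *-nonzero a≉0 b≉0 e = [ a≉0 , b≉0 ]′ (noZeroDivisors e)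

    cancelʳ : ∀ {a b d} → ¬ d ≈ 0# → a * d ≈ b * d → a ≈ b
    cancelʳ {a} {b} {d} d≉0 e with noZeroDivisors {a - b} {d} (begin
      (a - b) * d        ≈⟨ distribʳ d a (- b) ⟩
      a * d + - b * d    ≈⟨ +-cong e (sym (RP.-‿distribˡ-* b d)) ⟩
      b * d + - (b * d)  ≈⟨ -‿inverseʳ (b * d) ⟩
      0#                 ∎)
    ... | inj₁ a-b≈0 = RP.x∙y⁻¹≈ε⇒x≈y a b a-b≈0
    ... | inj₂ d≈0   = ⊥-elim (d≉0 d≈0)

  infixl 6 _⊞_
  infixl 7 _⊠_
  infix  8 ⊟_
  infix  9 _⁻¹

  _⊞_ _⊠_ : Fraction → Fraction → Fraction
  frac a b b≉0 ⊞ frac d e e≉0 = frac (a * e + d * b) (b * e) (*-nonzero b≉0 e≉0)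
  frac a b b≉0 ⊠ frac d e e≉0 = frac (a * d) (b * e) (*-nonzero b≉0 e≉0)

  ⊟_ : Fraction → Fraction
  ⊟ frac a b b≉0 = frac (- a) b b≉0

  _⁻¹ : Fraction → Fraction
  frac a b b≉0 ⁻¹ with a ≟ 0#
  ... | yes _   = ι 0#
  ... | no  a≉0 = frac b a a≉0

  private
    ≃-refl : ∀ {x} → x ≃ x
    ≃-refl = mk refl

    ≃-sym : ∀ {x y} → x ≃ y → y ≃ x
    ≃-sym (mk e) = mk (sym e)

    ≃-trans : ∀ {x y z} → x ≃ y → y ≃ z → x ≃ z
    ≃-trans {frac a b _} {frac d e e≉0} {frac f g _} (mk p) (mk q) =
      mk (cancelʳ e≉0 (begin
        a * g * e    ≈⟨ M.xy∙z≈xz∙y a g e ⟩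
        a * e * g    ≈⟨ *-congʳ p ⟩
        d * b * g    ≈⟨ M.xy∙z≈xz∙y d b g ⟩
        d * g * b    ≈⟨ *-congʳ q ⟩
        f * e * b    ≈⟨ M.xy∙z≈xz∙y f e b ⟩
        f * b * e    ∎))

    ⊞-cong : ∀ {x y u v} → x ≃ y → u ≃ v → x ⊞ u ≃ y ⊞ v
    ⊞-cong {frac a b _} {frac a′ b′ _} {frac d e _} {frac d′ e′ _} (mk p) (mk q) =
      mk (begin
        (a * e + d * b) * (b′ * e′)
          ≈⟨ distribʳ _ _ _ ⟩
        a * e * (b′ * e′) + d * b * (b′ * e′)
          ≈⟨ +-cong (M.interchange a e b′ e′)
               (trans (*-congˡ (*-comm b′ e′)) (M.interchange d b e′ b′)) ⟩
        a * b′ * (e * e′) + d * e′ * (b * b′)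
          ≈⟨ +-cong (*-cong p (*-comm e e′)) (*-cong q (*-comm b b′)) ⟩
        a′ * b * (e′ * e) + d′ * e * (b′ * b)
          ≈⟨ +-cong (M.interchange a′ b e′ e)
               (trans (M.interchange d′ e b′ b) (*-congˡ (*-comm e b))) ⟩
        a′ * e′ * (b * e) + d′ * b′ * (b * e)
          ≈⟨ distribʳ _ _ _ ⟨
        (a′ * e′ + d′ * b′) * (b * e) ∎)

    ⊠-cong : ∀ {x y u v} → x ≃ y → u ≃ v → x ⊠ u ≃ y ⊠ v
    ⊠-cong {frac a b _} {frac a′ b′ _} {frac d e _} {frac d′ e′ _} (mk p) (mk q) =
      mk (begin
        a * d * (b′ * e′)    ≈⟨ M.interchange a d b′ e′ ⟩
        a * b′ * (d * e′)    ≈⟨ *-cong p q ⟩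
        a′ * b * (d′ * e)    ≈⟨ M.interchange a′ b d′ e ⟩
        a′ * d′ * (b * e)    ∎)

    ⊟-cong : ∀ {x y} → x ≃ y → ⊟ x ≃ ⊟ y
    ⊟-cong {frac a b _} {frac d e _} (mk p) = mk (begin
      - a * e      ≈⟨ RP.-‿distribˡ-* a e ⟨
      - (a * e)    ≈⟨ -‿cong p ⟩
      - (d * b)    ≈⟨ RP.-‿distribˡ-* d b ⟩
      - d * b      ∎)

    ≈⇒≃ : ∀ {x y} → num x ≈ num y → den x ≈ den y → x ≃ y
    ≈⇒≃ p q = mk (*-cong p (sym q))

    ⊞-assoc : ∀ x y z → (x ⊞ y) ⊞ z ≃ x ⊞ (y ⊞ z)
    ⊞-assoc (frac a b _) (frac d e _) (frac f g _) = ≈⇒≃ (begin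
      (a * e + d * b) * g + f * (b * e)
        ≈⟨ +-cong (distribʳ g _ _) (trans (*-congˡ (*-comm b e)) (sym (*-assoc f e b))) ⟩
      a * e * g + d * b * g + f * e * b
        ≈⟨ +-assoc _ _ _ ⟩
      a * e * g + (d * b * g + f * e * b)
        ≈⟨ +-cong (*-assoc a e g)
             (trans (+-congʳ (M.xy∙z≈xz∙y d b g)) (sym (distribʳ b _ _))) ⟩
      a * (e * g) + (d * g + f * e) * b ∎) (*-assoc b e g)

    ⊞-comm : ∀ x y → x ⊞ y ≃ y ⊞ x
    ⊞-comm (frac a b _) (frac d e _) = ≈⇒≃ (+-comm _ _) (*-comm b e)

    ⊞-identityˡ : ∀ x → ι 0# ⊞ x ≃ x
    ⊞-identityˡ (frac a b _) = ≈⇒≃ (begin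
      0# * b + a * 1#  ≈⟨ +-cong (zeroˡ b) (*-identityʳ a) ⟩
      0# + a           ≈⟨ +-identityˡ a ⟩
      a                ∎) (*-identityˡ b)

    ≈0⇒≃0 : ∀ {x} → num x ≈ 0# → x ≃ ι 0#
    ≈0⇒≃0 {x} e = mk (trans (*-identityʳ (num x)) (trans e (sym (zeroˡ (den x)))))

    ≃0⇒≈0 : ∀ {x} → x ≃ ι 0# → num x ≈ 0#
    ≃0⇒≈0 {x} (mk e) = trans (sym (*-identityʳ (num x))) (trans e (zeroˡ (den x)))

    ⊟-inverseˡ : ∀ x → ⊟ x ⊞ x ≃ ι 0#
    ⊟-inverseˡ (frac a b _) = ≈0⇒≃0 (begin
      - a * b + a * b  ≈⟨ distribʳ b (- a) a ⟨
      (- a + a) * b    ≈⟨ *-congʳ (-‿inverseˡ a) ⟩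
      0# * b           ≈⟨ zeroˡ b ⟩
      0#               ∎)

    ⊠-assoc : ∀ x y z → (x ⊠ y) ⊠ z ≃ x ⊠ (y ⊠ z)
    ⊠-assoc (frac a b _) (frac d e _) (frac f g _) =
      ≈⇒≃ (*-assoc a d f) (*-assoc b e g)

    ⊠-comm : ∀ x y → x ⊠ y ≃ y ⊠ x
    ⊠-comm (frac a b _) (frac d e _) = ≈⇒≃ (*-comm a d) (*-comm b e)

    ⊠-identityˡ : ∀ x → ι 1# ⊠ x ≃ x
    ⊠-identityˡ (frac a b _) = ≈⇒≃ (*-identityˡ a) (*-identityˡ b)

    ⊠-distribˡ : ∀ x y z → x ⊠ (y ⊞ z) ≃ x ⊠ y ⊞ x ⊠ z
    ⊠-distribˡ (frac a b _) (frac d e _) (frac f g _) = mk (begin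
      a * (d * g + f * e) * ((b * e) * (b * g))
        ≈⟨ *-congˡ (trans (M.interchange b e b g) (*-assoc b b (e * g))) ⟩
      a * (d * g + f * e) * (b * (b * (e * g)))
        ≈⟨ *-assoc _ _ _ ⟨
      a * (d * g + f * e) * b * (b * (e * g))
        ≈⟨ *-congʳ (begin
          a * (d * g + f * e) * b
            ≈⟨ *-congʳ (distribˡ a _ _) ⟩
          (a * (d * g) + a * (f * e)) * b
            ≈⟨ distribʳ b _ _ ⟩
          a * (d * g) * b + a * (f * e) * b
            ≈⟨ +-cong (trans (*-congʳ (sym (*-assoc a d g))) (trans (*-assoc (a * d) g b) (*-congˡ (*-comm g b))))
                 (trans (*-congʳ (sym (*-assoc a f e))) (trans (*-assoc (a * f) e b) (*-congˡ (*-comm e b)))) ⟩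
          a * d * (b * g) + a * f * (b * e) ∎) ⟩
      (a * d * (b * g) + a * f * (b * e)) * (b * (e * g)) ∎)

    ≃-commutativeRing : CommutativeRing (c ⊔ ℓ) ℓ
    ≃-commutativeRing = record
      { Carrier = Fraction ; _≈_ = _≃_ ; _+_ = _⊞_ ; _*_ = _⊠_ ; -_ = ⊟_
      ; 0# = ι 0# ; 1# = ι 1#
      ; isCommutativeRing = record
        { isRing = record
          { +-isAbelianGroup = record
            { isGroup = record
              { isMonoid = record
                { isSemigroup = record
                  { isMagma = record
                    { isEquivalence = record
                      { refl = ≃-refl ; sym = ≃-sym ; trans = ≃-trans }
                    ; ∙-cong = ⊞-cong
                    }
                  ; assoc = ⊞-assoc
                  }
                ; identity =
                    ⊞-identityˡ , λ x → ≃-trans (⊞-comm x (ι 0#)) (⊞-identityˡ x)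
                }
              ; inverse =
                  ⊟-inverseˡ , λ x → ≃-trans (⊞-comm x (⊟ x)) (⊟-inverseˡ x)
              ; ⁻¹-cong = ⊟-cong
              }
            ; comm = ⊞-comm
            }
          ; *-cong = ⊠-cong
          ; *-assoc = ⊠-assoc
          ; *-identity =
              ⊠-identityˡ , λ x → ≃-trans (⊠-comm x (ι 1#)) (⊠-identityˡ x)
          ; distrib = ⊠-distribˡ , λ x y z →
              ≃-trans (⊠-comm (y ⊞ z) x) (≃-trans (⊠-distribˡ x y z)
                (⊞-cong (⊠-comm x y) (⊠-comm x z)))
          }
        ; *-comm = ⊠-comm
        }
      }

    ⁻¹-inverse : ∀ {x} → ¬ x ≃ ι 0# → x ⊠ x ⁻¹ ≃ ι 1#
    ⁻¹-inverse {frac a b b≉0} x≄0 with a ≟ 0#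
    ... | yes a≈0 = ⊥-elim (x≄0 (≈0⇒≃0 a≈0))
    ... | no  a≉0 = mk (begin
      a * b * 1#    ≈⟨ *-identityʳ (a * b) ⟩
      a * b         ≈⟨ *-comm a b ⟩
      b * a         ≈⟨ *-identityˡ (b * a) ⟨
      1# * (b * a)  ∎)

    ⁻¹-zero : ∀ {x} → x ≃ ι 0# → x ⁻¹ ≃ ι 0#
    ⁻¹-zero {frac a b b≉0} x≃0 with a ≟ 0#
    ... | yes a≈0 = ≃-refl
    ... | no  a≉0 = ⊥-elim (a≉0 (≃0⇒≈0 x≃0))

  fractionField : Field (c ⊔ ℓ) ℓ
  fractionField = record
    { commutativeRing = ≃-commutativeRing
    ; _≟_             = λ x y → map′ mk cross ((num x * den y) ≟ (num y * den x))
    ; 1≉0             = λ e → 1≉0 (≃0⇒≈0 e)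
    ; _⁻¹             = _⁻¹
    ; *-inverse       = ⁻¹-inverse
    ; ⁻¹-zero         = ⁻¹-zero
    }

module IntegersMod (p : ℕ) where

  infix 4 _≈ₚ_
  record _≈ₚ_ (x y : ℤ) : Set where
    constructor mk
    field divides : + p ℤ∣.∣ x ℤ.- y
  open _≈ₚ_ public

  private
    by : ∀ {x y z} → + p ℤ∣.∣ z → z ≡ x ℤ.- y → x ≈ₚ y
    by d e = mk (≡.subst (+ p ℤ∣.∣_) e d)

    neg-lemma : ∀ x y → ℤ.- (x ℤ.- y) ≡ y ℤ.- x
    neg-lemma = solve-∀

    trans-lemma : ∀ x y z → (x ℤ.- y) ℤ.+ (y ℤ.- z) ≡ x ℤ.- z
    trans-lemma = solve-∀

    +-lemma : ∀ x y u v → (x ℤ.- y) ℤ.+ (u ℤ.- v) ≡ (x ℤ.+ u) ℤ.- (y ℤ.+ v)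
    +-lemma = solve-∀

    *-lemma : ∀ x y u v →
      (x ℤ.- y) ℤ.* u ℤ.+ y ℤ.* (u ℤ.- v) ≡ (x ℤ.* u) ℤ.- (y ℤ.* v)
    *-lemma = solve-∀

    -‿lemma : ∀ x y → ℤ.- (x ℤ.- y) ≡ (ℤ.- x) ℤ.- (ℤ.- y)
    -‿lemma = solve-∀

  ≡⇒≈ₚ : ∀ {x y} → x ≡ y → x ≈ₚ y
  ≡⇒≈ₚ {x} ≡.refl = by (ℤ∣.divides ℤ.0ℤ ≡.refl) (≡.sym (ℤ.+-inverseʳ x))

  private
    ≈ₚ-sym : ∀ {x y} → x ≈ₚ y → y ≈ₚ x
    ≈ₚ-sym {x} {y} (mk d) = by (ℤ∣.∣m⇒∣-m d) (neg-lemma x y)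

    ≈ₚ-trans : ∀ {x y z} → x ≈ₚ y → y ≈ₚ z → x ≈ₚ z
    ≈ₚ-trans {x} {y} {z} (mk d) (mk e) = by (ℤ∣.∣m∣n⇒∣m+n d e) (trans-lemma x y z)

    +-cong : ∀ {x y u v} → x ≈ₚ y → u ≈ₚ v → x ℤ.+ u ≈ₚ y ℤ.+ v
    +-cong {x} {y} {u} {v} (mk d) (mk e) = by (ℤ∣.∣m∣n⇒∣m+n d e) (+-lemma x y u v)

    *-cong : ∀ {x y u v} → x ≈ₚ y → u ≈ₚ v → x ℤ.* u ≈ₚ y ℤ.* v
    *-cong {x} {y} {u} {v} (mk d) (mk e) =
      by (ℤ∣.∣m∣n⇒∣m+n (ℤ∣.∣m⇒∣m*n u d) (ℤ∣.∣n⇒∣m*n y e)) (*-lemma x y u v)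

    neg-cong : ∀ {x y} → x ≈ₚ y → ℤ.- x ≈ₚ ℤ.- y
    neg-cong {x} {y} (mk d) = by (ℤ∣.∣m⇒∣-m d) (-‿lemma x y)

  ℤ/ₚ : CommutativeRing 0ℓ 0ℓ
  ℤ/ₚ = record
    { Carrier = ℤ ; _≈_ = _≈ₚ_ ; _+_ = ℤ._+_ ; _*_ = ℤ._*_ ; -_ = ℤ.-_
    ; 0# = ℤ.0ℤ ; 1# = ℤ.1ℤ
    ; isCommutativeRing = record
      { isRing = record
        { +-isAbelianGroup = record
          { isGroup = record
            { isMonoid = record
              { isSemigroup = record
                { isMagma = record
                  { isEquivalence = record
                    { refl = ≡⇒≈ₚ ≡.refl ; sym = ≈ₚ-sym ; trans = ≈ₚ-trans }
                  ; ∙-cong = +-cong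
                  }
                ; assoc = λ x y z → ≡⇒≈ₚ (ℤ.+-assoc x y z)
                }
              ; identity = (λ x → ≡⇒≈ₚ (ℤ.+-identityˡ x)) , (λ x → ≡⇒≈ₚ (ℤ.+-identityʳ x))
              }
            ; inverse = (λ x → ≡⇒≈ₚ (ℤ.+-inverseˡ x)) , (λ x → ≡⇒≈ₚ (ℤ.+-inverseʳ x))
            ; ⁻¹-cong = neg-cong
            }
          ; comm = λ x y → ≡⇒≈ₚ (ℤ.+-comm x y)
          }
        ; *-cong = *-cong
        ; *-assoc = λ x y z → ≡⇒≈ₚ (ℤ.*-assoc x y z)
        ; *-identity = (λ x → ≡⇒≈ₚ (ℤ.*-identityˡ x)) , (λ x → ≡⇒≈ₚ (ℤ.*-identityʳ x))
        ; distrib = (λ x y z → ≡⇒≈ₚ (ℤ.*-distribˡ-+ x y z)) , (λ x y z → ≡⇒≈ₚ (ℤ.*-distribʳ-+ x y z))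
        }
      ; *-comm = λ x y → ≡⇒≈ₚ (ℤ.*-comm x y)
      }
    }

module PrimeField (p : ℕ) (p-prime : Prime p) where
  open IntegersMod p
  open CommutativeRing ℤ/ₚ
  private
    instance
      p≢0 : ℕ.NonZero p
      p≢0 = prime⇒nonZero p-prime

    residue : ∀ x → x ≈ + (x ℤ.%ℕ p)
    residue x = mk (ℤ∣.divides (x ℤ./ℕ p) (≡.trans
      (≡.cong (ℤ._- + (x ℤ.%ℕ p)) (ℤ.a≡a%ℕn+[a/ℕn]*n x p))
      (lemma (+ (x ℤ.%ℕ p)) _)))
      where
      lemma : ∀ r q → (r ℤ.+ q) ℤ.- r ≡ q
      lemma = solve-∀

    x-0 : ∀ x → x ℤ.- ℤ.0ℤ ≡ x
    x-0 = ℤ.+-identityʳ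

    p*≈0 : ∀ y → + y ℤ.* + p ≈ ℤ.0ℤ
    p*≈0 y = mk (ℤ∣.divides (+ y) (x-0 _))

    natInverse : ∀ r → r ℕ.< p → ¬ r ≡ 0 → ∃ λ y → + r * y ≈ 1#
    natInverse r r<p r≢0 with ℕ.coprime-Bézout (ℕ.prime⇒coprime p-prime {{ℕ.≢-nonZero r≢0}} r<p)
    ... | Bézout.-+ x y eq = + y , trans
      (≡⇒≈ₚ (≡.trans (ℤ.*-comm (+ r) (+ y)) (≡.trans (≡.sym (ℤ.pos-* y r))
        (≡.trans (≡.cong +_ (≡.sym eq)) (≡.cong (λ z → ℤ.1ℤ ℤ.+ z) (ℤ.pos-* x p))))))
      (trans (+-congˡ {1#} (p*≈0 x)) (+-identityʳ 1#))
    ... | Bézout.+- x y eq = ℤ.- (+ y) , (begin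
      + r ℤ.* ℤ.- (+ y)                           ≈⟨ ≡⇒≈ₚ (lemma (+ r) (+ y)) ⟩
      1# ℤ.- (1# ℤ.+ + y ℤ.* + r)                 ≈⟨ +-congˡ {1#} (-‿cong (≡⇒≈ₚ
        (≡.trans (≡.cong (λ z → ℤ.1ℤ ℤ.+ z) (≡.sym (ℤ.pos-* y r)))
          (≡.trans (≡.cong +_ eq) (ℤ.pos-* x p))))) ⟩
      1# ℤ.- + x ℤ.* + p                          ≈⟨ +-congˡ {1#} (-‿cong (p*≈0 x)) ⟩
      1#                                          ∎)
      where
      open Relation.Binary.Reasoning.Setoid setoid
      lemma : ∀ a b → a ℤ.* ℤ.- b ≡ ℤ.1ℤ ℤ.- (ℤ.1ℤ ℤ.+ b ℤ.* a)
      lemma = solve-∀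

    reciprocal : ∀ r → r ℕ.< p → ℤ
    reciprocal r r<p with r ℕ.≟ 0
    ... | yes _   = ℤ.0ℤ
    ... | no  r≢0 = proj₁ (natInverse r r<p r≢0)

    reciprocal-inverse : ∀ r (r<p : r ℕ.< p) → ¬ + r ≈ 0# → + r * reciprocal r r<p ≈ 1#
    reciprocal-inverse r r<p r≉0 with r ℕ.≟ 0
    ... | yes ≡.refl = ⊥-elim (r≉0 refl)
    ... | no  r≢0    = proj₂ (natInverse r r<p r≢0)

    reciprocal-zero : ∀ r (r<p : r ℕ.< p) → + r ≈ 0# → reciprocal r r<p ≈ 0#
    reciprocal-zero r r<p r≈0 with r ℕ.≟ 0
    ... | yes _   = refl
    ... | no  r≢0 = ⊥-elim (ℕ.<⇒≱ r<p (ℕ∣.∣⇒≤ {{ℕ.≢-nonZero r≢0}}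
      (ℤ∣.∣⇒∣ᵤ (≡.subst (+ p ℤ∣.∣_) (x-0 (+ r)) (divides r≈0)))))

    inv : ℤ → ℤ
    inv x = reciprocal (x ℤ.%ℕ p) (ℤ.n%ℕd<d x p)

    1≉0 : ¬ 1# ≈ 0#
    1≉0 (mk d) = ℕ.<⇒≱ (ℕ.nonTrivial⇒n>1 p {{prime⇒nonTrivial p-prime}})
      (ℕ∣.∣⇒≤ (ℤ∣.∣⇒∣ᵤ d))

  𝔽 : Field 0ℓ 0ℓ
  𝔽 = record
    { commutativeRing = ℤ/ₚ
    ; _≟_       = λ x y → map′ mk divides (+ p ℤ∣.∣? (x ℤ.- y))
    ; 1≉0       = 1≉0
    ; _⁻¹       = inv
    ; *-inverse = λ {x} x≉0 → trans (*-congʳ (residue x))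
        (reciprocal-inverse _ _ (λ e → x≉0 (trans (residue x) e)))
    ; ⁻¹-zero   = λ {x} x≈0 → reciprocal-zero _ _ (trans (sym (residue x)) x≈0)
    }

-- F = 𝔽ₚ, A = 𝔽ₚ[α], AX = 𝔽ₚ[α][X], K = 𝔽ₚ(α), KX = 𝔽ₚ(α)[X].
-- For each polynomial ring, the module with superscript ᴾ provides the
-- constants C, the variable X and composition.

module Laguerre (p : ℕ) (p-prime : Prime p) where

  open PrimeField p p-prime public using (𝔽)

  module F = Field 𝔽
  module Fᴿ = Ranges F.commutativeRing

  module A  = Domain (PolynomialDomain.polynomialDomain F.domain)
  module Aᴿ = Ranges A.commutativeRing
  module Aᴾ = Polynomial F.commutativeRing

  module AX  = CommutativeRing (Polynomial.polynomialRing A.commutativeRing)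
  module AXᴿ = Ranges (Polynomial.polynomialRing A.commutativeRing)
  module AXᴾ = Polynomial A.commutativeRing

  open Fractions (PolynomialDomain.polynomialDomain F.domain) public
    using (ι; fractionField)
  module K = Field fractionField

  module KX  = CommutativeRing (Polynomial.polynomialRing K.commutativeRing)
  module KXᴿ = Ranges (Polynomial.polynomialRing K.commutativeRing)
  module KXᴾ = Polynomial K.commutativeRing

  α : A.Carrier
  α = Aᴾ.X

  binom : A.Carrier → ℕ → A.Carrier
  binom x m = Aᴿ.∏ 0 m (λ j → x - C (+ j)) * C ((+ (m !)) F.⁻¹)
    where
    open A
    open Aᴾ using (C)

  -- L_{p-1}^{(α)}(X), with coefficients still in 𝔽ₚ[α]; Lᴷ below is its
  -- image in 𝔽ₚ(α)[X].
  L : AX.Carrier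
  L = ∑ 0 p λ k →
        C (binom (α A.- A.1#) (p ∸ 1 ∸ k)) * ((- X) ^ k * C (Aᴾ.C ((+ (k !)) F.⁻¹)))
    where
    open AX
    open AXᴿ
    open AXᴾ using (C; X)

  b : ℕ → ℕ → A.Carrier
  b r s = ∑ 0 p λ k →
            C ((F.- (+ r F.* (+ s) F.⁻¹)) Fᴿ.^ k)
              * (binom (C (+ r) * α - 1#) (p ∸ 1 ∸ k) * binom (C (+ s) * α - 1#) k)
    where
    open A
    open Aᴿ
    open Aᴾ using (C)

  modulus : KX.Carrier
  modulus = X ^ p - C (ι (α Aᴿ.^ p A.- α))
    where
    open KX
    open KXᴿ
    open KXᴾ using (C; X)

  Lᴷ : KX.Carrier
  Lᴷ = map ι L

  IsInverseOfL : KX.Carrier → Set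
  IsInverseOfL G =
    KXᴾ.DegreeBelow p G × modulus KXᴿ.∣ (G KXᴾ.⟨ Lᴷ ⟩ KX.- KXᴾ.X)

  G₀ : KX.Carrier
  G₀ = - ∑ 1 p λ k →
           C (ι (Aᴾ.C ((+ k) F.⁻¹))) * (X ^ k * C ((ι (Aᴿ.∏ 1 k λ s → b 1 s)) K.⁻¹))
    where
    open KX
    open KXᴿ
    open KXᴾ using (C; X)

{-# OPTIONS --safe #-}
module Submission where

-- Let c = α ^ p - α and work modulo X ^ p - c.  The derivation θ = X d/dX descends
-- to this quotient.  The coefficients of L satisfy a first-order recurrence, which
-- together with Wilson's theorem and x ^ (p - 1) - 1 = (x - 1) ⋯ (x - (p - 1))
-- says that L_m(X) := L^{(mα)}(mX) solves θ y = m (X - α) y.  For m prime to p the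
-- solutions are determined by their coefficient of X ^ (p - 1), which is -1 for
-- L_m.  Comparing this coefficient in the solution L_1 L_s for m = s + 1 gives
-- L_1 L_s = b_{1,s}(α) L_{s+1}, hence L ^ k = b_{1,1}(α) ⋯ b_{1,k-1}(α) L_k, and
-- G(L) = - Σ_k L_k / k.  The coefficients of this sum are power sums over 𝔽ₚ of
-- polynomials in k of degree at most p - 2 (after k⁻¹ = k ^ (p - 2)), and so it
-- equals X.  The polynomials b_{1,s} are nonzero since b_{1,s}(0) = 1.  For
-- uniqueness, X - α is a unit of the quotient because X ^ p - α ^ p = -α there, so
-- 1, L, …, L ^ (p - 1) are eigenvectors of (X - α)⁻¹ θ for distinct eigenvalues;
-- they are nonzero, hence linearly independent.

open import Defs
open import Algebra.Bundles using (CommutativeRing; RawRing)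
import Algebra.Definitions.RawMagma
import Algebra.Morphism.Construct.Composition as Composition
open import Algebra.Morphism.Structures using (IsRingHomomorphism)
import Algebra.Properties.CommutativeMonoid.Sum
import Algebra.Properties.CommutativeSemigroup
import Algebra.Properties.CommutativeSemiring.Exp
import Algebra.Properties.Ring
import Algebra.Properties.Semiring.Sum
import Algebra.Solver.Ring
open import Algebra.Solver.Ring.AlmostCommutativeRing
  using (fromCommutativeRing; _-Raw-AlmostCommutative⟶_)
open import Data.Empty using (⊥-elim)
open import Data.Fin.Base using (toℕ)
open import Data.Fin.Properties using (toℕ<n)
open import Data.Integer.Base as ℤ using (ℤ; +_)
import Data.Integer.Divisibility.Signed as ℤ∣
import Data.Integer.Properties as ℤ
open import Data.List.Base using ([]; _∷_; drop; length; map)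
open import Data.Maybe.Base using (Maybe; just; nothing)
open import Data.Nat using (ℕ; zero; suc; _∸_; _≤_; _<_; _!; z≤n; s≤s)
import Data.Nat.Base as ℕ
import Data.Nat.Divisibility as ℕ∣
import Data.Nat.DivMod as ℕ
open import Data.Nat.Primality using (Prime; euclidsLemma; ¬prime[0]; ¬prime[1])
import Data.Nat.Properties as ℕ
open import Data.Product using (_×_; ∃!; _,_)
open import Data.Sum.Base using (_⊎_; inj₁; inj₂; [_,_]′)
open import Data.Vec.Base using (Vec; []; _∷_; replicate)
open import Function.Base using (_∘_)
open import Level using (0ℓ; _⊔_)
open import Relation.Binary.Definitions using (tri<; tri≈; tri>)
open import Relation.Binary.PropositionalEquality.Core as ≡ using (_≡_)
import Relation.Binary.Reasoning.Setoid
open import Relation.Nullary using (¬_; yes; no)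
open import Relation.Nullary.Negation using (contradiction)

-- Formally, the equation for m is solved by X^(-mα) e^(mX), the m-th power of the solution for m =
-- 1. So L plays the role of an exponential, the b_{1,s} measure how far L_m is from L ^ m, and G
-- is, up to these factors, the series of log(1 - Y) truncated below degree p. All L_m live over the
-- same modulus because m ^ p = m in 𝔽ₚ: putting mα and mX for α and X multiplies X ^ p - (α ^ p -
-- α) by m. The quotient is treated as a bare commutative ring. Where a field would allow division,
-- particular elements are cancelled: nonzero residues, the b_{1,s}, and X - α. Between
-- representatives of degree below p a congruence is an equality, which is what makes coefficients
-- comparable. Fermat, Wilson and the power sums have one source, the sums of falling factorials
-- over a period, which telescope.

-- Sums and products over initial ranges

module RangeProperties {c ℓ} (R : CommutativeRing c ℓ) where
  open CommutativeRing R
  open Ranges R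
  private
    module Σ = Algebra.Properties.Semiring.Sum semiring
    module Π = Algebra.Properties.CommutativeMonoid.Sum *-commutativeMonoid

  -- Opaque, so that the summand can be recovered by unification.
  opaque
    ∑< ∏< : ℕ → (ℕ → Carrier) → Carrier
    ∑< n f = ∑ 0 n f
    ∏< n f = ∏ 0 n f

    ∑≡∑< : ∀ m n f → ∑ m (m ℕ.+ n) f ≡ ∑< n (λ k → f (m ℕ.+ k))
    ∑≡∑< m n f rewrite ℕ.m+n∸m≡n m n = ≡.refl

    ∏≡∏< : ∀ m n f → ∏ m (m ℕ.+ n) f ≡ ∏< n (λ k → f (m ℕ.+ k))
    ∏≡∏< m n f rewrite ℕ.m+n∸m≡n m n = ≡.refl

    ∑-empty : ∀ f → ∑< 0 f ≡ 0#
    ∑-empty f = ≡.refl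

    ∏-empty : ∀ f → ∏< 0 f ≡ 1#
    ∏-empty f = ≡.refl

    ∑-first : ∀ n f → ∑< (suc n) f ≡ f 0 + ∑< n (f ∘ suc)
    ∑-first n f = ≡.refl

    ∏-first : ∀ n f → ∏< (suc n) f ≡ f 0 * ∏< n (f ∘ suc)
    ∏-first n f = ≡.refl

    ∑-cong : ∀ n {f g} → (∀ k → k < n → f k ≈ g k) → ∑< n f ≈ ∑< n g
    ∑-cong n e = Σ.sum-cong-≋ {n} λ i → e (toℕ i) (toℕ<n i)

    ∏-cong : ∀ n {f g} → (∀ k → k < n → f k ≈ g k) → ∏< n f ≈ ∏< n g
    ∏-cong n e = Π.sum-cong-≋ {n} λ i → e (toℕ i) (toℕ<n i)

    ∑-+ : ∀ n f g → ∑< n (λ k → f k + g k) ≈ ∑< n f + ∑< n g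
    ∑-+ n f g = Σ.∑-distrib-+ {n} (f ∘ toℕ) (g ∘ toℕ)

    ∑-*ˡ : ∀ n a f → a * ∑< n f ≈ ∑< n (λ k → a * f k)
    ∑-*ˡ n a f = Σ.*-distribˡ-sum {n} a (f ∘ toℕ)

    ∑-last : ∀ n f → ∑< (suc n) f ≈ ∑< n f + f n
    ∑-last zero    f = trans (+-identityʳ _) (sym (+-identityˡ _))
    ∑-last (suc n) f = trans (+-congˡ (∑-last n (f ∘ suc))) (sym (+-assoc _ _ _))

    ∏-last : ∀ n f → ∏< (suc n) f ≈ ∏< n f * f n
    ∏-last zero    f = trans (*-identityʳ _) (sym (*-identityˡ _))
    ∏-last (suc n) f = trans (*-congˡ (∏-last n (f ∘ suc))) (sym (*-assoc _ _ _))

    ∑-zero : ∀ n {f} → (∀ k → k < n → f k ≈ 0#) → ∑< n f ≈ 0#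
    ∑-zero zero    e = refl
    ∑-zero (suc n) e =
      trans (+-cong (e 0 (s≤s z≤n)) (∑-zero n λ k k<n → e (suc k) (s≤s k<n))) (+-identityˡ 0#)

    ∏-zero : ∀ n f k → k < n → f k ≈ 0# → ∏< n f ≈ 0#
    ∏-zero (suc n) f zero    _         e = trans (*-congʳ e) (zeroˡ _)
    ∏-zero (suc n) f (suc k) (s≤s k<n) e =
      trans (*-congˡ (∏-zero n (f ∘ suc) k k<n e)) (zeroʳ _)

-- Ring homomorphisms and identities with integer coefficients

module HomProperties {a ℓ₁ b ℓ₂} (R : CommutativeRing a ℓ₁) (S : CommutativeRing b ℓ₂)
  (h : CommutativeRing.Carrier R → CommutativeRing.Carrier S)
  (h-homo : IsRingHomomorphism (CommutativeRing.rawRing R) (CommutativeRing.rawRing S) h) where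
  private
    module S = CommutativeRing S
  open IsRingHomomorphism h-homo
  private
    module Rᴿ where
      open Ranges R public
      open RangeProperties R public
    module Sᴿ where
      open Ranges S public
      open RangeProperties S public

  ∑-homo : ∀ n f → h (Rᴿ.∑< n f) S.≈ Sᴿ.∑< n (h ∘ f)
  ∑-homo zero    f rewrite Rᴿ.∑-empty f | Sᴿ.∑-empty (h ∘ f) = 0#-homo
  ∑-homo (suc n) f rewrite Rᴿ.∑-first n f | Sᴿ.∑-first n (h ∘ f) =
    S.trans (+-homo _ _) (S.+-congˡ (∑-homo n (f ∘ suc)))

  ∏-homo : ∀ n f → h (Rᴿ.∏< n f) S.≈ Sᴿ.∏< n (h ∘ f)
  ∏-homo zero    f rewrite Rᴿ.∏-empty f | Sᴿ.∏-empty (h ∘ f) = 1#-homo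
  ∏-homo (suc n) f rewrite Rᴿ.∏-first n f | Sᴿ.∏-first n (h ∘ f) =
    S.trans (*-homo _ _) (S.*-congˡ (∏-homo n (f ∘ suc)))

  ^-homo : ∀ x n → h (x Rᴿ.^ n) S.≈ h x Sᴿ.^ n
  ^-homo x zero    = 1#-homo
  ^-homo x (suc n) = S.trans (*-homo _ _) (S.*-congˡ (^-homo x n))

ℤₚ : ℕ → RawRing _ _
ℤₚ p = CommutativeRing.rawRing (IntegersMod.ℤ/ₚ p)

module IntegerSolver (p : ℕ) {c ℓ} (R : CommutativeRing c ℓ)
  (h : ℤ → CommutativeRing.Carrier R)
  (h-homo : IsRingHomomorphism (ℤₚ p) (CommutativeRing.rawRing R) h) where
  open CommutativeRing R
  open IsRingHomomorphism h-homo

  private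
    -- Agrees with h, but interprets the numerals 0 and 1 by 0# and 1# on the nose.
    ⟦_⟧′ : ℤ → Carrier
    ⟦ + 0 ⟧′ = 0#
    ⟦ + 1 ⟧′ = 1#
    ⟦ z   ⟧′ = h z

    ⟦⟧′≈h : ∀ z → ⟦ z ⟧′ ≈ h z
    ⟦⟧′≈h (+ 0)             = sym 0#-homo
    ⟦⟧′≈h (+ 1)             = sym 1#-homo
    ⟦⟧′≈h (+ suc (suc _))   = refl
    ⟦⟧′≈h (ℤ.-[1+ _ ])      = refl

    morphism : ℤₚ p -Raw-AlmostCommutative⟶ fromCommutativeRing R
    morphism = record
      { ⟦_⟧    = ⟦_⟧′
      ; +-homo = λ x y → trans (⟦⟧′≈h _) (trans (+-homo x y) (sym (+-cong (⟦⟧′≈h x) (⟦⟧′≈h y))))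
      ; *-homo = λ x y → trans (⟦⟧′≈h _) (trans (*-homo x y) (sym (*-cong (⟦⟧′≈h x) (⟦⟧′≈h y))))
      ; -‿homo = λ x → trans (⟦⟧′≈h _) (trans (-‿homo x) (sym (-‿cong (⟦⟧′≈h x))))
      ; 0-homo = refl
      ; 1-homo = refl
      }

    dec : ∀ x y → Maybe (⟦ x ⟧′ ≈ ⟦ y ⟧′)
    dec x y with x ℤ.≟ y
    ... | yes ≡.refl = just refl
    ... | no  _      = nothing

  open Algebra.Solver.Ring (ℤₚ p) (fromCommutativeRing R) morphism dec public
    using (solve; _:=_; _:+_; _:*_; _:-_; :-_; con)

-- Monic polynomials with as many known roots as their degree

module MonicRoots {c ℓ} (R : CommutativeRing c ℓ) where
  open CommutativeRing R
  open Ranges R using (_^_)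
  open RangeProperties R
  open Algebra.Properties.Ring ring
  open Relation.Binary.Reasoning.Setoid setoid

  -- The leading coefficient 1 is not listed; the constant term comes first.
  monic : ∀ {d} → Vec Carrier d → Carrier → Carrier
  monic []       x = 1#
  monic (c ∷ cs) x = c + x * monic cs x

  -- Synthetic division: the partial values of Horner's scheme at `r` are the coefficients of the
  -- quotient by x - r, which is monic again.
  divide : ∀ {d} → Carrier → Vec Carrier (suc d) → Vec Carrier d
  divide r (_ ∷ [])         = []
  divide r (_ ∷ cs@(_ ∷ _)) = monic cs r ∷ divide r cs

  private
    sub-add : ∀ a b → a ≈ b + (a - b)
    sub-add a b = begin
      a              ≈⟨ +-identityʳ a ⟨
      a + 0#         ≈⟨ +-congˡ (-‿inverseˡ b) ⟨
      a + (- b + b)  ≈⟨ +-assoc _ _ _ ⟨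
      (a - b) + b    ≈⟨ +-comm _ _ ⟩
      b + (a - b)    ∎

    split : ∀ x r a → x * a ≈ r * a + (x - r) * a
    split x r a = trans (*-congʳ (sub-add x r)) (distribʳ a r (x - r))

  divide-correct : ∀ {d} r (v : Vec Carrier (suc d)) x →
    monic v x ≈ monic v r + (x - r) * monic (divide r v) x
  divide-correct r (c ∷ []) x = begin
    c + x * 1#                     ≈⟨ +-congˡ (split x r 1#) ⟩
    c + (r * 1# + (x - r) * 1#)    ≈⟨ +-assoc _ _ _ ⟨
    c + r * 1# + (x - r) * 1#      ∎
  divide-correct r (c ∷ cs@(_ ∷ _)) x = begin
    c + x * monic cs x
      ≈⟨ +-congˡ (*-congˡ (divide-correct r cs x)) ⟩
    c + x * (monic cs r + (x - r) * monic (divide r cs) x)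
      ≈⟨ +-congˡ (distribˡ _ _ _) ⟩
    c + (x * monic cs r + x * ((x - r) * monic (divide r cs) x))
      ≈⟨ +-congˡ (+-cong (split x r _) (trans (sym (*-assoc _ _ _)) (trans (*-congʳ (*-comm _ _)) (*-assoc _ _ _)))) ⟩
    c + (r * monic cs r + (x - r) * monic cs r + (x - r) * (x * monic (divide r cs) x))
      ≈⟨ +-congˡ (trans (+-assoc _ _ _) (+-congˡ (sym (distribˡ _ _ _)))) ⟩
    c + (r * monic cs r + (x - r) * (monic cs r + x * monic (divide r cs) x))
      ≈⟨ +-assoc _ _ _ ⟨
    c + r * monic cs r + (x - r) * (monic cs r + x * monic (divide r cs) x) ∎

  -- The root `a 0` is split off; at a later root `a k` the factor `a k - a 0` is cancelled, so that
  -- the quotient vanishes there too. Asking for cancellable differences covers every 𝔽ₚ-algebra,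
  -- where the roots will be images of distinct residues.
  monic-roots : ∀ {d} (v : Vec Carrier d) (a : ℕ → Carrier) →
    (∀ i k → i < k → k < d → ∀ {y} → (a k - a i) * y ≈ 0# → y ≈ 0#) →
    (∀ k → k < d → monic v (a k) ≈ 0#) →
    ∀ x → monic v x ≈ ∏< d (λ k → x - a k)
  monic-roots [] a cancel root x = sym (reflexive (∏-empty _))
  monic-roots {suc d} v@(_ ∷ _) a cancel root x = begin
    monic v x
      ≈⟨ quotient x ⟩
    (x - a 0) * monic (divide (a 0) v) x
      ≈⟨ *-congˡ (monic-roots (divide (a 0) v) (a ∘ suc)
           (λ i k i<k k<d → cancel (suc i) (suc k) (s≤s i<k) (s≤s k<d))
           (λ k k<d → cancel 0 (suc k) (s≤s z≤n) (s≤s k<d)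
             (trans (sym (quotient (a (suc k)))) (root (suc k) (s≤s k<d)))) x) ⟩
    (x - a 0) * ∏< d (λ k → x - a (suc k))
      ≡⟨ ∏-first d _ ⟨
    ∏< (suc d) (λ k → x - a k) ∎
    where
    quotient : ∀ x → monic v x ≈ (x - a 0) * monic (divide (a 0) v) x
    quotient x = trans (divide-correct (a 0) v x)
      (trans (+-congʳ (root 0 (s≤s z≤n))) (+-identityˡ _))

  monic-zeros : ∀ d x → monic (replicate d 0#) x ≈ x ^ d
  monic-zeros zero    x = refl
  monic-zeros (suc d) x = trans (+-identityˡ _) (*-congˡ (monic-zeros d x))

-- Period sums, Fermat, Wilson and factorials in an 𝔽ₚ-algebra

module Characteristic (q : ℕ) (p-prime : Prime (suc (suc q))) {c ℓ} (R : CommutativeRing c ℓ)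
  (h : ℤ → CommutativeRing.Carrier R)
  (h-homo : IsRingHomomorphism (ℤₚ (suc (suc q))) (CommutativeRing.rawRing R) h) where

  private
    n p : ℕ
    n = suc q
    p = suc n

  open CommutativeRing R
  open Ranges R using (_^_)
  open RangeProperties R
  open MonicRoots R
  open IntegerSolver p R h h-homo
  open Algebra.Properties.CommutativeSemiring.Exp commutativeSemiring
    using (^-congˡ)
  open Algebra.Properties.Ring ring
  open IsRingHomomorphism h-homo
  open Relation.Binary.Reasoning.Setoid setoid
  private
    module F = Field (PrimeField.𝔽 p p-prime)

  -- `h` starts from the integers with congruence modulo p as equality, so the ring is an 𝔽ₚ-algebra
  -- and `ν` has period p.
  ν ν⁻¹ : ℕ → Carrier
  ν k   = h (+ k)
  ν⁻¹ k = h ((+ k) F.⁻¹)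

  ν-0 : ν 0 ≈ 0#
  ν-0 = 0#-homo

  ν-1 : ν 1 ≈ 1#
  ν-1 = 1#-homo

  ν-suc : ∀ k → ν (suc k) ≈ 1# + ν k
  ν-suc k = trans (+-homo (+ 1) (+ k)) (+-congʳ 1#-homo)

  ν-+ : ∀ j k → ν (j ℕ.+ k) ≈ ν j + ν k
  ν-+ j k = +-homo (+ j) (+ k)

  ν-* : ∀ j k → ν (j ℕ.* k) ≈ ν j * ν k
  ν-* j k = trans (reflexive (≡.cong h (ℤ.pos-* j k))) (*-homo (+ j) (+ k))

  private
    p∣⇒≈0 : ∀ {k} → p ℕ∣.∣ k → + k F.≈ + 0
    p∣⇒≈0 {k} p∣k = IntegersMod.mk (≡.subst (+ p ℤ∣.∣_) (≡.sym (ℤ.+-identityʳ (+ k))) (ℤ∣.∣ᵤ⇒∣ p∣k))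

    ≈0⇒p∣ : ∀ {k} → + k F.≈ + 0 → p ℕ∣.∣ k
    ≈0⇒p∣ {k} (IntegersMod.mk d) = ℤ∣.∣⇒∣ᵤ (≡.subst (+ p ℤ∣.∣_) (ℤ.+-identityʳ (+ k)) d)

  ν-∣ : ∀ {k} → p ℕ∣.∣ k → ν k ≈ 0#
  ν-∣ p∣k = trans (⟦⟧-cong (p∣⇒≈0 p∣k)) 0#-homo

  ν-p : ν p ≈ 0#
  ν-p = ν-∣ ℕ∣.∣-refl

  ν-n : ν n ≈ - 1#
  ν-n = +-inverseʳ-unique 1# (ν n) (trans (sym (ν-suc n)) ν-p)

  ν-inverse : ∀ {k} → ¬ p ℕ∣.∣ k → ν k * ν⁻¹ k ≈ 1#
  ν-inverse {k} p∤k = trans (sym (*-homo (+ k) ((+ k) F.⁻¹)))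
    (trans (⟦⟧-cong (F.*-inverse (p∤k ∘ ≈0⇒p∣))) 1#-homo)

  p∤ : ∀ {k} → 0 < k → k < p → ¬ p ℕ∣.∣ k
  p∤ {suc k} _ k<p p∣k = ℕ.<⇒≱ k<p (ℕ∣.∣⇒≤ p∣k)

  p∤suc : ∀ {k} → k < n → ¬ p ℕ∣.∣ suc k
  p∤suc k<n = p∤ (s≤s z≤n) (s≤s k<n)

  -- The ring may have zero divisors, but the nonzero residues are units in it.
  ν-cancel : ∀ {k} → ¬ p ℕ∣.∣ k → ∀ {x} → ν k * x ≈ 0# → x ≈ 0#
  ν-cancel {k} p∤k {x} e = begin
    x                      ≈⟨ *-identityˡ x ⟨
    1# * x                 ≈⟨ *-congʳ (ν-inverse p∤k) ⟨
    ν k * ν⁻¹ k * x        ≈⟨ solve 3 (λ a b c → a :* b :* c := b :* (a :* c)) refl _ _ _ ⟩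
    ν⁻¹ k * (ν k * x)      ≈⟨ *-congˡ e ⟩
    ν⁻¹ k * 0#             ≈⟨ zeroʳ _ ⟩
    0#                     ∎

  ν-∸ : ∀ {j k} → j ≤ k → ν (k ∸ j) ≈ ν k - ν j
  ν-∸ {j} {k} j≤k = begin
    ν (k ∸ j)              ≈⟨ solve 2 (λ a b → a := a :+ b :- b) refl _ (ν j) ⟩
    ν (k ∸ j) + ν j - ν j  ≈⟨ +-congʳ (ν-+ (k ∸ j) j) ⟨
    ν (k ∸ j ℕ.+ j) - ν j  ≡⟨ ≡.cong (λ i → ν i - ν j) (ℕ.m∸n+n≡m j≤k) ⟩
    ν k - ν j              ∎

  falling : ℕ → Carrier → Carrier
  falling e x = ∏< e (λ j → x - ν j)

  falling-cong : ∀ e {x y} → x ≈ y → falling e x ≈ falling e y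
  falling-cong e x≈y = ∏-cong e λ _ _ → +-congʳ x≈y

  falling-empty : ∀ x y → falling 0 x * y ≈ y
  falling-empty x y = trans (*-congʳ (reflexive (∏-empty _))) (*-identityˡ y)

  falling-last : ∀ e x → falling (suc e) x ≈ falling e x * (x - ν e)
  falling-last e x = ∏-last e (λ j → x - ν j)

  falling-0 : ∀ e → falling (suc e) (ν 0) ≈ 0#
  falling-0 e = trans (reflexive (∏-first e _)) (trans (*-congʳ (-‿inverseʳ (ν 0))) (zeroˡ _))

  falling-shift : ∀ e x → ∏< e (λ j → x - ν (suc j)) ≈ falling e (x - 1#)
  falling-shift e x = ∏-cong e λ j _ → trans (+-congˡ (-‿cong (ν-suc j)))
    (solve 2 (λ x y → x :- (con (+ 1) :+ y) := x :- con (+ 1) :- y) refl x (ν j))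

  -- Removing the first factor on the left and the last factor of `falling (suc e) x` leaves
  -- `falling e x` in both cases. This is the discrete form of the derivative of x ^ (e + 1).
  falling-difference : ∀ e x →
    falling (suc e) (x + 1#) ≈ falling (suc e) x + ν (suc e) * falling e x
  falling-difference e x = begin
    falling (suc e) (x + 1#)
      ≡⟨ ∏-first e _ ⟩
    (x + 1# - ν 0) * ∏< e (λ j → x + 1# - ν (suc j))
      ≈⟨ *-cong (+-congˡ (-‿cong ν-0)) (trans (falling-shift e (x + 1#))
           (falling-cong e (solve 1 (λ x → x :+ con (+ 1) :- con (+ 1) := x) refl x))) ⟩
    (x + 1# - 0#) * falling e x
      ≈⟨ solve 3 (λ x y f → (x :+ con (+ 1) :- con (+ 0)) :* f :=
                            f :* (x :- y) :+ (con (+ 1) :+ y) :* f) refl x (ν e) _ ⟩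
    falling e x * (x - ν e) + (1# + ν e) * falling e x
      ≈⟨ +-cong (falling-last e x) (*-congʳ (ν-suc e)) ⟨
    falling (suc e) x + ν (suc e) * falling e x ∎

  -- The sum telescopes by `falling-difference`: falling factorials have falling factorials as
  -- discrete antiderivatives.
  ∑-falling : ∀ e m → ν (suc e) * ∑< m (λ k → falling e (ν k)) ≈ falling (suc e) (ν m)
  ∑-falling e zero    = trans (trans (*-congˡ (reflexive (∑-empty _))) (zeroʳ _)) (sym (falling-0 e))
  ∑-falling e (suc m) = begin
    ν (suc e) * ∑< (suc m) (λ k → falling e (ν k))
      ≈⟨ *-congˡ (∑-last m _) ⟩
    ν (suc e) * (∑< m (λ k → falling e (ν k)) + falling e (ν m))
      ≈⟨ distribˡ _ _ _ ⟩
    ν (suc e) * ∑< m (λ k → falling e (ν k)) + ν (suc e) * falling e (ν m)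
      ≈⟨ +-congʳ (∑-falling e m) ⟩
    falling (suc e) (ν m) + ν (suc e) * falling e (ν m)
      ≈⟨ falling-difference e (ν m) ⟨
    falling (suc e) (ν m + 1#)
      ≈⟨ falling-cong (suc e) (trans (+-comm _ _) (sym (ν-suc m))) ⟩
    falling (suc e) (ν (suc m)) ∎

  ∑ₚ : (ℕ → Carrier) → Carrier
  ∑ₚ = ∑< p

  -- The antiderivative takes the same value at p and at 0. The bound on `e` makes the factor
  -- `ν (suc e)` a unit.
  ∑ₚ-falling : ∀ e → e < n → ∑ₚ (λ k → falling e (ν k)) ≈ 0#
  ∑ₚ-falling e e<n = ν-cancel (p∤suc e<n) (begin
    ν (suc e) * ∑ₚ (λ k → falling e (ν k))  ≈⟨ ∑-falling e p ⟩
    falling (suc e) (ν p)                   ≈⟨ falling-cong (suc e) (trans ν-p (sym ν-0)) ⟩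
    falling (suc e) (ν 0)                   ≈⟨ falling-0 e ⟩
    0#                                      ∎)

  -- The first sum that telescoping leaves open, since its factor `ν (suc n)` is zero. It is carried
  -- along as an unknown until `top≈-1`.
  top : Carrier
  top = ∑ₚ (λ k → falling n (ν k))

  -- Sums over a full period of a polynomial g of degree d with leading
  -- coefficient l.  The factor falling e makes the induction on d go through,
  -- since x · falling e x = falling (suc e) x + e · falling e x.
  record Moments (d : ℕ) (l : Carrier) (g : ℕ → Carrier) : Set ℓ where
    field
      below : ∀ e → e ℕ.+ d < n → ∑ₚ (λ k → falling e (ν k) * g k) ≈ 0#
      exact : ∀ e → e ℕ.+ d ≡ n → ∑ₚ (λ k → falling e (ν k) * g k) ≈ l * top
  open Moments

  moments-1 : Moments 0 1# (λ _ → 1#)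
  below moments-1 e e<n = trans (∑-cong p λ _ _ → *-identityʳ _)
    (∑ₚ-falling e (≡.subst (_< n) (ℕ.+-identityʳ e) e<n))
  exact moments-1 e e≡n with ≡.refl ← ≡.trans (≡.sym (ℕ.+-identityʳ e)) e≡n =
    trans (∑-cong p λ _ _ → *-identityʳ _) (sym (*-identityˡ _))

  moments-linear : ∀ u v {d l g} → Moments d l g →
    Moments (suc d) (u * l) (λ k → (u * ν k + v) * g k)
  moments-linear u v {d} {l} {g} M = record
    { below = λ e lt → let lt′ = ≡.subst (_< n) (ℕ.+-suc e d) lt in begin
        _                                              ≈⟨ step e ⟩
        u * m (suc e) + (u * ν e + v) * m e            ≈⟨ +-cong (*-congˡ (below M (suc e) lt′))
                                                            (*-congˡ (below M e (ℕ.<-trans (ℕ.n<1+n _) lt′))) ⟩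
        u * 0# + (u * ν e + v) * 0#                    ≈⟨ trans (+-cong (zeroʳ _) (zeroʳ _)) (+-identityˡ _) ⟩
        0#                                             ∎
    ; exact = λ e eq → let eq′ = ≡.trans (≡.sym (ℕ.+-suc e d)) eq in begin
        _                                              ≈⟨ step e ⟩
        u * m (suc e) + (u * ν e + v) * m e            ≈⟨ +-cong (*-congˡ (exact M (suc e) eq′))
                                                            (*-congˡ (below M e (ℕ.≤-reflexive eq′))) ⟩
        u * (l * top) + (u * ν e + v) * 0#             ≈⟨ trans (+-cong (sym (*-assoc _ _ _)) (zeroʳ _)) (+-identityʳ _) ⟩
        u * l * top                                    ∎
    }
    where
    m : ℕ → Carrier
    m e = ∑ₚ (λ k → falling e (ν k) * g k)

    step : ∀ e → ∑ₚ (λ k → falling e (ν k) * ((u * ν k + v) * g k)) ≈ u * m (suc e) + (u * ν e + v) * m e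
    step e = begin
      ∑ₚ (λ k → falling e (ν k) * ((u * ν k + v) * g k))
        ≈⟨ ∑-cong p (λ k _ → trans
             (solve 6 (λ f u x v g e → f :* ((u :* x :+ v) :* g) :=
               u :* (f :* (x :- e) :* g) :+ (u :* e :+ v) :* (f :* g)) refl _ u (ν k) v (g k) (ν e))
             (+-congʳ (*-congˡ (*-congʳ (sym (falling-last e (ν k))))))) ⟩
      ∑ₚ (λ k → u * (falling (suc e) (ν k) * g k) + (u * ν e + v) * (falling e (ν k) * g k))
        ≈⟨ ∑-+ p _ _ ⟩
      _ ≈⟨ +-cong (∑-*ˡ p u _) (∑-*ˡ p (u * ν e + v) _) ⟨
      u * m (suc e) + (u * ν e + v) * m e ∎

  moments-cong : ∀ {d l l′ f g} → l ≈ l′ → (∀ k → f k ≈ g k) → Moments d l f → Moments d l′ g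
  moments-cong l≈l′ f≈g M = record
    { below = λ e lt → trans (∑-cong p λ k _ → *-congˡ (sym (f≈g k))) (below M e lt)
    ; exact = λ e eq → trans (∑-cong p λ k _ → *-congˡ (sym (f≈g k))) (trans (exact M e eq) (*-congʳ l≈l′))
    }

  moments-∏ : ∀ u (v : ℕ → Carrier) d {e l g} → Moments e l g →
    Moments (d ℕ.+ e) (u ^ d * l) (λ k → ∏< d (λ i → u * ν k + v i) * g k)
  moments-∏ u v zero    M = moments-cong (sym (*-identityˡ _))
    (λ _ → sym (trans (*-congʳ (reflexive (∏-empty _))) (*-identityˡ _))) M
  moments-∏ u v (suc d) M = moments-cong (sym (*-assoc _ _ _))
    (λ _ → trans (sym (*-assoc _ _ _)) (*-congʳ (sym (reflexive (∏-first d _)))))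
    (moments-linear u (v 0) (moments-∏ u (v ∘ suc) d M))

  moments-^ : ∀ u d {e l g} → Moments e l g →
    Moments (d ℕ.+ e) (u ^ d * l) (λ k → (u * ν k) ^ d * g k)
  moments-^ u zero    M = moments-cong (sym (*-identityˡ _)) (λ _ → sym (*-identityˡ _)) M
  moments-^ u (suc d) M = moments-cong (sym (*-assoc _ _ _))
    (λ _ → trans (*-congʳ (+-identityʳ _)) (sym (*-assoc _ _ _)))
    (moments-linear u 0# (moments-^ u d M))

  ∑ₚ-below : ∀ {d l g} → Moments d l g → d < n → ∑ₚ g ≈ 0#
  ∑ₚ-below M d<n = trans (∑-cong p λ k _ → sym (falling-empty (ν k) _)) (below M 0 d<n)

  ∑ₚ-exact : ∀ {d l g} → Moments d l g → d ≡ n → ∑ₚ g ≈ l * top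
  ∑ₚ-exact M d≡n = trans (∑-cong p λ k _ → sym (falling-empty (ν k) _)) (exact M 0 d≡n)

  private
    γ : Carrier
    γ = ∏< n (λ i → - ν (suc i))

    γ-cancel : ∀ m → m ≤ n → ∀ {x} → ∏< m (λ i → - ν (suc i)) * x ≈ 0# → x ≈ 0#
    γ-cancel zero    m≤n {x} e =
      trans (sym (*-identityˡ x)) (trans (*-congʳ (sym (reflexive (∏-empty _)))) e)
    γ-cancel (suc m) m<n {x} e = ν-cancel (p∤suc m<n)
      (γ-cancel m (ℕ.<⇒≤ m<n) (begin
        Π * (ν (suc m) * x)      ≈⟨ solve 3 (λ a b c → a :* (b :* c) := :- (a :* (:- b) :* c)) refl _ _ x ⟩
        - (Π * - ν (suc m) * x)  ≈⟨ -‿cong (*-congʳ (∏-last m _)) ⟨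
        - (∏< (suc m) (λ i → - ν (suc i)) * x)  ≈⟨ -‿cong e ⟩
        - 0#                     ≈⟨ -0#≈0# ⟩
        0#                       ∎))
      where Π = ∏< m (λ i → - ν (suc i))

    -- Only the term k = 0 of Σ_k Π_i (m k - i) survives, as m k is otherwise
    -- congruent to some i between 1 and p - 1.
    ν^n*top : ∀ m → ¬ p ℕ∣.∣ m → ν m ^ n * top ≈ γ
    ν^n*top m p∤m = begin
      ν m ^ n * top
        ≈⟨ ∑ₚ-exact (moments-cong (*-identityʳ _) (λ _ → *-identityʳ _)
             (moments-∏ (ν m) (λ i → - ν (suc i)) n moments-1)) (ℕ.+-identityʳ n) ⟨
      ∑ₚ f
        ≡⟨ ∑-first n f ⟩
      f 0 + ∑< n (f ∘ suc)
        ≈⟨ +-cong (∏-cong n (λ i _ → trans (+-congʳ (trans (*-congˡ ν-0) (zeroʳ _))) (+-identityˡ _)))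
             (∑-zero n (λ k k<n → vanish (suc k) (p∤suc k<n))) ⟩
      γ + 0#
        ≈⟨ +-identityʳ γ ⟩
      γ ∎
      where
      f : ℕ → Carrier
      f k = ∏< n (λ i → ν m * ν k - ν (suc i))

      vanish : ∀ k → ¬ p ℕ∣.∣ k → f k ≈ 0#
      vanish k p∤k with (m ℕ.* k) ℕ.% p in eq | ℕ.m%n<n (m ℕ.* k) p
      ... | zero  | _ = contradiction (ℕ∣.m%n≡0⇒n∣m (m ℕ.* k) p eq)
                          ([ p∤m , p∤k ]′ ∘ euclidsLemma m k p-prime)
      ... | suc r | s≤s r<n = ∏-zero n _ r r<n (begin
        ν m * ν k - ν (suc r)
          ≈⟨ +-congʳ (ν-* m k) ⟨
        ν (m ℕ.* k) - ν (suc r)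
          ≡⟨ ≡.cong (λ i → ν i - ν (suc r)) (≡.trans (ℕ.m≡m%n+[m/n]*n (m ℕ.* k) p) (≡.cong (ℕ._+ (m ℕ.* k) ℕ./ p ℕ.* p) eq)) ⟩
        ν (suc r ℕ.+ (m ℕ.* k) ℕ./ p ℕ.* p) - ν (suc r)
          ≈⟨ +-congʳ (trans (ν-+ (suc r) _) (trans (+-congˡ (ν-∣ (ℕ∣.n∣m*n ((m ℕ.* k) ℕ./ p)))) (+-identityʳ _))) ⟩
        ν (suc r) - ν (suc r)
          ≈⟨ -‿inverseʳ _ ⟩
        0# ∎)

  1^ : ∀ k → 1# ^ k ≈ 1#
  1^ zero    = refl
  1^ (suc k) = trans (*-identityˡ _) (1^ k)

  p∤1 : ¬ p ℕ∣.∣ 1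
  p∤1 = p∤ (s≤s z≤n) (s≤s (s≤s z≤n))

  private
    top≈γ : top ≈ γ
    top≈γ = begin
      top               ≈⟨ *-identityˡ _ ⟨
      1# * top          ≈⟨ *-congʳ (trans (^-congˡ n ν-1) (1^ n)) ⟨
      ν 1 ^ n * top     ≈⟨ ν^n*top 1 p∤1 ⟩
      γ                 ∎

  -- The sum over k of the products Π_i (m k - i) is `ν m ^ n * top` by its leading coefficient in k
  -- and `γ` by its only surviving term. Since `γ` does not depend on m, comparison with m = 1 gives
  -- `ν m ^ n * γ ≈ γ`, and `γ` is a product of units.
  fermat : ∀ {m} → ¬ p ℕ∣.∣ m → ν m ^ n ≈ 1#
  fermat {m} p∤m = x∙y⁻¹≈ε⇒x≈y _ _ (γ-cancel n ℕ.≤-refl (begin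
    γ * (ν m ^ n - 1#)      ≈⟨ *-congʳ top≈γ ⟨
    top * (ν m ^ n - 1#)    ≈⟨ solve 2 (λ t x → t :* (x :- con (+ 1)) := x :* t :- t) refl top _ ⟩
    ν m ^ n * top - top     ≈⟨ +-cong (ν^n*top m p∤m) (-‿cong top≈γ) ⟩
    γ - γ                   ≈⟨ -‿inverseʳ γ ⟩
    0#                      ∎))

  ∑-1 : ∀ m {f} → (∀ k → k < m → f k ≈ 1#) → ∑< m f ≈ ν m
  ∑-1 zero    e = trans (reflexive (∑-empty _)) (sym ν-0)
  ∑-1 (suc m) e = trans (reflexive (∑-first m _)) (trans (+-cong (e 0 (s≤s z≤n)) (∑-1 m (λ k k<m → e (suc k) (s≤s k<m)))) (sym (ν-suc m)))

  -- The sum of k ^ (p - 1) over a period is evaluated twice: as that of a monic polynomial of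
  -- degree p - 1 it is `top`, and by Fermat it consists of p - 1 ones.
  top≈-1 : top ≈ - 1#
  top≈-1 = begin
    top                               ≈⟨ *-identityˡ top ⟨
    1# * top                          ≈⟨ *-congʳ (trans (*-identityʳ _) (1^ n)) ⟨
    1# ^ n * 1# * top                 ≈⟨ ∑ₚ-exact (moments-^ 1# n moments-1) (ℕ.+-identityʳ n) ⟨
    ∑ₚ (λ k → (1# * ν k) ^ n * 1#)    ≈⟨ ∑-cong p (λ k _ → trans (*-identityʳ _) (^-congˡ n (*-identityˡ _))) ⟩
    ∑ₚ (λ k → ν k ^ n)                ≡⟨ ∑-first n _ ⟩
    ν 0 ^ n + ∑< n (λ k → ν (suc k) ^ n)
                                      ≈⟨ +-cong (trans (*-congʳ ν-0) (zeroˡ _))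
                                           (∑-1 n (λ k k<n → fermat (p∤suc k<n))) ⟩
    0# + ν n                          ≈⟨ trans (+-identityˡ _) ν-n ⟩
    - 1#                              ∎

  p∤n : ¬ p ℕ∣.∣ n
  p∤n = p∤ (s≤s z≤n) ℕ.≤-refl

  [-1]^n : (- 1#) ^ n ≈ 1#
  [-1]^n = trans (^-congˡ n (sym ν-n)) (fermat p∤n)

  falling-[-1] : ∀ m → falling m (- 1#) ≈ (- 1#) ^ m * ν (m !)
  falling-[-1] zero    = trans (reflexive (∏-empty _)) (trans (sym ν-1) (sym (*-identityˡ _)))
  falling-[-1] (suc m) = begin
    falling (suc m) (- 1#)                  ≈⟨ falling-last m (- 1#) ⟩
    falling m (- 1#) * (- 1# - ν m)         ≈⟨ *-cong (falling-[-1] m) (trans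
                                                 (solve 1 (λ x → :- con (+ 1) :- x := :- (con (+ 1) :+ x)) refl _)
                                                 (-‿cong (sym (ν-suc m)))) ⟩
    (- 1#) ^ m * ν (m !) * - ν (suc m)      ≈⟨ solve 3 (λ s a b → s :* a :* (:- b) := (:- con (+ 1)) :* s :* (b :* a)) refl _ _ _ ⟩
    (- 1#) ^ suc m * (ν (suc m) * ν (m !))  ≈⟨ *-congˡ (ν-* (suc m) (m !)) ⟨
    (- 1#) ^ suc m * ν (suc m !)            ∎

  -- The product of -1, ..., -(p - 1) is (p - 1)! up to the sign (-1) ^ (p - 1) = 1, and it is also
  -- `γ`, whose value is known through `top`.
  wilson : ν (n !) ≈ - 1#
  wilson = begin
    ν (n !)               ≈⟨ *-identityˡ _ ⟨
    1# * ν (n !)          ≈⟨ *-congʳ [-1]^n ⟨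
    (- 1#) ^ n * ν (n !)  ≈⟨ falling-[-1] n ⟨
    falling n (- 1#)      ≈⟨ falling-cong n (+-identityˡ _) ⟨
    falling n (0# - 1#)   ≈⟨ falling-shift n 0# ⟨
    ∏< n (λ i → 0# - ν (suc i))
                          ≈⟨ ∏-cong n (λ _ _ → +-identityˡ _) ⟩
    γ                     ≈⟨ top≈γ ⟨
    top                   ≈⟨ top≈-1 ⟩
    - 1#                  ∎

  -- x ^ (p - 1) - 1 is monic and has the roots 1, …, p - 1.
  falling-n : ∀ x → falling n (x - 1#) ≈ x ^ n - 1#
  falling-n x = begin
    falling n (x - 1#)              ≈⟨ falling-shift n x ⟨
    ∏< n (λ i → x - ν (suc i))     ≈⟨ monic-roots v (ν ∘ suc) cancel root x ⟨
    monic v x                       ≈⟨ value x ⟩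
    x ^ n - 1#                      ∎
    where
    v : Vec Carrier n
    v = - 1# ∷ replicate q 0#

    value : ∀ x → monic v x ≈ x ^ n - 1#
    value x = trans (+-congˡ (*-congˡ (monic-zeros q x))) (+-comm _ _)

    root : ∀ k → k < n → monic v (ν (suc k)) ≈ 0#
    root k k<n = trans (value (ν (suc k)))
      (trans (+-congʳ (fermat (p∤suc k<n))) (-‿inverseʳ 1#))

    cancel : ∀ i k → i < k → k < n → ∀ {y} → (ν (suc k) - ν (suc i)) * y ≈ 0# → y ≈ 0#
    cancel i k i<k k<n e = ν-cancel (p∤ (ℕ.m<n⇒0<n∸m (s≤s i<k)) (ℕ.≤-<-trans (ℕ.m∸n≤m (suc k) (suc i)) (s≤s k<n)))
      (trans (*-congʳ (ν-∸ (ℕ.<⇒≤ (s≤s i<k)))) e)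

  invfact : ℕ → Carrier
  invfact m = ν⁻¹ (m !)

  p∤! : ∀ m → m < p → ¬ p ℕ∣.∣ m !
  p∤! zero    _   = p∤1
  p∤! (suc m) m<p = [ p∤ {suc m} (s≤s z≤n) m<p , p∤! m (ℕ.<-trans (ℕ.n<1+n m) m<p) ]′ ∘ euclidsLemma (suc m) (m !) p-prime

  invfact-suc : ∀ m → suc m < p → invfact m ≈ ν (suc m) * invfact (suc m)
  invfact-suc m m<p = begin
    invfact m                                          ≈⟨ *-identityʳ _ ⟨
    invfact m * 1#                                     ≈⟨ *-congˡ (ν-inverse (p∤! (suc m) m<p)) ⟨
    invfact m * (ν (suc m !) * invfact (suc m))        ≈⟨ *-congˡ (*-congʳ (ν-* (suc m) (m !))) ⟩
    invfact m * (ν (suc m) * ν (m !) * invfact (suc m))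
      ≈⟨ solve 4 (λ a b c d → a :* (b :* c :* d) := c :* a :* (b :* d)) refl _ _ _ _ ⟩
    ν (m !) * invfact m * (ν (suc m) * invfact (suc m))
      ≈⟨ *-congʳ (ν-inverse (p∤! m (ℕ.<-trans (ℕ.n<1+n m) m<p))) ⟩
    1# * (ν (suc m) * invfact (suc m))                 ≈⟨ *-identityˡ _ ⟩
    ν (suc m) * invfact (suc m)                        ∎

  invfact-0 : invfact 0 ≈ 1#
  invfact-0 = trans (sym (*-identityˡ _)) (trans (*-congʳ (sym ν-1)) (ν-inverse p∤1))

  invfact-n : invfact n ≈ - 1#
  invfact-n = begin
    invfact n                  ≈⟨ solve 1 (λ x → x := :- ((:- con (+ 1)) :* x)) refl _ ⟩
    - (- 1# * invfact n)       ≈⟨ -‿cong (*-congʳ wilson) ⟨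
    - (ν (n !) * invfact n)    ≈⟨ -‿cong (ν-inverse (p∤! n ℕ.≤-refl)) ⟩
    - 1#                       ∎

  ν-complement : ∀ {k} → k ≤ n → ν (n ∸ k) ≈ - ν (suc k)
  ν-complement {k} k≤n = begin
    ν (n ∸ k)      ≈⟨ ν-∸ k≤n ⟩
    ν n - ν k      ≈⟨ +-congʳ ν-n ⟩
    - 1# - ν k     ≈⟨ solve 1 (λ x → :- con (+ 1) :- x := :- (con (+ 1) :+ x)) refl _ ⟩
    - (1# + ν k)   ≈⟨ -‿cong (ν-suc k) ⟨
    - ν (suc k)    ∎

  -- By Wilson this says that p - 1 choose k is (-1) ^ k. In the induction, n - k = -(k + 1) modulo
  -- p makes consecutive products opposite.
  invfact-complement : ∀ k → k ≤ n → invfact k * invfact (n ∸ k) ≈ - ((- 1#) ^ k)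
  invfact-complement zero    _   = trans (*-congʳ invfact-0) (trans (*-identityˡ _) invfact-n)
  invfact-complement (suc k) k<n = begin
    invfact (suc k) * invfact j   ≈⟨ +-inverseˡ-unique _ _ (ν-cancel (p∤suc k<n) sum≈0) ⟩
    - (invfact k * invfact (n ∸ k))  ≈⟨ -‿cong (invfact-complement k (ℕ.<⇒≤ k<n)) ⟩
    - (- ((- 1#) ^ k))             ≈⟨ solve 1 (λ x → :- (:- x) := :- ((:- con (+ 1)) :* x)) refl _ ⟩
    - ((- 1#) ^ suc k)             ∎
    where
    j = n ∸ suc k
    suc-j : suc j ≡ n ∸ k
    suc-j = ≡.sym (ℕ.+-∸-assoc 1 k<n)

    sum≈0 : ν (suc k) * (invfact (suc k) * invfact j + invfact k * invfact (n ∸ k)) ≈ 0#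
    sum≈0 = begin
      ν (suc k) * (invfact (suc k) * invfact j + invfact k * invfact (n ∸ k))
        ≈⟨ solve 5 (λ s a b c d → s :* (a :* b :+ c :* d) := s :* a :* b :- (:- s) :* d :* c) refl _ _ _ _ _ ⟩
      ν (suc k) * invfact (suc k) * invfact j - - ν (suc k) * invfact (n ∸ k) * invfact k
        ≈⟨ +-cong (*-congʳ (sym (invfact-suc k (s≤s k<n)))) (-‿cong (*-congʳ (trans
             (*-congʳ (sym (ν-complement (ℕ.<⇒≤ k<n)))) (≡.subst (λ i → ν i * invfact i ≈ invfact j) suc-j
               (sym (invfact-suc j (s≤s (≡.subst (_≤ n) (≡.sym suc-j) (ℕ.m∸n≤m n k))))))))) ⟩
      invfact k * invfact j - invfact j * invfact k
        ≈⟨ solve 2 (λ a b → a :* b :- b :* a := con (+ 0)) refl _ _ ⟩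
      0# ∎

-- Coefficients of the L_m and the polynomials b_{1,s}

module Coefficients (q : ℕ) (p-prime : Prime (suc (suc q))) {c ℓ} (R : CommutativeRing c ℓ)
  (h : ℤ → CommutativeRing.Carrier R)
  (h-homo : IsRingHomomorphism (ℤₚ (suc (suc q))) (CommutativeRing.rawRing R) h)
  (α : CommutativeRing.Carrier R) where

  private
    n p : ℕ
    n = suc q
    p = suc n
    module F where
      open Field (PrimeField.𝔽 p p-prime) public
      open Ranges (IntegersMod.ℤ/ₚ p) public using (_^_)

  open Characteristic q p-prime R h h-homo
  open CommutativeRing R
  open Ranges R using (_^_)
  open RangeProperties R
  open HomProperties (IntegersMod.ℤ/ₚ p) R h h-homo using (^-homo)
  open IntegerSolver p R h h-homo
  open Algebra.Properties.CommutativeSemiring.Exp commutativeSemiring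
    using (^-congˡ; ^-distrib-*; ^-homo-*)
  open Algebra.Properties.Ring ring
  open IsRingHomomorphism h-homo
  open Relation.Binary.Reasoning.Setoid setoid

  binomial : Carrier → ℕ → Carrier
  binomial x m = falling m x * invfact m

  -- The coefficient of X ^ k in the polynomial L with mα and mX for α and X.
  lag : ℕ → ℕ → Carrier
  lag m k = binomial (ν m * α - 1#) (n ∸ k) * ((- ν m) ^ k * invfact k)

  -- b_{1,s}(α)
  connection : ℕ → Carrier
  connection s = ∑ₚ λ k →
    h ((F.- (+ 1 F.* (+ s) F.⁻¹)) F.^ k)
      * (binomial (ν 1 * α - 1#) (n ∸ k) * binomial (ν s * α - 1#) k)

  binomial-cong : ∀ m {x y} → x ≈ y → binomial x m ≈ binomial y m
  binomial-cong m x≈y = *-congʳ (falling-cong m x≈y)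

  binomial-[-1] : ∀ m → m < p → binomial (- 1#) m ≈ (- 1#) ^ m
  binomial-[-1] m m<p = begin
    falling m (- 1#) * invfact m         ≈⟨ *-congʳ (falling-[-1] m) ⟩
    (- 1#) ^ m * ν (m !) * invfact m     ≈⟨ *-assoc _ _ _ ⟩
    (- 1#) ^ m * (ν (m !) * invfact m)   ≈⟨ *-congˡ (ν-inverse (p∤! m m<p)) ⟩
    (- 1#) ^ m * 1#                      ≈⟨ *-identityʳ _ ⟩
    (- 1#) ^ m                           ∎

  [-ν]^n : ∀ {m} → ¬ p ℕ∣.∣ m → (- ν m) ^ n ≈ 1#
  [-ν]^n {m} p∤m = begin
    (- ν m) ^ n            ≈⟨ ^-congˡ n (-1*x≈-x (ν m)) ⟨
    (- 1# * ν m) ^ n       ≈⟨ ^-distrib-* (- 1#) (ν m) n ⟩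
    (- 1#) ^ n * ν m ^ n   ≈⟨ *-cong [-1]^n (fermat p∤m) ⟩
    1# * 1#                ≈⟨ *-identityˡ 1# ⟩
    1#                     ∎

  -- From k + 1 to k the falling factorial gains the factor mα - 1 - j with j = p - 2 - k, which is
  -- mα + k + 1 in characteristic p. The two factorials contribute k + 1 and -(k + 1), and the
  -- latter sign cancels that of `- ν m`.
  lag-suc : ∀ m k → k < n → (ν (suc k) + ν m * α) * lag m (suc k) ≈ ν m * lag m k
  lag-suc m k k<n = begin
    (ν (suc k) + a) * (falling j x * invfact j * (- ν m * w * G))
      ≈⟨ *-congˡ (*-congʳ (*-congˡ (trans (invfact-suc j (s≤s j<n)) (*-congʳ ν-suc-j)))) ⟩
    (ν (suc k) + a) * (falling j x * (- ν (suc k) * invfact (suc j)) * (- ν m * w * G))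
      ≈⟨ solve 7 (λ s a P F M w G → (s :+ a) :* (P :* ((:- s) :* F) :* ((:- M) :* w :* G)) :=
                                    M :* (P :* (a :- (:- s)) :* F :* (w :* (s :* G)))) refl
           (ν (suc k)) a (falling j x) (invfact (suc j)) (ν m) w G ⟩
    ν m * (falling j x * (a - - ν (suc k)) * invfact (suc j) * (w * (ν (suc k) * G)))
      ≈⟨ *-congˡ (*-cong (*-congʳ (*-congˡ (+-congˡ (-‿cong ν-suc-j)))) (*-congˡ (invfact-suc k (s≤s k<n)))) ⟨
    ν m * (falling j x * (a - ν (suc j)) * invfact (suc j) * (w * invfact k))
      ≈⟨ *-congˡ (*-congʳ (*-congʳ (*-congˡ (trans (+-congˡ (-‿cong (ν-suc j)))
           (solve 2 (λ a y → a :- (con (+ 1) :+ y) := a :- con (+ 1) :- y) refl a (ν j)))))) ⟩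
    ν m * (falling j x * (x - ν j) * invfact (suc j) * (w * invfact k))
      ≈⟨ *-congˡ (*-congʳ (*-congʳ (falling-last j x))) ⟨
    ν m * (binomial x (suc j) * (w * invfact k))
      ≡⟨ ≡.cong (λ i → ν m * (binomial x i * (w * invfact k))) suc-j ⟩
    ν m * lag m k ∎
    where
    j = n ∸ suc k
    a = ν m * α
    x = a - 1#
    w = (- ν m) ^ k
    G = invfact (suc k)

    suc-j : suc j ≡ n ∸ k
    suc-j = ≡.sym (ℕ.+-∸-assoc 1 k<n)

    j<n : j < n
    j<n = ≡.subst (_≤ n) (≡.sym suc-j) (ℕ.m∸n≤m n k)

    ν-suc-j : ν (suc j) ≈ - ν (suc k)
    ν-suc-j = trans (reflexive (≡.cong ν suc-j)) (ν-complement (ℕ.<⇒≤ k<n))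

  -- The falling factorial becomes (mα) ^ (p - 1) - 1, from which Fermat removes m. All L_m thus
  -- share their constant coefficient, as they must to satisfy equations over the same modulus.
  lag-0 : ∀ {m} → ¬ p ℕ∣.∣ m → lag m 0 ≈ 1# - α ^ n
  lag-0 {m} p∤m = begin
    falling n (ν m * α - 1#) * invfact n * (1# * invfact 0)
      ≈⟨ *-cong (*-cong (falling-n (ν m * α)) invfact-n) (trans (*-identityˡ _) invfact-0) ⟩
    ((ν m * α) ^ n - 1#) * - 1# * 1#
      ≈⟨ *-congʳ (*-congʳ (+-congʳ (trans (^-distrib-* (ν m) α n) (*-congʳ (fermat p∤m))))) ⟩
    (1# * α ^ n - 1#) * - 1# * 1#
      ≈⟨ solve 1 (λ a → (con (+ 1) :* a :- con (+ 1)) :* (:- con (+ 1)) :* con (+ 1) := con (+ 1) :- a) refl _ ⟩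
    1# - α ^ n ∎

  lag-n : ∀ {m} → ¬ p ℕ∣.∣ m → lag m n ≈ - 1#
  lag-n {m} p∤m = begin
    binomial x (n ∸ n) * ((- ν m) ^ n * invfact n)
      ≡⟨ ≡.cong (λ i → binomial x i * ((- ν m) ^ n * invfact n)) (ℕ.n∸n≡0 n) ⟩
    falling 0 x * invfact 0 * ((- ν m) ^ n * invfact n)
      ≈⟨ *-cong (trans (falling-empty x _) invfact-0) (*-cong ([-ν]^n p∤m) invfact-n) ⟩
    1# * (1# * - 1#)
      ≈⟨ trans (*-identityˡ _) (*-identityˡ _) ⟩
    - 1# ∎
    where x = ν m * α - 1#

  private
    ν⁻¹≈ν^q : ∀ {m} → ¬ p ℕ∣.∣ m → ν⁻¹ m ≈ ν m ^ q
    ν⁻¹≈ν^q {m} p∤m = begin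
      ν⁻¹ m                    ≈⟨ *-identityʳ _ ⟨
      ν⁻¹ m * 1#               ≈⟨ *-congˡ (fermat p∤m) ⟨
      ν⁻¹ m * (ν m * ν m ^ q)  ≈⟨ solve 3 (λ a b c → a :* (b :* c) := b :* a :* c) refl _ _ _ ⟩
      ν m * ν⁻¹ m * ν m ^ q    ≈⟨ *-congʳ (ν-inverse p∤m) ⟩
      1# * ν m ^ q             ≈⟨ *-identityˡ _ ⟩
      ν m ^ q                  ∎

  -- The constant coefficients are equal, so what remains is the sum of k ^ (p - 2). Extending it to
  -- the full period adds 0 ^ (p - 2), which is zero because p is odd.
  ∑-lag-0 : 0 < q → ∑< n (λ k → ν⁻¹ (suc k) * lag (suc k) 0) ≈ 0#
  ∑-lag-0 0<q = begin
    ∑< n (λ k → ν⁻¹ (suc k) * lag (suc k) 0)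
      ≈⟨ ∑-cong n (λ k k<n → trans (*-comm _ _) (*-cong (lag-0 (p∤suc k<n)) (ν⁻¹≈ν^q (p∤suc k<n)))) ⟩
    ∑< n (λ k → (1# - α ^ n) * ν (suc k) ^ q)
      ≈⟨ ∑-*ˡ n _ _ ⟨
    (1# - α ^ n) * ∑< n (λ k → ν (suc k) ^ q)
      ≈⟨ *-congˡ (trans (sym (+-identityˡ _)) (+-congʳ (sym (0^ 0<q)))) ⟩
    (1# - α ^ n) * (ν 0 ^ q + ∑< n (λ k → ν (suc k) ^ q))
      ≡⟨ ≡.cong ((1# - α ^ n) *_) (∑-first n _) ⟨
    (1# - α ^ n) * ∑ₚ (λ k → ν k ^ q)
      ≈⟨ *-congˡ (∑-cong p (λ k _ → trans (*-identityʳ _) (^-congˡ q (*-identityˡ (ν k))))) ⟨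
    (1# - α ^ n) * ∑ₚ (λ k → (1# * ν k) ^ q * 1#)
      ≈⟨ *-congˡ (∑ₚ-below (moments-^ 1# q moments-1) (s≤s (ℕ.≤-reflexive (ℕ.+-identityʳ q)))) ⟩
    (1# - α ^ n) * 0#
      ≈⟨ zeroʳ _ ⟩
    0# ∎
    where
    0^ : ∀ {d} → 0 < d → ν 0 ^ d ≈ 0#
    0^ {suc d} _ = trans (*-congʳ ν-0) (zeroˡ _)

  -- The sum over k = 1, …, p - 1 of a polynomial in k of degree at most p - 2
  -- is minus its value at 0.
  ∑-lag-suc : ∀ i → i ≤ q → ∑< n (λ k → ν⁻¹ (suc k) * lag (suc k) (suc i))
                            ≈ (- ν 0) ^ i * binomial (ν 0 * α - 1#) (q ∸ i) * invfact (suc i)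
  ∑-lag-suc i i≤q = begin
    ∑< n (λ k → ν⁻¹ (suc k) * lag (suc k) (suc i))
      ≈⟨ ∑-cong n (λ k k<n → term (suc k) (p∤suc k<n)) ⟩
    ∑< n (λ k → - (invfact (q ∸ i) * invfact (suc i)) * g (suc k))
      ≈⟨ ∑-*ˡ n _ _ ⟨
    - (invfact (q ∸ i) * invfact (suc i)) * ∑< n (g ∘ suc)
      ≈⟨ *-congˡ (+-inverseʳ-unique (g 0) _ (trans (reflexive (≡.sym (∑-first n g)))
           (trans (∑-cong p λ k _ → *-congˡ (trans (∏-cong (q ∸ i) (λ j _ →
             solve 3 (λ x a y → x :* a :- con (+ 1) :- y := a :* x :+ (:- con (+ 1) :- y)) refl (ν k) α (ν j)))
               (sym (*-identityʳ _))))
             (trans (∑-cong p λ k _ → *-congʳ (^-congˡ i (sym (-1*x≈-x (ν k)))))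
              (∑ₚ-below (moments-^ (- 1#) i (moments-∏ α (λ j → - 1# - ν j) (q ∸ i) moments-1))
              (s≤s (ℕ.≤-reflexive (≡.trans (≡.cong (i ℕ.+_) (ℕ.+-identityʳ _)) (ℕ.m+[n∸m]≡n i≤q))))))))) ⟩
    - (invfact (q ∸ i) * invfact (suc i)) * - g 0
      ≈⟨ solve 4 (λ a b c d → (:- (a :* b)) :* (:- (c :* d)) := c :* (d :* a) :* b) refl _ _ _ _ ⟩
    (- ν 0) ^ i * binomial (ν 0 * α - 1#) (q ∸ i) * invfact (suc i) ∎
    where
    g : ℕ → Carrier
    g k = (- ν k) ^ i * falling (q ∸ i) (ν k * α - 1#)

    -- The reciprocal of m cancels one of the i + 1 factors `- ν m`, which leaves a polynomial in m
    -- of degree i + (q - i) = p - 2, just below the critical degree.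
    term : ∀ m → ¬ p ℕ∣.∣ m →
      ν⁻¹ m * lag m (suc i) ≈ - (invfact (q ∸ i) * invfact (suc i)) * g m
    term m p∤m = begin
      ν⁻¹ m * (falling (q ∸ i) x * invfact (q ∸ i) * (- ν m * (- ν m) ^ i * invfact (suc i)))
        ≈⟨ solve 6 (λ r P F m w G → r :* (P :* F :* ((:- m) :* w :* G)) :=
                                    (m :* r) :* ((:- (F :* G)) :* (w :* P))) refl _ _ _ _ _ _ ⟩
      (ν m * ν⁻¹ m) * (- (invfact (q ∸ i) * invfact (suc i)) * g m)
        ≈⟨ trans (*-congʳ (ν-inverse p∤m)) (*-identityˡ _) ⟩
      - (invfact (q ∸ i) * invfact (suc i)) * g m ∎
      where x = ν m * α - 1#

  -- For i = 0 the power of `- ν 0` is empty, so the value at 0 survives; it is the binomial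
  -- coefficient of -1 over p - 2. For larger i that power makes it zero.
  ∑-lag-1 : ∑< n (λ k → ν⁻¹ (suc k) * lag (suc k) 1) ≈ - 1#
  ∑-lag-1 = begin
    ∑< n (λ k → ν⁻¹ (suc k) * lag (suc k) 1)
      ≈⟨ ∑-lag-suc 0 z≤n ⟩
    1# * binomial (ν 0 * α - 1#) q * invfact 1
      ≈⟨ *-cong (*-congˡ (trans (binomial-cong q (trans (+-congʳ (trans (*-congʳ ν-0) (zeroˡ α))) (+-identityˡ _)))
           (binomial-[-1] q (ℕ.m≤n⇒m≤1+n (ℕ.n<1+n q))))) invfact-1 ⟩
    1# * (- 1#) ^ q * 1#
      ≈⟨ solve 1 (λ x → con (+ 1) :* x :* con (+ 1) := :- ((:- con (+ 1)) :* x)) refl _ ⟩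
    - ((- 1#) ^ n)
      ≈⟨ -‿cong [-1]^n ⟩
    - 1# ∎
    where
    invfact-1 : invfact 1 ≈ 1#
    invfact-1 = trans (sym (*-identityˡ _)) (trans (*-congʳ (sym ν-1))
      (trans (sym (invfact-suc 0 (s≤s (s≤s z≤n)))) invfact-0))

  ∑-lag-2+ : ∀ i → suc i ≤ q → ∑< n (λ k → ν⁻¹ (suc k) * lag (suc k) (suc (suc i))) ≈ 0#
  ∑-lag-2+ i i<q = begin
    ∑< n (λ k → ν⁻¹ (suc k) * lag (suc k) (suc (suc i)))
      ≈⟨ ∑-lag-suc (suc i) i<q ⟩
    - ν 0 * (- ν 0) ^ i * B * G
      ≈⟨ *-congʳ (*-congʳ (*-congʳ (-‿cong ν-0))) ⟩
    - 0# * (- ν 0) ^ i * B * G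
      ≈⟨ solve 3 (λ a b c → (:- con (+ 0)) :* a :* b :* c := con (+ 0)) refl _ _ _ ⟩
    0# ∎
    where
    B = binomial (ν 0 * α - 1#) (q ∸ suc i)
    G = invfact (suc (suc i))

  private
    V : ℕ → Carrier
    V s = h (F.- (+ 1 F.* (+ s) F.⁻¹))

    V-inverse : ∀ {s} → ¬ p ℕ∣.∣ s → - ν s * V s ≈ 1#
    V-inverse {s} p∤s = begin
      - ν s * V s              ≈⟨ *-congˡ (trans (-‿homo _) (-‿cong (trans (*-homo _ _) (*-congʳ ν-1)))) ⟩
      - ν s * - (1# * ν⁻¹ s)   ≈⟨ solve 2 (λ a b → (:- a) :* (:- (con (+ 1) :* b)) := a :* b) refl _ _ ⟩
      ν s * ν⁻¹ s              ≈⟨ ν-inverse p∤s ⟩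
      1#                       ∎

    -- L_s contributes powers of -s, while b_{1,s} is written with powers of -1/s. Since (-s) ^ (p -
    -- 1) = 1, complementary exponents match.
    V^ : ∀ {s} → ¬ p ℕ∣.∣ s → ∀ k → k ≤ n → (- ν s) ^ (n ∸ k) ≈ V s ^ k
    V^ {s} p∤s k k≤n = begin
      u ^ (n ∸ k)                    ≈⟨ *-identityʳ _ ⟨
      u ^ (n ∸ k) * 1#               ≈⟨ *-congˡ (trans (^-congˡ k (V-inverse p∤s)) (1^ k)) ⟨
      u ^ (n ∸ k) * (u * V s) ^ k    ≈⟨ *-congˡ (^-distrib-* u (V s) k) ⟩
      u ^ (n ∸ k) * (u ^ k * V s ^ k)  ≈⟨ *-assoc _ _ _ ⟨
      u ^ (n ∸ k) * u ^ k * V s ^ k  ≈⟨ *-congʳ (^-homo-* u (n ∸ k) k) ⟨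
      u ^ (n ∸ k ℕ.+ k) * V s ^ k    ≡⟨ ≡.cong (λ i → u ^ i * V s ^ k) (ℕ.m∸n+n≡m k≤n) ⟩
      u ^ n * V s ^ k                ≈⟨ *-congʳ ([-ν]^n p∤s) ⟩
      1# * V s ^ k                   ≈⟨ *-identityˡ _ ⟩
      V s ^ k                        ∎
      where u = - ν s

  -- The left side is the coefficient of X ^ (p - 1) in L_1 L_s. In every term the two inverse
  -- factorials and the power of -1 combine to the same constant -1, and the remaining factors are
  -- those of b_{1,s}.
  connection-lag : ∀ {s} → ¬ p ℕ∣.∣ s →
    ∑ₚ (λ k → lag 1 k * lag s (n ∸ k)) ≈ - connection s
  connection-lag {s} p∤s = begin
    ∑ₚ (λ k → lag 1 k * lag s (n ∸ k))  ≈⟨ ∑-cong p (λ k k<p → term k (ℕ.s≤s⁻¹ k<p)) ⟩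
    ∑ₚ (λ k → - 1# * summand k)         ≈⟨ ∑-*ˡ p _ _ ⟨
    - 1# * connection s                 ≈⟨ -1*x≈-x _ ⟩
    - connection s                      ∎
    where
    x = ν 1 * α - 1#
    y = ν s * α - 1#
    summand : ℕ → Carrier
    summand k = h ((F.- (+ 1 F.* (+ s) F.⁻¹)) F.^ k) * (binomial x (n ∸ k) * binomial y k)

    term : ∀ k → k ≤ n → lag 1 k * lag s (n ∸ k) ≈ - 1# * summand k
    term k k≤n = begin
      binomial x (n ∸ k) * ((- ν 1) ^ k * invfact k)
        * (binomial y (n ∸ (n ∸ k)) * ((- ν s) ^ (n ∸ k) * invfact (n ∸ k)))
        ≡⟨ ≡.cong (λ i → lag 1 k * (binomial y i * ((- ν s) ^ (n ∸ k) * invfact (n ∸ k)))) (ℕ.m∸[m∸n]≡n k≤n) ⟩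
      binomial x (n ∸ k) * ((- ν 1) ^ k * invfact k)
        * (binomial y k * ((- ν s) ^ (n ∸ k) * invfact (n ∸ k)))
        ≈⟨ solve 6 (λ a b c d e f → a :* (b :* c) :* (d :* (e :* f)) := b :* (c :* f) :* e :* (a :* d)) refl _ _ _ _ _ _ ⟩
      (- ν 1) ^ k * (invfact k * invfact (n ∸ k)) * (- ν s) ^ (n ∸ k) * (binomial x (n ∸ k) * binomial y k)
        ≈⟨ *-congʳ (*-cong (*-cong (^-congˡ k (-‿cong ν-1)) (invfact-complement k k≤n))
             (trans (V^ p∤s k k≤n) (sym (^-homo _ k)))) ⟩
      (- 1#) ^ k * (- ((- 1#) ^ k)) * h ((F.- (+ 1 F.* (+ s) F.⁻¹)) F.^ k) * (binomial x (n ∸ k) * binomial y k)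
        ≈⟨ trans (*-congʳ (*-congʳ (trans (sym (-‿distribʳ-* _ _)) (-‿cong [-1]^k*[-1]^k)))) (*-assoc _ _ _) ⟩
      - 1# * summand k ∎
      where
      [-1]^k*[-1]^k : (- 1#) ^ k * (- 1#) ^ k ≈ 1#
      [-1]^k*[-1]^k = begin
        (- 1#) ^ k * (- 1#) ^ k  ≈⟨ ^-distrib-* (- 1#) (- 1#) k ⟨
        (- 1# * - 1#) ^ k        ≈⟨ ^-congˡ k (solve 0 ((:- con (+ 1)) :* (:- con (+ 1)) := con (+ 1)) refl) ⟩
        1# ^ k                   ≈⟨ 1^ k ⟩
        1#                       ∎

  -- At α = 0 the sum is geometric with ratio v = -1/s, hence equal to
  -- (v ^ p - 1) / (v - 1) = 1 unless v = 1.
  connection-at-0 : α ≈ 0# → ∀ {s} → ¬ p ℕ∣.∣ s → ¬ p ℕ∣.∣ suc s → connection s ≈ 0# → 1# ≈ 0#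
  connection-at-0 α≈0 {s} p∤s p∤1+s b≈0 = ν-cancel p∤1+s (trans (*-identityʳ _) (begin
    ν (suc s)           ≈⟨ ν-suc s ⟩
    1# + ν s            ≈⟨ solve 1 (λ x → con (+ 1) :+ x := con (+ 1) :- (:- x)) refl _ ⟩
    1# - - ν s          ≈⟨ +-congˡ (-‿cong (trans (sym (*-identityʳ _)) (trans (*-congˡ (sym V≈1)) (V-inverse p∤s)))) ⟩
    1# - 1#             ≈⟨ -‿inverseʳ 1# ⟩
    0#                  ∎))
    where
    v = V s

    geometric : ∀ m → (v - 1#) * ∑< m (λ k → v ^ k) ≈ v ^ m - 1#
    geometric zero    = trans (*-congˡ (reflexive (∑-empty _))) (trans (zeroʳ _) (sym (-‿inverseʳ 1#)))
    geometric (suc m) = begin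
      (v - 1#) * ∑< (suc m) (λ k → v ^ k)             ≈⟨ *-congˡ (∑-last m _) ⟩
      (v - 1#) * (∑< m (λ k → v ^ k) + v ^ m)         ≈⟨ distribˡ _ _ _ ⟩
      (v - 1#) * ∑< m (λ k → v ^ k) + (v - 1#) * v ^ m  ≈⟨ +-congʳ (geometric m) ⟩
      v ^ m - 1# + (v - 1#) * v ^ m                   ≈⟨ solve 2 (λ v w → w :- con (+ 1) :+ (v :- con (+ 1)) :* w := v :* w :- con (+ 1)) refl v _ ⟩
      v ^ suc m - 1#                                  ∎

    at-0 : ∀ m → ν m * α - 1# ≈ - 1#
    at-0 m = trans (+-congʳ (trans (*-congˡ α≈0) (zeroʳ _))) (+-identityˡ _)

    ∑≈b : connection s ≈ ∑ₚ (λ k → v ^ k)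
    ∑≈b = ∑-cong p λ k k<p → begin
      h (_ F.^ k) * (binomial (ν 1 * α - 1#) (n ∸ k) * binomial (ν s * α - 1#) k)
        ≈⟨ *-cong (^-homo _ k) (*-cong
             (trans (binomial-cong (n ∸ k) (at-0 1)) (binomial-[-1] (n ∸ k) (s≤s (ℕ.m∸n≤m n k))))
             (trans (binomial-cong k (at-0 s)) (binomial-[-1] k k<p))) ⟩
      v ^ k * ((- 1#) ^ (n ∸ k) * (- 1#) ^ k)
        ≈⟨ *-congˡ (trans (sym (^-homo-* (- 1#) (n ∸ k) k)) (trans (reflexive (≡.cong ((- 1#) ^_) (ℕ.m∸n+n≡m (ℕ.s≤s⁻¹ k<p)))) [-1]^n)) ⟩
      v ^ k * 1#
        ≈⟨ *-identityʳ _ ⟩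
      v ^ k ∎

    V^n≈1 : v ^ n ≈ 1#
    V^n≈1 = trans (sym (V^ p∤s n ℕ.≤-refl)) (reflexive (≡.cong ((- ν s) ^_) (ℕ.n∸n≡0 n)))

    V≈1 : v ≈ 1#
    V≈1 = x∙y⁻¹≈ε⇒x≈y v 1# (begin
      v - 1#                          ≈⟨ +-congʳ (trans (*-congˡ V^n≈1) (*-identityʳ v)) ⟨
      v ^ p - 1#                      ≈⟨ geometric p ⟨
      (v - 1#) * ∑ₚ (λ k → v ^ k)     ≈⟨ *-congˡ (trans (sym ∑≈b) b≈0) ⟩
      (v - 1#) * 0#                   ≈⟨ zeroʳ _ ⟩
      0#                              ∎)

-- Naturality in the ring: for setting α = 0 and for embedding 𝔽ₚ[α] into 𝔽ₚ(α)

module Naturality (q : ℕ) (p-prime : Prime (suc (suc q)))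
  {c ℓ} (R : CommutativeRing c ℓ)
  (h : ℤ → CommutativeRing.Carrier R)
  (h-homo : IsRingHomomorphism (ℤₚ (suc (suc q))) (CommutativeRing.rawRing R) h)
  (α : CommutativeRing.Carrier R)
  {c′ ℓ′} (S : CommutativeRing c′ ℓ′)
  (φ : CommutativeRing.Carrier R → CommutativeRing.Carrier S)
  (φ-homo : IsRingHomomorphism (CommutativeRing.rawRing R) (CommutativeRing.rawRing S) φ) where

  private
    n p : ℕ
    n = suc q
    p = suc n

  open CommutativeRing S

  φ∘h-homo : IsRingHomomorphism (ℤₚ (suc (suc q))) rawRing (φ ∘ h)
  φ∘h-homo = Composition.isRingHomomorphism trans h-homo φ-homo

  private
    module R where
      open CommutativeRing R public
      open Characteristic q p-prime R h h-homo public
      open Coefficients q p-prime R h h-homo α public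
    module S where
      open Characteristic q p-prime S (φ ∘ h) φ∘h-homo public
      open Coefficients q p-prime S (φ ∘ h) φ∘h-homo (φ α) public
  open IsRingHomomorphism φ-homo
  open HomProperties R S φ φ-homo
  open RangeProperties S
  open Algebra.Properties.CommutativeSemiring.Exp commutativeSemiring using (^-congˡ)

  binomial-homo : ∀ x m → φ (R.binomial x m) ≈ S.binomial (φ x) m
  binomial-homo x m = trans (*-homo _ _) (*-congʳ (trans (∏-homo m _)
    (∏-cong m λ _ _ → trans (+-homo _ _) (+-congˡ (-‿homo _)))))

  private
    x-homo : ∀ m → φ (R.ν m R.* α R.- R.1#) ≈ S.ν m * φ α - 1#
    x-homo m = trans (+-homo _ _) (+-cong (*-homo _ _) (trans (-‿homo _) (-‿cong 1#-homo)))

    binomial-homo′ : ∀ m j → φ (R.binomial (R.ν m R.* α R.- R.1#) j) ≈ S.binomial (S.ν m * φ α - 1#) j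
    binomial-homo′ m j = trans (binomial-homo _ j) (S.binomial-cong j (x-homo m))

  lag-homo : ∀ m k → φ (R.lag m k) ≈ S.lag m k
  lag-homo m k = trans (*-homo _ _) (*-cong (binomial-homo′ m (n ∸ k))
    (trans (*-homo _ _) (*-congʳ (trans (^-homo _ k) (^-congˡ k (-‿homo _))))))

  connection-homo : ∀ s → φ (R.connection s) ≈ S.connection s
  connection-homo s = trans (∑-homo p _) (∑-cong p λ k _ → trans (*-homo _ _)
    (*-congˡ (trans (*-homo _ _) (*-cong (binomial-homo′ 1 (n ∸ k)) (binomial-homo′ s k)))))

  connection-nonzero : φ α ≈ 0# → ∀ {s} → ¬ p ℕ∣.∣ s → ¬ p ℕ∣.∣ suc s → R.connection s R.≈ R.0# → 1# ≈ 0#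
  connection-nonzero φα≈0 {s} p∤s p∤1+s e = S.connection-at-0 φα≈0 p∤s p∤1+s
    (trans (sym (connection-homo s)) (trans (⟦⟧-cong e) 0#-homo))

-- Polynomials through their coefficients

module PolynomialProperties {c ℓ} (R : CommutativeRing c ℓ) where
  open CommutativeRing R
  open Polynomial R
  open Ranges R using (_^_)
  open RangeProperties R
  open Relation.Binary.Reasoning.Setoid setoid
  open Algebra.Properties.Ring ring using (-0#≈0#)
  module P where
    open CommutativeRing polynomialRing public
    open Ranges polynomialRing public using (_^_)
    open RangeProperties polynomialRing public

  coeff-C⊛ : ∀ a f k → coeff (C a ⊛ f) k ≈ a * coeff f k
  coeff-C⊛ a f k = trans (coeff-⊕ (a · f) (0# ∷ []) k)
    (trans (+-cong (coeff-· a f k) (zeros k)) (+-identityʳ _))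
    where
    zeros : ∀ k → coeff (0# ∷ []) k ≈ 0#
    zeros zero    = refl
    zeros (suc k) = refl

  coeff-∸ : ∀ f g k → coeff (f P.- g) k ≈ coeff f k - coeff g k
  coeff-∸ f g k = trans (coeff-⊕ f (⊖ g) k) (+-congˡ (coeff-⊖ g k))

  C-homo : IsRingHomomorphism rawRing P.rawRing C
  C-homo = record
    { isSemiringHomomorphism = record
      { isNearSemiringHomomorphism = record
        { +-isMonoidHomomorphism = record
          { isMagmaHomomorphism = record
            { isRelHomomorphism = record { cong = λ a≈b → mk λ { zero → a≈b ; (suc k) → refl } }
            ; homo = λ _ _ → P.refl
            }
          ; ε-homo = mk λ { zero → refl ; (suc k) → refl }
          }
        ; *-homo = λ a b → mk λ { zero → sym (+-identityʳ _) ; (suc k) → refl }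
        }
      ; 1#-homo = P.refl
      }
    ; -‿homo = λ _ → P.refl
    }

  C-zero : ∀ {a} → a ≈ 0# → C a ≋ []
  C-zero a≈0 = mk λ { zero → a≈0 ; (suc k) → refl }

  -- Evaluation at 0. Over 𝔽ₚ it is the specialisation α = 0 under which the b_{1,s} are seen to be
  -- nonzero.
  coeff₀-homo : IsRingHomomorphism P.rawRing rawRing (λ f → coeff f 0)
  coeff₀-homo = record
    { isSemiringHomomorphism = record
      { isNearSemiringHomomorphism = record
        { +-isMonoidHomomorphism = record
          { isMagmaHomomorphism = record
            { isRelHomomorphism = record { cong = λ f≋g → at f≋g 0 }
            ; homo = λ f g → coeff-⊕ f g 0
            }
          ; ε-homo = refl
          }
        ; *-homo = coeff₀-*
        }
      ; 1#-homo = refl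
      }
    ; -‿homo = λ f → coeff-⊖ f 0
    }
    where
    coeff₀-* : ∀ f g → coeff (f ⊛ g) 0 ≈ coeff f 0 * coeff g 0
    coeff₀-* []      g = sym (zeroˡ _)
    coeff₀-* (a ∷ f) g = trans (coeff-⊕ (a · g) (0# ∷ f ⊛ g) 0)
      (trans (+-identityʳ _) (coeff-· a g 0))

  X⊛ : ∀ f → X ⊛ f ≋ 0# ∷ f
  X⊛ f = P.trans (0∷-⊛ (C 1#) f refl)
    (mk λ { zero → refl ; (suc k) → at (P.*-identityˡ f) k })

  ∷-expand : ∀ a f → a ∷ f ≋ C a ⊕ X ⊛ f
  ∷-expand a f = P.sym (P.trans (P.+-congˡ {C a} (X⊛ f))
    (mk λ { zero → +-identityʳ a ; (suc k) → refl }))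

  coeff-X^⊛-< : ∀ m f k → k < m → coeff (X P.^ m ⊛ f) k ≈ 0#
  coeff-X^⊛-< (suc m) f k k<m = trans (at (P.trans (P.*-assoc X (X P.^ m) f) (X⊛ _)) k) (shifted k k<m)
    where
    shifted : ∀ k → k < suc m → coeff (0# ∷ X P.^ m ⊛ f) k ≈ 0#
    shifted zero    _         = refl
    shifted (suc k) (s≤s k<m) = coeff-X^⊛-< m f k k<m

  coeff-X^⊛-+ : ∀ m f k → coeff (X P.^ m ⊛ f) (m ℕ.+ k) ≈ coeff f k
  coeff-X^⊛-+ zero    f k = at (P.*-identityˡ f) k
  coeff-X^⊛-+ (suc m) f k =
    trans (at (P.trans (P.*-assoc X (X P.^ m) f) (X⊛ _)) (suc (m ℕ.+ k))) (coeff-X^⊛-+ m f k)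

  coeff-⊛ : ∀ f g m → coeff (f ⊛ g) m ≈ ∑< (suc m) (λ k → coeff f k * coeff g (m ∸ k))
  coeff-⊛ []      g m = sym (∑-zero (suc m) λ _ _ → zeroˡ _)
  coeff-⊛ (a ∷ f) g m = begin
    coeff (a · g ⊕ (0# ∷ f ⊛ g)) m
      ≈⟨ coeff-⊕ (a · g) (0# ∷ f ⊛ g) m ⟩
    coeff (a · g) m + coeff (0# ∷ f ⊛ g) m
      ≈⟨ +-cong (coeff-· a g m) (rest m) ⟩
    a * coeff g m + ∑< m (λ k → coeff f k * coeff g (m ∸ suc k))
      ≡⟨ ∑-first m _ ⟨
    ∑< (suc m) (λ k → coeff (a ∷ f) k * coeff g (m ∸ k)) ∎
    where
    rest : ∀ m → coeff (0# ∷ f ⊛ g) m ≈ ∑< m (λ k → coeff f k * coeff g (m ∸ suc k))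
    rest zero    = sym (reflexive (∑-empty _))
    rest (suc m) = coeff-⊛ f g m

  coeff-∑ : ∀ m F k → coeff (P.∑< m F) k ≈ ∑< m (λ i → coeff (F i) k)
  coeff-∑ zero    F k rewrite P.∑-empty F = sym (reflexive (∑-empty _))
  coeff-∑ (suc m) F k rewrite P.∑-first m F = trans (coeff-⊕ (F 0) _ k)
    (trans (+-congˡ (coeff-∑ m (F ∘ suc) k)) (sym (reflexive (∑-first m _))))

  tabulate : ℕ → (ℕ → Carrier) → Poly
  tabulate zero    a = []
  tabulate (suc m) a = a 0 ∷ tabulate m (a ∘ suc)

  coeff-tabulate : ∀ {m k} a → k < m → coeff (tabulate m a) k ≈ a k
  coeff-tabulate {suc m} {zero}  a _         = refl
  coeff-tabulate {suc m} {suc k} a (s≤s k<m) = coeff-tabulate (a ∘ suc) k<m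

  tabulate-degree : ∀ m a → DegreeBelow m (tabulate m a)
  tabulate-degree zero    a k       _         = refl
  tabulate-degree (suc m) a (suc k) (s≤s m≤k) = tabulate-degree m (a ∘ suc) k m≤k

  below-ext : ∀ {m f g} → DegreeBelow m f → DegreeBelow m g →
    (∀ k → k < m → coeff f k ≈ coeff g k) → f ≋ g
  below-ext {m} df dg e = mk λ k → go k (ℕ.<-≤-connex k m)
    where
    go : ∀ k → k < m ⊎ m ≤ k → _
    go k (inj₁ k<m) = e k k<m
    go k (inj₂ m≤k) = trans (df k m≤k) (sym (dg k m≤k))

  tabulate-coeff : ∀ {m f} → DegreeBelow m f → f ≋ tabulate m (coeff f)
  tabulate-coeff {m} {f} df =
    below-ext df (tabulate-degree m _) λ k k<m → sym (coeff-tabulate (coeff f) k<m)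

  ∑-monomials : ∀ m a y → tabulate m a ⟨ y ⟩ ≋ P.∑< m (λ k → C (a k) ⊛ y P.^ k)
  ∑-monomials zero    a y = P.reflexive (≡.sym (P.∑-empty _))
  ∑-monomials (suc m) a y = PR.begin
    C (a 0) ⊕ y ⊛ tabulate m (a ∘ suc) ⟨ y ⟩
      PR.≈⟨ P.+-cong (P.*-identityʳ (C (a 0))) (P.*-congˡ {y} (P.sym (∑-monomials m (a ∘ suc) y))) ⟨
    C (a 0) ⊛ C 1# ⊕ y ⊛ P.∑< m (λ k → C (a (suc k)) ⊛ y P.^ k)
      PR.≈⟨ P.+-congˡ {C (a 0) ⊛ C 1#} (P.trans (P.∑-*ˡ m y _) (P.∑-cong m λ k _ →
           x∙yz≈y∙xz y (C (a (suc k))) (y P.^ k))) ⟩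
    C (a 0) ⊛ C 1# ⊕ P.∑< m (λ k → C (a (suc k)) ⊛ y P.^ suc k)
      PR.≡⟨ P.∑-first m _ ⟨
    P.∑< (suc m) (λ k → C (a k) ⊛ y P.^ k) PR.∎
    where
    module PR = Relation.Binary.Reasoning.Setoid P.setoid
    open Algebra.Properties.CommutativeSemigroup P.*-commutativeSemigroup using (x∙yz≈y∙xz)

  tabulate-⟨X⟩ : ∀ m a → tabulate m a ⟨ X ⟩ ≋ tabulate m a
  tabulate-⟨X⟩ zero    a = P.refl
  tabulate-⟨X⟩ (suc m) a = P.trans (P.+-congˡ {C (a 0)} (P.*-congˡ {X} (tabulate-⟨X⟩ m (a ∘ suc))))
    (P.sym (∷-expand (a 0) _))

  ⟨⟩-congʳ : ∀ f {g h} → g ≋ h → f ⟨ g ⟩ ≋ f ⟨ h ⟩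
  ⟨⟩-congʳ []      g≋h = P.refl
  ⟨⟩-congʳ (a ∷ f) g≋h = P.+-congˡ {C a} (P.*-cong g≋h (⟨⟩-congʳ f g≋h))

  ⟨⟩-congˡ : ∀ {f g} h → f ≋ g → f ⟨ h ⟩ ≋ g ⟨ h ⟩
  ⟨⟩-congˡ {[]}    {[]}    h e = P.refl
  ⟨⟩-congˡ {[]}    {b ∷ g} h e = P.trans (P.sym (P.trans (P.+-identityˡ _) (P.zeroʳ h)))
    (P.+-cong (mk λ { zero → at e 0 ; (suc _) → refl }) (P.*-congˡ {h} (⟨⟩-congˡ {[]} {g} h (mk (at e ∘ suc)))))
  ⟨⟩-congˡ {a ∷ f} {[]}    h e = P.trans
    (P.+-cong (mk λ { zero → at e 0 ; (suc _) → refl }) (P.*-congˡ {h} (⟨⟩-congˡ {f} {[]} h (mk (at e ∘ suc)))))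
    (P.trans (P.+-identityˡ _) (P.zeroʳ h))
  ⟨⟩-congˡ {a ∷ f} {b ∷ g} h e = P.+-cong (mk λ { zero → at e 0 ; (suc _) → refl })
    (P.*-congˡ {h} (⟨⟩-congˡ {f} {g} h (mk (at e ∘ suc))))

  coeff-drop : ∀ m f k → coeff (drop m f) k ≈ coeff f (m ℕ.+ k)
  coeff-drop zero    f       k = refl
  coeff-drop (suc m) []      k = refl
  coeff-drop (suc m) (_ ∷ f) k = coeff-drop m f k

  coeff-length : ∀ f k → length f ≤ k → coeff f k ≈ 0#
  coeff-length []      k       _         = refl
  coeff-length (_ ∷ f) (suc k) (s≤s f≤k) = coeff-length f k f≤k

  -- Replacing the power of X on the right by a constant is reduction modulo X ^ m minus that
  -- constant.
  split-at : ∀ m f → f ≋ tabulate m (coeff f) ⊕ X P.^ m ⊛ drop m f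
  split-at m f = mk λ k → go k (ℕ.<-≤-connex k m)
    where
    hi = X P.^ m ⊛ drop m f
    go : ∀ k → k < m ⊎ m ≤ k → coeff f k ≈ coeff (tabulate m (coeff f) ⊕ hi) k
    go k (inj₁ k<m) = begin
      coeff f k                                      ≈⟨ +-identityʳ _ ⟨
      coeff f k + 0#                                 ≈⟨ +-cong (coeff-tabulate (coeff f) k<m) (coeff-X^⊛-< m (drop m f) k k<m) ⟨
      coeff (tabulate m (coeff f)) k + coeff hi k    ≈⟨ coeff-⊕ (tabulate m (coeff f)) hi k ⟨
      coeff (tabulate m (coeff f) ⊕ hi) k            ∎
    go k (inj₂ m≤k) with j , ≡.refl ← ℕ.m≤n⇒∃[o]m+o≡n m≤k = begin
      coeff f (m ℕ.+ j)                              ≈⟨ coeff-drop m f j ⟨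
      coeff (drop m f) j                             ≈⟨ coeff-X^⊛-+ m (drop m f) j ⟨
      coeff hi (m ℕ.+ j)                             ≈⟨ +-identityˡ _ ⟨
      0# + coeff hi (m ℕ.+ j)                        ≈⟨ +-congʳ (tabulate-degree m (coeff f) _ m≤k) ⟨
      coeff (tabulate m (coeff f)) _ + coeff hi _    ≈⟨ coeff-⊕ (tabulate m (coeff f)) hi _ ⟨
      coeff (tabulate m (coeff f) ⊕ hi) (m ℕ.+ j)    ∎

  -- The successor on one side only makes the bound sharp: two factors of degree at most p - 1 give
  -- degree at most 2p - 2. Reduction of L_1 L_s relies on the degree gained over p + p.
  ⊛-degree : ∀ {m n f g} → DegreeBelow (suc m) f → DegreeBelow n g → DegreeBelow (m ℕ.+ n) (f ⊛ g)
  ⊛-degree {m} {n} {f} {g} df dg k m+n≤k = trans (coeff-⊛ f g k)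
    (∑-zero (suc k) λ i _ → term i (ℕ.<-≤-connex m i))
    where
    term : ∀ i → m < i ⊎ i ≤ m → coeff f i * coeff g (k ∸ i) ≈ 0#
    term i (inj₁ m<i) = trans (*-congʳ (df i m<i)) (zeroˡ _)
    term i (inj₂ i≤m) = trans (*-congˡ (dg (k ∸ i) (ℕ.≤-trans (ℕ.≤-reflexive (≡.sym (ℕ.m+n∸m≡n m n)))
      (ℕ.∸-mono m+n≤k i≤m)))) (zeroʳ _)

  ⊕-degree : ∀ {m f g} → DegreeBelow m f → DegreeBelow m g → DegreeBelow m (f ⊕ g)
  ⊕-degree {f = f} {g} df dg k m≤k = trans (coeff-⊕ f g k) (trans (+-cong (df k m≤k) (dg k m≤k)) (+-identityˡ 0#))

  C⊛-degree : ∀ {m f} a → DegreeBelow m f → DegreeBelow m (C a ⊛ f)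
  C⊛-degree {f = f} a df k m≤k = trans (coeff-C⊛ a f k) (trans (*-congˡ (df k m≤k)) (zeroʳ a))

  ∸-degree : ∀ {m f g} → DegreeBelow m f → DegreeBelow m g → DegreeBelow m (f P.- g)
  ∸-degree {f = f} {g} df dg k m≤k = trans (coeff-∸ f g k)
    (trans (+-cong (df k m≤k) (trans (-‿cong (dg k m≤k)) -0#≈0#)) (+-identityˡ 0#))

-- The derivation X d/dX

module Derivation (q : ℕ) (p-prime : Prime (suc (suc q))) {c ℓ} (R : CommutativeRing c ℓ)
  (h : ℤ → CommutativeRing.Carrier R)
  (h-homo : IsRingHomomorphism (ℤₚ (suc (suc q))) (CommutativeRing.rawRing R) h) where

  open CommutativeRing R
  open Characteristic q p-prime R h h-homo using (ν; ν-0; ν-suc)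
  open Polynomial R
  open PolynomialProperties R

  -- X d/dX
  θ : Poly → Poly
  θ []      = []
  θ (a ∷ f) = 0# ∷ (f ⊕ θ f)

  -- The derivation is diagonal on monomials, so linearity can be read off coefficientwise; only the
  -- Leibniz rule needs an induction on the polynomial.
  coeff-θ : ∀ f k → coeff (θ f) k ≈ ν k * coeff f k
  coeff-θ []      k       = sym (zeroʳ _)
  coeff-θ (a ∷ f) zero    = sym (trans (*-congʳ ν-0) (zeroˡ a))
  coeff-θ (a ∷ f) (suc k) = begin
    coeff (f ⊕ θ f) k              ≈⟨ coeff-⊕ f (θ f) k ⟩
    coeff f k + coeff (θ f) k      ≈⟨ +-cong (sym (*-identityˡ _)) (coeff-θ f k) ⟩
    1# * coeff f k + ν k * coeff f k  ≈⟨ distribʳ _ _ _ ⟨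
    (1# + ν k) * coeff f k         ≈⟨ *-congʳ (ν-suc k) ⟨
    ν (suc k) * coeff f k          ∎
    where open Relation.Binary.Reasoning.Setoid setoid

  θ-cong : ∀ {f g} → f ≋ g → θ f ≋ θ g
  θ-cong {f} {g} f≋g = mk λ k → trans (coeff-θ f k) (trans (*-congˡ (at f≋g k)) (sym (coeff-θ g k)))

  θ-⊕ : ∀ f g → θ (f ⊕ g) ≋ θ f ⊕ θ g
  θ-⊕ f g = mk λ k → trans (coeff-θ (f ⊕ g) k) (trans (*-congˡ (coeff-⊕ f g k)) (trans (distribˡ _ _ _)
    (trans (+-cong (sym (coeff-θ f k)) (sym (coeff-θ g k))) (sym (coeff-⊕ (θ f) (θ g) k)))))

  θ-⊖ : ∀ f → θ (⊖ f) ≋ ⊖ θ f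
  θ-⊖ f = mk λ k → trans (coeff-θ (⊖ f) k) (trans (*-congˡ (coeff-⊖ f k))
    (trans (sym (-‿distribʳ-* _ _)) (trans (-‿cong (sym (coeff-θ f k))) (sym (coeff-⊖ (θ f) k)))))
    where open Algebra.Properties.Ring ring

  θ-C⊛ : ∀ a f → θ (C a ⊛ f) ≋ C a ⊛ θ f
  θ-C⊛ a f = mk λ k → trans (coeff-θ (C a ⊛ f) k) (trans (*-congˡ (coeff-C⊛ a f k))
    (trans (x∙yz≈y∙xz _ _ _) (trans (*-congˡ (sym (coeff-θ f k))) (sym (coeff-C⊛ a (θ f) k)))))
    where open Algebra.Properties.CommutativeSemigroup *-commutativeSemigroup

  θ-C : ∀ a → θ (C a) ≋ []
  θ-C a = mk λ { zero → refl ; (suc k) → refl }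

  θ-X⊛ : ∀ f → θ (X ⊛ f) ≋ X ⊛ f ⊕ X ⊛ θ f
  θ-X⊛ f = P.trans (θ-cong (X⊛ f)) (P.trans (P.sym (X⊛ (f ⊕ θ f))) (P.distribˡ X f (θ f)))

  θ-⊛ : ∀ f g → θ (f ⊛ g) ≋ θ f ⊛ g ⊕ f ⊛ θ g
  θ-⊛ []      g = P.refl
  θ-⊛ (a ∷ f) g = begin
    θ ((a ∷ f) ⊛ g)
      ≈⟨ θ-cong (P.trans (P.*-congʳ {g} (∷-expand a f)) (P.distribʳ g (C a) (X ⊛ f))) ⟩
    θ (C a ⊛ g ⊕ X ⊛ f ⊛ g)
      ≈⟨ P.trans (θ-⊕ (C a ⊛ g) (X ⊛ f ⊛ g)) (P.+-cong (θ-C⊛ a g) (P.trans (θ-cong (P.*-assoc X f g)) (θ-X⊛ (f ⊛ g)))) ⟩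
    C a ⊛ θ g ⊕ (X ⊛ (f ⊛ g) ⊕ X ⊛ θ (f ⊛ g))
      ≈⟨ P.+-congˡ {C a ⊛ θ g} (P.trans (P.sym (P.distribˡ X (f ⊛ g) _))
           (P.*-congˡ {X} (P.+-congˡ {f ⊛ g} (θ-⊛ f g)))) ⟩
    C a ⊛ θ g ⊕ X ⊛ (f ⊛ g ⊕ (θ f ⊛ g ⊕ f ⊛ θ g))
      ≈⟨ P.+-congˡ {C a ⊛ θ g} (P.trans (P.*-congˡ {X} (P.trans (P.sym (P.+-assoc (f ⊛ g) _ _))
           (P.+-congʳ {f ⊛ θ g} (P.sym (P.distribʳ g f (θ f)))))) (P.distribˡ X ((f ⊕ θ f) ⊛ g) (f ⊛ θ g))) ⟩
    C a ⊛ θ g ⊕ (X ⊛ ((f ⊕ θ f) ⊛ g) ⊕ X ⊛ (f ⊛ θ g))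
      ≈⟨ x∙yz≈y∙xz (C a ⊛ θ g) (X ⊛ ((f ⊕ θ f) ⊛ g)) (X ⊛ (f ⊛ θ g)) ⟩
    X ⊛ ((f ⊕ θ f) ⊛ g) ⊕ (C a ⊛ θ g ⊕ X ⊛ (f ⊛ θ g))
      ≈⟨ P.+-cong (P.trans (P.sym (P.*-assoc X (f ⊕ θ f) g)) (P.*-congʳ {g} (X⊛ (f ⊕ θ f))))
           (P.trans (P.+-congˡ {C a ⊛ θ g} (P.sym (P.*-assoc X f (θ g))))
             (P.trans (P.sym (P.distribʳ (θ g) (C a) (X ⊛ f))) (P.*-congʳ {θ g} (P.sym (∷-expand a f))))) ⟩
    θ (a ∷ f) ⊛ g ⊕ (a ∷ f) ⊛ θ g ∎
    where
    open Relation.Binary.Reasoning.Setoid P.setoid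
    open Algebra.Properties.CommutativeSemigroup P.+-commutativeSemigroup

  θ-∑ : ∀ m F → θ (P.∑< m F) ≋ P.∑< m (θ ∘ F)
  θ-∑ zero    F rewrite P.∑-empty F | P.∑-empty (θ ∘ F) = P.refl
  θ-∑ (suc m) F rewrite P.∑-first m F | P.∑-first m (θ ∘ F) =
    P.trans (θ-⊕ (F 0) _) (P.+-congˡ {θ (F 0)} (θ-∑ m (F ∘ suc)))

-- The quotient by a principal ideal

module Congruence (p : ℕ) {c ℓ} (R : CommutativeRing c ℓ)
  (h : ℤ → CommutativeRing.Carrier R)
  (h-homo : IsRingHomomorphism (ℤₚ p) (CommutativeRing.rawRing R) h)
  (m : CommutativeRing.Carrier R) where

  open CommutativeRing R
  open Ranges R using (_∣_)
  open IntegerSolver p R h h-homo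
  open import Algebra.Definitions.RawMagma *-rawMagma using (_,_)

  infix 4 _≅_
  record _≅_ (x y : Carrier) : Set (c ⊔ ℓ) where
    constructor mk
    field divides : m ∣ (x - y)
  open _≅_ public

  private
    by : ∀ {x y} k → k * m ≈ x - y → x ≅ y
    by k e = mk (k , e)

  ≈⇒≅ : ∀ {x y} → x ≈ y → x ≅ y
  ≈⇒≅ {x} {y} x≈y = by 0# (trans (zeroˡ m) (sym (trans (+-congʳ x≈y) (-‿inverseʳ y))))

  multiple≅0 : ∀ k → k * m ≅ 0#
  multiple≅0 k = by k (solve 1 (λ x → x := x :- con (+ 0)) refl _)

  quotientRing : CommutativeRing c (c ⊔ ℓ)
  quotientRing = record
    { Carrier = Carrier ; _≈_ = _≅_ ; _+_ = _+_ ; _*_ = _*_ ; -_ = -_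
    ; 0# = 0# ; 1# = 1#
    ; isCommutativeRing = record
      { isRing = record
        { +-isAbelianGroup = record
          { isGroup = record
            { isMonoid = record
              { isSemigroup = record
                { isMagma = record
                  { isEquivalence = record
                    { refl = ≈⇒≅ refl
                    ; sym = λ { {x} {y} (mk (k , e)) → by (- k) (trans
                        (solve 2 (λ k m → (:- k) :* m := :- (k :* m)) refl k m)
                        (trans (-‿cong e) (solve 2 (λ x y → :- (x :- y) := y :- x) refl x y))) }
                    ; trans = λ { {x} {y} {z} (mk (k , e)) (mk (l , f)) → by (k + l) (trans (distribʳ m k l)
                        (trans (+-cong e f) (solve 3 (λ x y z → x :- y :+ (y :- z) := x :- z) refl x y z))) }
                    }
                  ; ∙-cong = λ { {x} {y} {u} {v} (mk (k , e)) (mk (l , f)) → by (k + l) (trans (distribʳ m k l)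
                      (trans (+-cong e f) (solve 4 (λ x y u v → x :- y :+ (u :- v) := x :+ u :- (y :+ v)) refl x y u v))) }
                  }
                ; assoc = λ x y z → ≈⇒≅ (+-assoc x y z)
                }
              ; identity = (λ x → ≈⇒≅ (+-identityˡ x)) , (λ x → ≈⇒≅ (+-identityʳ x))
              }
            ; inverse = (λ x → ≈⇒≅ (-‿inverseˡ x)) , (λ x → ≈⇒≅ (-‿inverseʳ x))
            ; ⁻¹-cong = λ { {x} {y} (mk (k , e)) → by (- k) (trans
                (solve 2 (λ k m → (:- k) :* m := :- (k :* m)) refl k m)
                (trans (-‿cong e) (solve 2 (λ x y → :- (x :- y) := :- x :- (:- y)) refl x y))) }
            }
          ; comm = λ x y → ≈⇒≅ (+-comm x y)
          }
        ; *-cong = λ { {x} {y} {u} {v} (mk (k , e)) (mk (l , f)) → by (k * u + y * l) (trans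
            (solve 5 (λ k u y l m → (k :* u :+ y :* l) :* m := k :* m :* u :+ y :* (l :* m)) refl k u y l m)
            (trans (+-cong (*-congʳ e) (*-congˡ f))
              (solve 4 (λ x y u v → (x :- y) :* u :+ y :* (u :- v) := x :* u :- y :* v) refl x y u v))) }
        ; *-assoc = λ x y z → ≈⇒≅ (*-assoc x y z)
        ; *-identity = (λ x → ≈⇒≅ (*-identityˡ x)) , (λ x → ≈⇒≅ (*-identityʳ x))
        ; distrib = (λ x y z → ≈⇒≅ (distribˡ x y z)) , (λ x y z → ≈⇒≅ (distribʳ x y z))
        }
      ; *-comm = λ x y → ≈⇒≅ (*-comm x y)
      }
    }

  quotient-homo : IsRingHomomorphism rawRing (CommutativeRing.rawRing quotientRing) (λ x → x)
  quotient-homo = record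
    { isSemiringHomomorphism = record
      { isNearSemiringHomomorphism = record
        { +-isMonoidHomomorphism = record
          { isMagmaHomomorphism = record
            { isRelHomomorphism = record { cong = ≈⇒≅ }
            ; homo = λ _ _ → ≈⇒≅ refl
            }
          ; ε-homo = ≈⇒≅ refl
          }
        ; *-homo = λ _ _ → ≈⇒≅ refl
        }
      ; 1#-homo = ≈⇒≅ refl
      }
    ; -‿homo = λ _ → ≈⇒≅ refl
    }

-- Eigenvector equations in a commutative ring

module EigenLemmas (p : ℕ) {c ℓ} (R : CommutativeRing c ℓ)
  (h : ℤ → CommutativeRing.Carrier R)
  (h-homo : IsRingHomomorphism (ℤₚ p) (CommutativeRing.rawRing R) h) where
  open CommutativeRing R
  open Ranges R using (_^_)
  open IntegerSolver p R h h-homo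
  open Algebra.Properties.Ring ring
  open Relation.Binary.Reasoning.Setoid setoid

  -- Logarithmic derivatives add under multiplication. With the common factor `w` taken out, the
  -- eigenvalues `u` and `v` add.
  product-eigen : ∀ {y z y′ z′ u v w} → y′ ≈ u * (w * y) → z′ ≈ v * (w * z) →
    y′ * z + y * z′ ≈ (u + v) * (w * (y * z))
  product-eigen {y} {z} {y′} {z′} {u} {v} {w} e f = trans (+-cong (*-congʳ e) (*-congˡ f))
    (solve 5 (λ y z u v w → u :* (w :* y) :* z :+ y :* (v :* (w :* z)) := (u :+ v) :* (w :* (y :* z))) refl y z u v w)

  scale-eigen : ∀ {a y y′ u w} → y′ ≈ u * (w * y) → a * y′ ≈ u * (w * (a * y))
  scale-eigen {a} {y} {y′} {u} {w} e = trans (*-congˡ e)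
    (solve 4 (λ a y u w → a :* (u :* (w :* y)) := u :* (w :* (a :* y))) refl a y u w)

  -- x y ≈ a y gives x ^ p y ≈ a ^ p y, while x ^ p ≈ a ^ p - a.
  -‿cancel : ∀ {x a a⁻¹ t} → a * a⁻¹ ≈ 1# → x ^ p ≈ t → t ≈ a ^ p - a →
    ∀ {y} → (x - a) * y ≈ 0# → y ≈ 0#
  -‿cancel {x} {a} {a⁻¹} {t} aa⁻¹≈1 x^p≈t t≈ {y} e = begin
    y                  ≈⟨ *-identityˡ y ⟨
    1# * y             ≈⟨ *-congʳ aa⁻¹≈1 ⟨
    a * a⁻¹ * y        ≈⟨ solve 3 (λ a b y → a :* b :* y := b :* (a :* y)) refl a a⁻¹ y ⟩
    a⁻¹ * (a * y)      ≈⟨ *-congˡ ay≈0 ⟩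
    a⁻¹ * 0#           ≈⟨ zeroʳ _ ⟩
    0#                 ∎
    where
    xy≈ay : x * y ≈ a * y
    xy≈ay = begin
      x * y                ≈⟨ solve 3 (λ x a y → x :* y := (x :- a) :* y :+ a :* y) refl x a y ⟩
      (x - a) * y + a * y  ≈⟨ trans (+-congʳ e) (+-identityˡ _) ⟩
      a * y                ∎

    power : ∀ k → x ^ k * y ≈ a ^ k * y
    power zero    = refl
    power (suc k) = begin
      x * x ^ k * y    ≈⟨ solve 3 (λ x b y → x :* b :* y := b :* (x :* y)) refl x _ y ⟩
      x ^ k * (x * y)  ≈⟨ *-congˡ xy≈ay ⟩
      x ^ k * (a * y)  ≈⟨ solve 3 (λ a b y → b :* (a :* y) := a :* (b :* y)) refl a _ y ⟩
      a * (x ^ k * y)  ≈⟨ *-congˡ (power k) ⟩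
      a * (a ^ k * y)  ≈⟨ *-assoc _ _ _ ⟨
      a * a ^ k * y    ∎

    ay≈0 : a * y ≈ 0#
    ay≈0 = begin
      a * y                            ≈⟨ solve 3 (λ a b y → a :* y := b :* y :- (b :- a) :* y) refl a (a ^ p) y ⟩
      a ^ p * y - (a ^ p - a) * y      ≈⟨ +-cong (power p) (-‿cong (*-congʳ (trans x^p≈t t≈))) ⟨
      x ^ p * y - x ^ p * y            ≈⟨ -‿inverseʳ _ ⟩
      0#                               ∎

-- The quotient by X ^ p - T and its differential equation

module Inversion (q : ℕ) (0<q : 0 < q) (p-prime : Prime (suc (suc q))) {c ℓ} (R : CommutativeRing c ℓ)
  (h : ℤ → CommutativeRing.Carrier R)
  (h-homo : IsRingHomomorphism (ℤₚ (suc (suc q))) (CommutativeRing.rawRing R) h)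
  (α α⁻¹ T : CommutativeRing.Carrier R)
  (αα⁻¹≈1 : CommutativeRing._≈_ R (CommutativeRing._*_ R α α⁻¹) (CommutativeRing.1# R))
  (T≈α^p-α : CommutativeRing._≈_ R T (CommutativeRing._-_ R (Ranges._^_ R α (suc (suc q))) α))
  (connection-cancel : ∀ s → 1 ≤ s → s < suc q → ∀ {x} →
    CommutativeRing._≈_ R (CommutativeRing._*_ R (Coefficients.connection q p-prime R h h-homo α s) x) (CommutativeRing.0# R) →
    CommutativeRing._≈_ R x (CommutativeRing.0# R))
  where

  private
    n p : ℕ
    n = suc q
    p = suc n

  open CommutativeRing R
  open Ranges R using (_^_)
  open RangeProperties R
  open Characteristic q p-prime R h h-homo
  open Coefficients q p-prime R h h-homo α
  open IntegerSolver p R h h-homo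
  open Algebra.Properties.Ring ring
  open Polynomial R
  open PolynomialProperties R
  open Derivation q p-prime R h h-homo
  open Algebra.Definitions.RawMagma P.*-rawMagma using (_,_)

  M w : Poly
  M = X P.^ p P.- C T
  w = X P.- C α

  Ch-homo : IsRingHomomorphism (ℤₚ p) P.rawRing (C ∘ h)
  Ch-homo = Composition.isRingHomomorphism P.trans h-homo C-homo

  open Congruence p polynomialRing (C ∘ h) Ch-homo M
  module S where
    open CommutativeRing quotientRing public
    open Ranges quotientRing public using (_^_)
    open RangeProperties quotientRing public

  Ch-homo′ : IsRingHomomorphism (ℤₚ p) S.rawRing (C ∘ h)
  Ch-homo′ = Composition.isRingHomomorphism S.trans Ch-homo quotient-homo

  module PR = Relation.Binary.Reasoning.Setoid P.setoid
  module SR = Relation.Binary.Reasoning.Setoid S.setoid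
  open EigenLemmas p quotientRing (C ∘ h) Ch-homo′
  open Relation.Binary.Reasoning.Setoid setoid

  C-cong : ∀ {a b} → a ≈ b → C a ≋ C b
  C-cong = IsRingHomomorphism.⟦⟧-cong C-homo

  C-* : ∀ a b → C (a * b) ≋ C a ⊛ C b
  C-* = IsRingHomomorphism.*-homo C-homo

  X^p≋ : X P.^ p ≋ X P.^ p ⊛ C 1#
  X^p≋ = P.sym (P.*-identityʳ (X P.^ p))

  coeff-X^p-< : ∀ k → k < p → coeff (X P.^ p) k ≈ 0#
  coeff-X^p-< k k<p = trans (at X^p≋ k) (coeff-X^⊛-< p (C 1#) k k<p)

  coeff-X^p-+ : ∀ k → coeff (X P.^ p) (p ℕ.+ k) ≈ coeff (C 1#) k
  coeff-X^p-+ k = trans (at X^p≋ (p ℕ.+ k)) (coeff-X^⊛-+ p (C 1#) k)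

  coeff-w⊛ : ∀ f k → coeff (w ⊛ f) k ≈ coeff (0# ∷ f) k - α * coeff f k
  coeff-w⊛ f k = begin
    coeff (w ⊛ f) k                            ≈⟨ at (RP.[y-z]x≈yx-zx f X (C α)) k ⟩
    coeff (X ⊛ f P.- C α ⊛ f) k                ≈⟨ coeff-∸ (X ⊛ f) (C α ⊛ f) k ⟩
    coeff (X ⊛ f) k - coeff (C α ⊛ f) k        ≈⟨ +-cong (at (X⊛ f) k) (-‿cong (coeff-C⊛ α f k)) ⟩
    coeff (0# ∷ f) k - α * coeff f k           ∎
    where module RP = Algebra.Properties.Ring P.ring

  -- Above degree p the coefficients of g M give g_k = T g_{p + k}, so g, having
  -- finitely many coefficients, vanishes.
  divisible⇒zero : ∀ {f} → DegreeBelow p f → f ≅ [] → f ≋ []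
  divisible⇒zero {f} df (mk (g , e)) = P.trans (P.sym gM≋f)
    (P.*-congʳ {M} {g} {[]} (mk λ k → g≈0 (length g) k (ℕ.m≤m+n (length g) k)))
    where
    gM≋f : g ⊛ M ≋ f
    gM≋f = P.trans e (P.+-identityʳ f)

    recurrence : ∀ k → coeff g k ≈ T * coeff g (p ℕ.+ k)
    recurrence k = x∙y⁻¹≈ε⇒x≈y _ _ (begin
      coeff g k - T * coeff g (p ℕ.+ k)
        ≈⟨ +-cong (coeff-X^⊛-+ p g k) (-‿cong (coeff-C⊛ T g (p ℕ.+ k))) ⟨
      coeff (X P.^ p ⊛ g) (p ℕ.+ k) - coeff (C T ⊛ g) (p ℕ.+ k)
        ≈⟨ coeff-∸ (X P.^ p ⊛ g) (C T ⊛ g) (p ℕ.+ k) ⟨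
      coeff (X P.^ p ⊛ g P.- C T ⊛ g) (p ℕ.+ k)
        ≈⟨ at (P.trans (P.sym (RP.[y-z]x≈yx-zx g (X P.^ p) (C T))) (P.trans (P.*-comm M g) gM≋f)) (p ℕ.+ k) ⟩
      coeff f (p ℕ.+ k)
        ≈⟨ df (p ℕ.+ k) (ℕ.m≤m+n p k) ⟩
      0# ∎)
      where module RP = Algebra.Properties.Ring P.ring

    g≈0 : ∀ j k → length g ≤ j ℕ.+ k → coeff g k ≈ 0#
    g≈0 zero    k len = coeff-length g k len
    g≈0 (suc j) k len = trans (recurrence k) (trans (*-congˡ (g≈0 j (p ℕ.+ k)
      (ℕ.≤-trans len (ℕ.≤-trans (ℕ.≤-reflexive (≡.sym (ℕ.+-suc j k)))
        (ℕ.+-monoʳ-≤ j (s≤s (ℕ.m≤n+m k n))))))) (zeroʳ T))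

  -- The derivative of X ^ p is p X ^ p = 0 and constants have derivative zero, so θ of a multiple
  -- of `M` is again a multiple of `M`.
  θ-M : θ M ≋ []
  θ-M = P.trans (θ-⊕ (X P.^ p) (⊖ C T)) (P.trans (P.+-cong θ-X^p
    (P.trans (θ-⊖ (C T)) (P.-‿cong (θ-C T)))) (P.+-identityˡ []))
    where
    θ-X^p : θ (X P.^ p) ≋ []
    θ-X^p = mk λ k → trans (coeff-θ (X P.^ p) k) (go k (ℕ.<-≤-connex k p))
      where
      go : ∀ k → k < p ⊎ p ≤ k → ν k * coeff (X P.^ p) k ≈ 0#
      go k (inj₁ k<p) = trans (*-congˡ (coeff-X^p-< k k<p)) (zeroʳ _)
      go k (inj₂ p≤k) with ℕ.m≤n⇒∃[o]m+o≡n p≤k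
      ... | zero  , ≡.refl = trans (*-congʳ (trans (reflexive (≡.cong ν (ℕ.+-identityʳ p))) ν-p)) (zeroˡ _)
      ... | suc j , ≡.refl = trans (*-congˡ (coeff-X^p-+ (suc j))) (zeroʳ _)

  θ-≅ : ∀ {f g} → f ≅ g → θ f ≅ θ g
  θ-≅ {f} {g} (mk (k , e)) = mk (θ k , (PR.begin
    θ k ⊛ M                  PR.≈⟨ P.trans (P.+-congˡ {θ k ⊛ M} (P.trans (P.*-congˡ {k} θ-M) (P.zeroʳ k))) (P.+-identityʳ _) ⟨
    θ k ⊛ M ⊕ k ⊛ θ M        PR.≈⟨ θ-⊛ k M ⟨
    θ (k ⊛ M)                PR.≈⟨ θ-cong e ⟩
    θ (f ⊕ ⊖ g)              PR.≈⟨ P.trans (θ-⊕ f (⊖ g)) (P.+-congˡ {θ f} (θ-⊖ g)) ⟩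
    θ f ⊕ ⊖ θ g              PR.∎))

  -- Stated without division by `w`; since `w` is cancellable (`w-cancel`), `u` acts as an
  -- eigenvalue of (X - α)⁻¹ θ.
  Eigen : Carrier → Poly → Set _
  Eigen u f = θ f ≅ C u ⊛ (w ⊛ f)

  eigen-cong : ∀ {u v f g} → u ≈ v → f ≅ g → Eigen u f → Eigen v g
  eigen-cong {u} {v} {f} {g} u≈v f≅g e = S.trans (θ-≅ (S.sym f≅g)) (S.trans e
    (S.*-cong (≈⇒≅ (C-cong u≈v)) (S.*-congˡ {w} f≅g)))

  eigen-⊛ : ∀ {u v f g} → Eigen u f → Eigen v g → Eigen (u + v) (f ⊛ g)
  eigen-⊛ {u} {v} {f} {g} e e′ = S.trans (≈⇒≅ (θ-⊛ f g)) (product-eigen {f} {g} {θ f} {θ g} {C u} {C v} {w} e e′)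

  eigen-C⊛ : ∀ {u f} a → Eigen u f → Eigen u (C a ⊛ f)
  eigen-C⊛ {u} {f} a e = S.trans (≈⇒≅ (θ-C⊛ a f)) (scale-eigen {C a} {f} {θ f} {C u} {w} e)

  eigen-⊕ : ∀ {u f g} → Eigen u f → Eigen u g → Eigen u (f ⊕ g)
  eigen-⊕ {u} {f} {g} e e′ = S.trans (≈⇒≅ (θ-⊕ f g)) (S.trans (S.+-cong e e′)
    (≈⇒≅ (P.sym (P.trans (P.*-congˡ {C u} (P.distribˡ w f g)) (P.distribˡ (C u) (w ⊛ f) (w ⊛ g))))))

  -- A solution of degree below p - 1 vanishes, from the top coefficient downwards.
  eigen-zero : ∀ {m z} → ¬ p ℕ∣.∣ m → DegreeBelow p z → coeff z n ≈ 0# → Eigen (ν m) z → z ≋ []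
  eigen-zero {m} {z} p∤m dz zₙ≈0 e = below-ext dz (λ _ _ → refl) λ k k<p →
    ≡.subst (λ i → coeff z i ≈ 0#) (ℕ.m∸[m∸n]≡n (ℕ.s≤s⁻¹ k<p)) (descend (n ∸ k) (ℕ.m∸n≤m n k))
    where
    z′ : Poly
    z′ = C (ν m) ⊛ (w ⊛ z)

    coeff-z′ : ∀ k → coeff z′ k ≈ ν m * (coeff (0# ∷ z) k - α * coeff z k)
    coeff-z′ k = trans (coeff-C⊛ (ν m) (w ⊛ z) k) (*-congˡ (coeff-w⊛ z k))

    z≈0 : ∀ k → n ≤ k → coeff z k ≈ 0#
    z≈0 k n≤k with ℕ.m≤n⇒m<n∨m≡n n≤k
    ... | inj₁ n<k    = dz k n<k
    ... | inj₂ ≡.refl = zₙ≈0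

    -- The missing top coefficient keeps `w ⊛ z` below degree p, so the congruence is an equality of
    -- polynomials.
    difference≋0 : θ z P.- z′ ≋ []
    difference≋0 = divisible⇒zero (∸-degree {p} {θ z} {z′}
      (λ k p≤k → trans (coeff-θ z k) (trans (*-congˡ (dz k p≤k)) (zeroʳ _)))
      λ { (suc k) (s≤s n≤k) → trans (coeff-z′ (suc k)) (trans (*-congˡ
            (trans (+-cong (z≈0 k n≤k) (-‿cong (trans (*-congˡ (dz (suc k) (s≤s n≤k))) (zeroʳ α)))) (-‿inverseʳ 0#)))
            (zeroʳ _)) })
      (S.trans (S.+-congʳ {⊖ z′} e) (S.-‿inverseʳ z′))

    -- The equation reads (k + 1) z_{k+1} = m (z_k - α z_{k+1}), which determines z_k from z_{k+1};
    -- only m has to be cancelled.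
    step : ∀ k → coeff z (suc k) ≈ 0# → coeff z k ≈ 0#
    step k zₖ₊₁≈0 = ν-cancel p∤m (begin
      ν m * coeff z k
        ≈⟨ *-congˡ (trans (sym (+-identityʳ _)) (+-congˡ (sym (trans (-‿cong (trans (*-congˡ zₖ₊₁≈0) (zeroʳ α))) -0#≈0#)))) ⟩
      ν m * (coeff z k - α * coeff z (suc k))
        ≈⟨ coeff-z′ (suc k) ⟨
      coeff z′ (suc k)
        ≈⟨ x∙y⁻¹≈ε⇒x≈y _ _ (trans (sym (coeff-∸ (θ z) z′ (suc k))) (at difference≋0 (suc k))) ⟨
      coeff (θ z) (suc k)
        ≈⟨ trans (coeff-θ z (suc k)) (trans (*-congˡ zₖ₊₁≈0) (zeroʳ _)) ⟩
      0# ∎)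

    descend : ∀ j → j ≤ n → coeff z (n ∸ j) ≈ 0#
    descend zero    _   = zₙ≈0
    descend (suc j) j<n = step (n ∸ suc j)
      (≡.subst (λ i → coeff z i ≈ 0#) (ℕ.+-∸-assoc 1 j<n) (descend j (ℕ.<⇒≤ j<n)))

  -- The polynomials L_m and their products

  Lag : ℕ → Poly
  Lag m = tabulate p (lag m)

  coeff-Lag : ∀ m {k} → k < p → coeff (Lag m) k ≈ lag m k
  coeff-Lag m = coeff-tabulate (lag m)

  Lag-degree : ∀ m → DegreeBelow p (Lag m)
  Lag-degree m = tabulate-degree p (lag m)

  coeff-M : ∀ k → coeff M k ≈ coeff (X P.^ p) k - coeff (C T) k
  coeff-M = coeff-∸ (X P.^ p) (C T)

  -- X d/dX L = m (X - α) L + m M for L = Lag m, which is the recurrence for the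
  -- coefficients together with their values at 0 and p - 1.
  Lag-ode : ∀ {m} → ¬ p ℕ∣.∣ m → θ (Lag m) ≋ C (ν m) ⊛ (w ⊛ Lag m ⊕ M)
  Lag-ode {m} p∤m = mk λ k → begin
    coeff (θ L) k
      ≈⟨ coeff-θ L k ⟩
    ν k * coeff L k
      ≈⟨ go k ⟩
    ν m * (coeff (0# ∷ L) k - α * coeff L k + (coeff (X P.^ p) k - coeff (C T) k))
      ≈⟨ *-congˡ (+-cong (coeff-w⊛ L k) (coeff-M k)) ⟨
    ν m * (coeff (w ⊛ L) k + coeff M k)
      ≈⟨ *-congˡ (coeff-⊕ (w ⊛ L) M k) ⟨
    ν m * coeff (w ⊛ L ⊕ M) k
      ≈⟨ coeff-C⊛ (ν m) (w ⊛ L ⊕ M) k ⟨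
    coeff (C (ν m) ⊛ (w ⊛ L ⊕ M)) k ∎
    where
    L = Lag m

    go : ∀ k → ν k * coeff L k ≈
      ν m * (coeff (0# ∷ L) k - α * coeff L k + (coeff (X P.^ p) k - coeff (C T) k))
    -- This coefficient dictates the constant of the modulus: α (1 - α ^ (p - 1)) = -(α ^ p - α).
    go zero = begin
      ν 0 * coeff L 0
        ≈⟨ trans (*-congʳ ν-0) (zeroˡ _) ⟩
      0#
        ≈⟨ solve 3 (λ m a x → con (+ 0) := m :* (con (+ 0) :- a :* (con (+ 1) :- x) :+ (con (+ 0) :- (a :* x :- a)))) refl (ν m) α (α ^ n) ⟩
      ν m * (0# - α * (1# - α ^ n) + (0# - (α ^ p - α)))
        ≈⟨ *-congˡ (+-cong (+-congˡ (-‿cong (*-congˡ (lag-0 p∤m)))) (+-cong (coeff-X^p-< 0 (s≤s z≤n)) (-‿cong T≈α^p-α))) ⟨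
      ν m * (0# - α * lag m 0 + (coeff (X P.^ p) 0 - T)) ∎
    go (suc k) with ℕ.<-cmp k n
    ... | tri< k<n _ _ = begin
      ν (suc k) * coeff L (suc k)
        ≈⟨ *-congˡ (coeff-Lag m (s≤s k<n)) ⟩
      ν (suc k) * l₁
        ≈⟨ solve 4 (λ s m a l → s :* l := (s :+ m :* a) :* l :- m :* (a :* l)) refl (ν (suc k)) (ν m) α l₁ ⟩
      (ν (suc k) + ν m * α) * l₁ - ν m * (α * l₁)
        ≈⟨ +-congʳ (lag-suc m k k<n) ⟩
      ν m * lag m k - ν m * (α * l₁)
        ≈⟨ solve 4 (λ m l a l₁ → m :* l :- m :* (a :* l₁) := m :* (l :- a :* l₁ :+ (con (+ 0) :- con (+ 0)))) refl (ν m) (lag m k) α l₁ ⟩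
      ν m * (lag m k - α * l₁ + (0# - 0#))
        ≈⟨ *-congˡ (+-cong (+-cong (coeff-Lag m (ℕ.m≤n⇒m≤1+n k<n)) (-‿cong (*-congˡ (coeff-Lag m (s≤s k<n)))))
             (+-congʳ (coeff-X^p-< (suc k) (s≤s k<n)))) ⟨
      ν m * (coeff L k - α * coeff L (suc k) + (coeff (X P.^ p) (suc k) - 0#)) ∎
      where l₁ = lag m (suc k)
    -- At X ^ p the leading coefficient -1 of L_m, shifted by the factor X of `w`, cancels the
    -- leading coefficient 1 of `M`.
    ... | tri≈ _ ≡.refl _ = begin
      ν p * coeff L p
        ≈⟨ trans (*-congʳ ν-p) (zeroˡ _) ⟩
      0#
        ≈⟨ solve 2 (λ m a → con (+ 0) := m :* (:- con (+ 1) :- a :* con (+ 0) :+ (con (+ 1) :- con (+ 0)))) refl (ν m) α ⟩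
      ν m * (- 1# - α * 0# + (1# - 0#))
        ≈⟨ *-congˡ (+-cong (+-cong (trans (coeff-Lag m ℕ.≤-refl) (lag-n p∤m)) (-‿cong (*-congˡ (Lag-degree m p ℕ.≤-refl))))
             (+-congʳ (trans (reflexive (≡.cong (coeff (X P.^ p)) (≡.sym (ℕ.+-identityʳ p)))) (coeff-X^p-+ 0)))) ⟨
      ν m * (coeff L n - α * coeff L p + (coeff (X P.^ p) p - 0#)) ∎
    ... | tri> _ _ n<k with j , ≡.refl ← ℕ.m≤n⇒∃[o]m+o≡n n<k = begin
      ν (suc (p ℕ.+ j)) * coeff L (suc (p ℕ.+ j))
        ≈⟨ trans (*-congˡ (Lag-degree m (suc (p ℕ.+ j)) (ℕ.m≤n⇒m≤1+n n<k))) (zeroʳ _) ⟩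
      0#
        ≈⟨ solve 2 (λ m a → con (+ 0) := m :* (con (+ 0) :- a :* con (+ 0) :+ (con (+ 0) :- con (+ 0)))) refl (ν m) α ⟩
      ν m * (0# - α * 0# + (0# - 0#))
        ≈⟨ *-congˡ (+-cong (+-cong (Lag-degree m _ n<k) (-‿cong (*-congˡ (Lag-degree m (suc (p ℕ.+ j)) (ℕ.m≤n⇒m≤1+n n<k)))))
             (+-congʳ (trans (reflexive (≡.cong (coeff (X P.^ p)) (≡.sym (ℕ.+-suc p j)))) (coeff-X^p-+ (suc j))))) ⟨
      ν m * (coeff L (p ℕ.+ j) - α * coeff L (suc (p ℕ.+ j)) + (coeff (X P.^ p) (suc (p ℕ.+ j)) - 0#)) ∎

  M≅0 : M ≅ []
  M≅0 = S.trans (≈⇒≅ (P.sym (P.*-identityˡ M))) (multiple≅0 (C 1#))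

  Lag-eigen : ∀ {m} → ¬ p ℕ∣.∣ m → Eigen (ν m) (Lag m)
  Lag-eigen {m} p∤m = S.trans (≈⇒≅ (Lag-ode p∤m)) (S.*-congˡ {C (ν m)}
    (S.trans (S.+-congˡ {w ⊛ Lag m} M≅0) (S.+-identityʳ (w ⊛ Lag m))))

  X^p≅T : X P.^ p ≅ C T
  X^p≅T = SR.begin
    X P.^ p        SR.≈⟨ ≈⇒≅ (P.trans (P.+-assoc (X P.^ p) (⊖ C T) (C T)) (P.trans
                        (P.+-congˡ {X P.^ p} (P.-‿inverseˡ (C T))) (P.+-identityʳ (X P.^ p)))) ⟨
    M ⊕ C T        SR.≈⟨ S.+-congʳ {C T} M≅0 ⟩
    [] ⊕ C T       SR.≡⟨⟩
    C T            SR.∎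

  -- The product has degree at most 2p - 2, so reducing it modulo M does not
  -- touch the coefficient of X ^ (p - 1).
  Lag-product : ∀ s → 1 ≤ s → s < n → Lag 1 ⊛ Lag s ≅ C (connection s) ⊛ Lag (suc s)
  Lag-product s 1≤s s<n = S.trans W≅Y (≈⇒≅ Y≋)
    where
    λₛ = connection s
    W lo hi Y z : Poly
    W  = Lag 1 ⊛ Lag s
    lo = tabulate p (coeff W)
    hi = drop p W
    Y  = lo ⊕ C T ⊛ hi
    -- Both terms have eigenvalue s + 1, and the scalar is the one that removes the coefficient of X
    -- ^ (p - 1); so `eigen-zero` applies.
    z  = Y ⊕ C (- λₛ) ⊛ Lag (suc s)

    p∤s = p∤ 1≤s (ℕ.m<n⇒m<1+n s<n)

    W≅Y : W ≅ Y
    W≅Y = S.trans (≈⇒≅ (split-at p W)) (S.+-congˡ {lo} (S.*-congʳ {hi} X^p≅T))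

    W-degree : DegreeBelow (n ℕ.+ p) W
    W-degree = ⊛-degree {n} {p} {Lag 1} {Lag s} (Lag-degree 1) (Lag-degree s)

    coeff-hi : ∀ k → n ≤ k → coeff (C T ⊛ hi) k ≈ 0#
    coeff-hi k n≤k = trans (coeff-C⊛ T hi k) (trans (*-congˡ (trans (coeff-drop p W k)
      (W-degree (p ℕ.+ k) (ℕ.≤-trans (ℕ.≤-reflexive (ℕ.+-comm n p)) (ℕ.+-monoʳ-≤ p n≤k))))) (zeroʳ T))

    z-degree : DegreeBelow p z
    z-degree = ⊕-degree {p} {Y} {C (- λₛ) ⊛ Lag (suc s)}
      (⊕-degree {p} {lo} {C T ⊛ hi} (tabulate-degree p (coeff W)) (λ k p≤k → coeff-hi k (ℕ.<⇒≤ p≤k)))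
      (C⊛-degree {p} {Lag (suc s)} (- λₛ) (Lag-degree (suc s)))

    zₙ≈0 : coeff z n ≈ 0#
    zₙ≈0 = begin
      coeff z n
        ≈⟨ trans (coeff-⊕ Y (C (- λₛ) ⊛ Lag (suc s)) n) (+-cong (coeff-⊕ lo (C T ⊛ hi) n) (coeff-C⊛ (- λₛ) (Lag (suc s)) n)) ⟩
      coeff lo n + coeff (C T ⊛ hi) n + - λₛ * coeff (Lag (suc s)) n
        ≈⟨ +-cong (+-cong (coeff-tabulate {p} {n} (coeff W) ℕ.≤-refl) (coeff-hi n ℕ.≤-refl))
             (*-congˡ (trans (coeff-Lag (suc s) ℕ.≤-refl) (lag-n (p∤suc s<n)))) ⟩
      coeff W n + 0# + - λₛ * - 1#
        ≈⟨ +-congʳ (+-congʳ (trans (coeff-⊛ (Lag 1) (Lag s) n) (trans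
             (∑-cong p λ k k<p → *-cong (coeff-Lag 1 k<p) (coeff-Lag s (s≤s (ℕ.m∸n≤m n k))))
             (connection-lag p∤s)))) ⟩
      - λₛ + 0# + - λₛ * - 1#
        ≈⟨ solve 1 (λ x → :- x :+ con (+ 0) :+ (:- x) :* (:- con (+ 1)) := con (+ 0)) refl λₛ ⟩
      0# ∎

    z-eigen : Eigen (ν (suc s)) z
    z-eigen = eigen-⊕ {ν (suc s)} {Y} {C (- λₛ) ⊛ Lag (suc s)}
      (eigen-cong {ν 1 + ν s} (sym (ν-+ 1 s)) W≅Y
        (eigen-⊛ {ν 1} {ν s} {Lag 1} {Lag s} (Lag-eigen p∤1) (Lag-eigen p∤s)))
      (eigen-C⊛ {ν (suc s)} {Lag (suc s)} (- λₛ) (Lag-eigen (p∤suc s<n)))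

    Y≋ : Y ≋ C λₛ ⊛ Lag (suc s)
    Y≋ = mk λ k → x∙y⁻¹≈ε⇒x≈y _ _ (begin
      coeff Y k - coeff (C λₛ ⊛ Lag (suc s)) k
        ≈⟨ +-congˡ (-‿cong (coeff-C⊛ λₛ (Lag (suc s)) k)) ⟩
      coeff Y k - λₛ * coeff (Lag (suc s)) k
        ≈⟨ +-congˡ (-‿distribˡ-* λₛ _) ⟩
      coeff Y k + - λₛ * coeff (Lag (suc s)) k
        ≈⟨ trans (coeff-⊕ Y (C (- λₛ) ⊛ Lag (suc s)) k) (+-congˡ (coeff-C⊛ (- λₛ) (Lag (suc s)) k)) ⟨
      coeff z k
        ≈⟨ at (eigen-zero (p∤suc s<n) z-degree zₙ≈0 z-eigen) k ⟩
      0# ∎)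

  -- Powers of L and the inverse polynomial

  connections : ℕ → Carrier
  connections k = ∏< k (λ i → connection (suc i))

  connections-cancel : ∀ k → k < n → ∀ {x} → connections k * x ≈ 0# → x ≈ 0#
  connections-cancel zero    _   {x} e = trans (sym (*-identityˡ x)) (trans (*-congʳ (sym (reflexive (∏-empty _)))) e)
  connections-cancel (suc k) k<n {x} e = connection-cancel (suc k) (s≤s z≤n) k<n
    (connections-cancel k (ℕ.<-trans (ℕ.n<1+n k) k<n)
      (trans (trans (sym (*-assoc _ _ _)) (*-congʳ (sym (∏-last k _)))) e))

  Lag-power : ∀ k → k < n → Lag 1 P.^ suc k ≅ C (connections k) ⊛ Lag (suc k)
  Lag-power zero    _   = ≈⇒≅ (P.trans (P.*-comm (Lag 1) (C 1#))
    (P.*-congʳ {Lag 1} (C-cong (sym (reflexive (∏-empty _))))))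
  Lag-power (suc k) k<n = SR.begin
    Lag 1 ⊛ Lag 1 P.^ suc k
      SR.≈⟨ S.*-congˡ {Lag 1} (Lag-power k (ℕ.<-trans (ℕ.n<1+n k) k<n)) ⟩
    Lag 1 ⊛ (C (connections k) ⊛ Lag (suc k))
      SR.≈⟨ ≈⇒≅ (x∙yz≈y∙xz (Lag 1) (C (connections k)) (Lag (suc k))) ⟩
    C (connections k) ⊛ (Lag 1 ⊛ Lag (suc k))
      SR.≈⟨ S.*-congˡ {C (connections k)} (Lag-product (suc k) (s≤s z≤n) k<n) ⟩
    C (connections k) ⊛ (C (connection (suc k)) ⊛ Lag (suc (suc k)))
      SR.≈⟨ ≈⇒≅ (P.*-assoc (C (connections k)) (C (connection (suc k))) (Lag (suc (suc k)))) ⟨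
    C (connections k) ⊛ C (connection (suc k)) ⊛ Lag (suc (suc k))
      SR.≈⟨ ≈⇒≅ (P.*-congʳ {Lag (suc (suc k))} (P.trans (P.sym (C-* (connections k) (connection (suc k))))
           (C-cong (sym (∏-last k _))))) ⟩
    C (connections (suc k)) ⊛ Lag (suc (suc k)) SR.∎
    where open Algebra.Properties.CommutativeSemigroup P.*-commutativeSemigroup using (x∙yz≈y∙xz)

  combination : ℕ → (ℕ → Carrier) → Poly
  combination m a = P.∑< m (λ k → C (a k) ⊛ Lag 1 P.^ k)

  ∑-≅ : ∀ m {F G : ℕ → Poly} → (∀ k → k < m → F k ≅ G k) → P.∑< m F ≅ P.∑< m G
  ∑-≅ m {F} {G} e = S.trans (∑-homo m F) (S.trans (S.∑-cong m e) (S.sym (∑-homo m G)))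
    where open HomProperties polynomialRing quotientRing (λ f → f) quotient-homo

  -- Describing the coefficients of G by their products with `connections k` matches the scalar that
  -- `Lag-power` produces and avoids reciprocals in the ring. The resulting sum of L_k / k has
  -- degree below p and is compared with -X one coefficient at a time.
  inverse : ∀ {G} → DegreeBelow p G → coeff G 0 ≈ 0# →
    (∀ k → k < n → coeff G (suc k) * connections k ≈ - ν⁻¹ (suc k)) → G ⟨ Lag 1 ⟩ ≅ X
  inverse {G} dG G₀≈0 Gₖ = SR.begin
    G ⟨ Lag 1 ⟩
      SR.≈⟨ ≈⇒≅ (P.trans (⟨⟩-congˡ {G} (Lag 1) (tabulate-coeff dG)) (∑-monomials p (coeff G) (Lag 1))) ⟩
    combination p (coeff G)
      SR.≈⟨ ≈⇒≅ (P.trans (P.reflexive (P.∑-first n _)) (P.trans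
           (P.+-congʳ {P.∑< n (λ k → C (coeff G (suc k)) ⊛ Lag 1 P.^ suc k)} (P.trans (P.*-identityʳ (C (coeff G 0)))
             (C-zero G₀≈0)))
           (P.+-identityˡ (P.∑< n (λ k → C (coeff G (suc k)) ⊛ Lag 1 P.^ suc k))))) ⟩
    P.∑< n (λ k → C (coeff G (suc k)) ⊛ Lag 1 P.^ suc k)
      SR.≈⟨ ∑-≅ n (λ k k<n → S.trans (S.*-congˡ {C (coeff G (suc k))} (Lag-power k k<n))
           (≈⇒≅ (P.trans (P.sym (P.*-assoc (C (coeff G (suc k))) (C (connections k)) (Lag (suc k))))
             (P.*-congʳ {Lag (suc k)} (P.trans (P.sym (C-* (coeff G (suc k)) (connections k))) (C-cong (Gₖ k k<n))))))) ⟩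
    P.∑< n (λ k → C (- ν⁻¹ (suc k)) ⊛ Lag (suc k))
      SR.≈⟨ ≈⇒≅ (mk λ j → trans (coeff-∑ n _ j) (trans (∑-cong n λ k _ → coeff-C⊛ (- ν⁻¹ (suc k)) (Lag (suc k)) j)
           (value j (ℕ.<-≤-connex j p)))) ⟩
    X SR.∎
    where
    negate : ∀ j → j < p → ∑< n (λ k → - ν⁻¹ (suc k) * coeff (Lag (suc k)) j) ≈ - ∑< n (λ k → ν⁻¹ (suc k) * lag (suc k) j)
    negate j j<p = trans (∑-cong n λ k _ → trans (*-congˡ (coeff-Lag (suc k) j<p))
      (solve 2 (λ x y → (:- x) :* y := (:- con (+ 1)) :* (x :* y)) refl _ _)) (trans (sym (∑-*ˡ n _ _)) (-1*x≈-x _))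

    value : ∀ j → j < p ⊎ p ≤ j → ∑< n (λ k → - ν⁻¹ (suc k) * coeff (Lag (suc k)) j) ≈ coeff X j
    value zero          (inj₁ j<p) = trans (negate 0 j<p) (trans (-‿cong (∑-lag-0 0<q)) -0#≈0#)
    value (suc zero)    (inj₁ j<p) = trans (negate 1 j<p) (trans (-‿cong ∑-lag-1) (-‿involutive 1#))
    value (suc (suc j)) (inj₁ j<p) = trans (negate _ j<p) (trans (-‿cong (∑-lag-2+ j (ℕ.s≤s⁻¹ (ℕ.s≤s⁻¹ j<p)))) -0#≈0#)
    value (suc (suc j)) (inj₂ p≤j) = ∑-zero n λ k _ → trans (*-congˡ (Lag-degree (suc k) _ p≤j)) (zeroʳ _)
    value (suc zero)    (inj₂ (s≤s ()))

  -- Linear independence of the powers of L, and uniqueness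

  w-cancel : ∀ {f} → w ⊛ f ≅ [] → f ≅ []
  w-cancel {f} = -‿cancel {X} {C α} {C α⁻¹} {C T} (≈⇒≅ (P.trans (P.sym (C-* α α⁻¹)) (C-cong αα⁻¹≈1)))
    (S.trans (S.sym (Q.^-homo X p)) X^p≅T)
    (S.trans (≈⇒≅ (P.trans (C-cong T≈α^p-α) (P.+-congʳ {⊖ C α} (H.^-homo α p))))
      (S.+-congʳ {⊖ C α} (Q.^-homo (C α) p))) {f}
    where
    module H = HomProperties R polynomialRing C C-homo
    module Q = HomProperties polynomialRing quotientRing (λ f → f) quotient-homo

  power-eigen : ∀ k → Eigen (ν k) (Lag 1 P.^ k)
  power-eigen zero    = ≈⇒≅ (P.trans (θ-C 1#) (P.sym (P.*-congʳ {w ⊛ C 1#} (C-zero ν-0))))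
  power-eigen (suc k) = eigen-cong {ν 1 + ν k} {ν (suc k)} (sym (ν-+ 1 k)) S.refl
    (eigen-⊛ {ν 1} {ν k} {Lag 1} {Lag 1 P.^ k} (Lag-eigen p∤1) (power-eigen k))

  -- Powers of L have large degree, but modulo `M` they are multiples of L_k, of degree below p with
  -- top coefficient -1. The congruence then becomes an equality, whose coefficient of X ^ (p - 1)
  -- can be read off. The power 0 is the constant 1 and is treated by its constant coefficient.
  Lag-power-cancel : ∀ k → k < p → ∀ {a} → C a ⊛ Lag 1 P.^ k ≅ [] → a ≈ 0#
  Lag-power-cancel zero    _         {a} e = at (divisible⇒zero
    {C a} (λ { (suc k) _ → refl }) (S.trans (≈⇒≅ (P.sym (P.*-identityʳ (C a)))) e)) 0
  Lag-power-cancel (suc k) (s≤s k<n) {a} e = connections-cancel k k<n (begin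
    B * a                                     ≈⟨ solve 2 (λ b a → b :* a := :- (a :* b :* (:- con (+ 1)))) refl B a ⟩
    - (a * B * - 1#)                          ≈⟨ -‿cong (*-congˡ (trans (coeff-Lag (suc k) ℕ.≤-refl) (lag-n (p∤suc k<n)))) ⟨
    - (a * B * coeff (Lag (suc k)) n)         ≈⟨ -‿cong (coeff-C⊛ (a * B) (Lag (suc k)) n) ⟨
    - coeff (C (a * B) ⊛ Lag (suc k)) n       ≈⟨ -‿cong (at aBL≋0 n) ⟩
    - 0#                                      ≈⟨ -0#≈0# ⟩
    0#                                        ∎)
    where
    B = connections k
    aBL≋0 : C (a * B) ⊛ Lag (suc k) ≋ []
    aBL≋0 = divisible⇒zero (C⊛-degree {p} {Lag (suc k)} (a * B) (Lag-degree (suc k)))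
      (S.trans (≈⇒≅ (P.trans (P.*-congʳ {Lag (suc k)} (C-* a B)) (P.*-assoc (C a) (C B) (Lag (suc k)))))
        (S.trans (S.*-congˡ {C a} (S.sym (Lag-power k k<n))) e))

  combination-θ : ∀ m a → θ (combination m a) ≅ w ⊛ combination m (λ k → ν k * a k)
  combination-θ m a = S.trans (≈⇒≅ (θ-∑ m _)) (S.trans (∑-≅ m λ k _ → term k) (≈⇒≅ (P.sym (P.∑-*ˡ m w _))))
    where
    term : ∀ k → θ (C (a k) ⊛ Lag 1 P.^ k) ≅ w ⊛ (C (ν k * a k) ⊛ Lag 1 P.^ k)
    term k = S.trans (eigen-C⊛ {ν k} {Lag 1 P.^ k} (a k) (power-eigen k)) (≈⇒≅ (P.trans
      (rearrange (C (ν k)) w (C (a k)) (Lag 1 P.^ k)) (P.*-congˡ {w} (P.*-congʳ {Lag 1 P.^ k} (P.sym (C-* (ν k) (a k)))))))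
      where
      open IntegerSolver p polynomialRing (C ∘ h) Ch-homo renaming (solve to solveₚ; _:*_ to _:*ₚ_; _:=_ to _:=ₚ_)
      rearrange : ∀ u w v y → u ⊛ (w ⊛ (v ⊛ y)) ≋ w ⊛ (u ⊛ v ⊛ y)
      rearrange = solveₚ 4 (λ u w v y → u :*ₚ (w :*ₚ (v :*ₚ y)) :=ₚ w :*ₚ (u :*ₚ v :*ₚ y)) P.refl

  combination-linear : ∀ m c a b → combination m (λ k → a k + c * b k) ≋ combination m a ⊕ C c ⊛ combination m b
  combination-linear m c a b = P.trans (P.∑-cong m λ k _ → term k)
    (P.trans (P.∑-+ m _ _) (P.+-congˡ {combination m a} (P.sym (P.∑-*ˡ m (C c) _))))
    where
    term : ∀ k → C (a k + c * b k) ⊛ Lag 1 P.^ k ≋ C (a k) ⊛ Lag 1 P.^ k ⊕ C c ⊛ (C (b k) ⊛ Lag 1 P.^ k)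
    term k = P.trans (P.distribʳ (Lag 1 P.^ k) (C (a k)) (C (c * b k))) (P.+-congˡ {C (a k) ⊛ Lag 1 P.^ k}
      (P.trans (P.*-congʳ {Lag 1 P.^ k} (C-* c (b k))) (P.*-assoc (C c) (C (b k)) (Lag 1 P.^ k))))

  -- The powers L ^ k are eigenvectors of (X - α)⁻¹ θ with distinct eigenvalues.
  independent : ∀ m → m ≤ p → ∀ a → combination m a ≅ [] → ∀ k → k < m → a k ≈ 0#
  independent (suc m) m<p a e = λ k k≤m → go k (ℕ.m≤n⇒m<n∨m≡n (ℕ.s≤s⁻¹ k≤m))
    where
    νa b : ℕ → Carrier
    νa k = ν k * a k
    -- The operator (X - α)⁻¹ θ - m scales the k-th coefficient by k - m, so it kills the last term
    -- and leaves a shorter relation.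
    b k  = νa k + - ν m * a k

    ∑νa≅0 : combination (suc m) νa ≅ []
    ∑νa≅0 = w-cancel (S.trans (S.sym (combination-θ (suc m) a)) (θ-≅ e))

    bₘ≈0 : b m ≈ 0#
    bₘ≈0 = solve 2 (λ x y → x :* y :+ (:- x) :* y := con (+ 0)) refl (ν m) (a m)

    ∑b≅0 : combination m b ≅ []
    ∑b≅0 = SR.begin
      combination m b
        SR.≈⟨ ≈⇒≅ (P.trans (P.+-congˡ {combination m b} (P.*-congʳ {Lag 1 P.^ m} (C-zero bₘ≈0))) (P.+-identityʳ (combination m b))) ⟨
      combination m b ⊕ C (b m) ⊛ Lag 1 P.^ m
        SR.≈⟨ ≈⇒≅ (P.∑-last m _) ⟨
      combination (suc m) b
        SR.≈⟨ ≈⇒≅ (combination-linear (suc m) (- ν m) νa a) ⟩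
      combination (suc m) νa ⊕ C (- ν m) ⊛ combination (suc m) a
        SR.≈⟨ S.+-cong ∑νa≅0 (S.*-congˡ {C (- ν m)} e) ⟩
      [] ⊕ C (- ν m) ⊛ []
        SR.≈⟨ ≈⇒≅ (P.zeroʳ (C (- ν m))) ⟩
      [] SR.∎

    below : ∀ k → k < m → a k ≈ 0#
    below k k<m = ν-cancel (p∤ (ℕ.m<n⇒0<n∸m k<m) (ℕ.≤-<-trans (ℕ.m∸n≤m m k) m<p)) (begin
      ν (m ∸ k) * a k             ≈⟨ *-congʳ (ν-∸ (ℕ.<⇒≤ k<m)) ⟩
      (ν m - ν k) * a k           ≈⟨ solve 3 (λ x y z → (x :- y) :* z := :- (y :* z :+ (:- x) :* z)) refl (ν m) (ν k) (a k) ⟩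
      - b k                       ≈⟨ -‿cong (independent m (ℕ.<⇒≤ m<p) b ∑b≅0 k k<m) ⟩
      - 0#                        ≈⟨ -0#≈0# ⟩
      0#                          ∎)

    last : a m ≈ 0#
    last = Lag-power-cancel m m<p (SR.begin
      C (a m) ⊛ Lag 1 P.^ m
        SR.≈⟨ ≈⇒≅ (P.+-identityˡ (C (a m) ⊛ Lag 1 P.^ m)) ⟨
      [] ⊕ C (a m) ⊛ Lag 1 P.^ m
        SR.≈⟨ ≈⇒≅ (P.+-congʳ {C (a m) ⊛ Lag 1 P.^ m} ∑≋0) ⟨
      combination m a ⊕ C (a m) ⊛ Lag 1 P.^ m
        SR.≈⟨ ≈⇒≅ (P.∑-last m _) ⟨
      combination (suc m) a
        SR.≈⟨ e ⟩
      [] SR.∎)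
      where
      ∑≋0 : combination m a ≋ []
      ∑≋0 = P.trans (P.∑-cong m λ k k<m → P.*-congʳ {Lag 1 P.^ k} (C-zero (below k k<m)))
        (P.∑-zero m λ _ _ → P.refl)

    go : ∀ k → k < m ⊎ k ≡ m → a k ≈ 0#
    go k (inj₁ k<m)    = below k k<m
    go k (inj₂ ≡.refl) = last

  unique : ∀ {F G} → DegreeBelow p F → DegreeBelow p G → F ⟨ Lag 1 ⟩ ≅ G ⟨ Lag 1 ⟩ → F ≋ G
  unique {F} {G} dF dG e = below-ext dF dG λ k k<p → x∙y⁻¹≈ε⇒x≈y _ _
    (trans (+-congˡ (sym (-1*x≈-x _))) (independent p ℕ.≤-refl (λ k → coeff F k + - 1# * coeff G k) (SR.begin
      combination p (λ k → coeff F k + - 1# * coeff G k)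
        SR.≈⟨ ≈⇒≅ (combination-linear p (- 1#) (coeff F) (coeff G)) ⟩
      combination p (coeff F) ⊕ C (- 1#) ⊛ combination p (coeff G)
        SR.≈⟨ S.+-cong (≈⇒≅ (expand {F} dF)) (S.*-congˡ {C (- 1#)} (≈⇒≅ (expand {G} dG))) ⟨
      F ⟨ Lag 1 ⟩ ⊕ C (- 1#) ⊛ G ⟨ Lag 1 ⟩
        SR.≈⟨ S.+-cong e (≈⇒≅ (-1*x≈-xₚ (G ⟨ Lag 1 ⟩))) ⟩
      G ⟨ Lag 1 ⟩ ⊕ ⊖ G ⟨ Lag 1 ⟩
        SR.≈⟨ ≈⇒≅ (P.-‿inverseʳ (G ⟨ Lag 1 ⟩)) ⟩
      [] SR.∎) k k<p))
    where
    open Algebra.Properties.Ring P.ring using () renaming (-1*x≈-x to -1*x≈-xₚ)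
    expand : ∀ {F} → DegreeBelow p F → F ⟨ Lag 1 ⟩ ≋ combination p (coeff F)
    expand {F} dF = P.trans (⟨⟩-congˡ {F} (Lag 1) (tabulate-coeff dF)) (∑-monomials p (coeff F) (Lag 1))

-- The theorem over 𝔽ₚ(α)

open import Data.Nat using (_+_)
open import Data.Nat.Divisibility using (_∣_)

module FractionProperties {c ℓ} (D : Domain c ℓ) where
  open Domain D
  open Fractions D
  private
    module K = Field fractionField

  ι-cong : ∀ {a b} → a ≈ b → ι a ≃ ι b
  ι-cong a≈b = mk (*-congʳ a≈b)

  ι-injective : ∀ {a b} → ι a ≃ ι b → a ≈ b
  ι-injective (mk e) = trans (sym (*-identityʳ _)) (trans e (*-identityʳ _))

  ι-homo : IsRingHomomorphism rawRing K.rawRing ι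
  ι-homo = record
    { isSemiringHomomorphism = record
      { isNearSemiringHomomorphism = record
        { +-isMonoidHomomorphism = record
          { isMagmaHomomorphism = record
            { isRelHomomorphism = record { cong = ι-cong }
            ; homo = λ a b → mk (*-cong (sym (+-cong (*-identityʳ a) (*-identityʳ b))) (*-identityˡ 1#))
            }
          ; ε-homo = K.refl
          }
        ; *-homo = λ a b → mk (*-congˡ (*-identityˡ 1#))
        }
      ; 1#-homo = K.refl
      }
    ; -‿homo = λ _ → K.refl
    }

coeff-map : ∀ {a ℓ₁ b ℓ₂} (R : CommutativeRing a ℓ₁) (S : CommutativeRing b ℓ₂)
  (φ : CommutativeRing.Carrier R → CommutativeRing.Carrier S) →
  IsRingHomomorphism (CommutativeRing.rawRing R) (CommutativeRing.rawRing S) φ →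
  ∀ f k → CommutativeRing._≈_ S (Polynomial.coeff S (map φ f) k) (φ (Polynomial.coeff R f k))
coeff-map R S φ φ-homo []      k       = CommutativeRing.sym S (IsRingHomomorphism.0#-homo φ-homo)
coeff-map R S φ φ-homo (a ∷ f) zero    = CommutativeRing.refl S
coeff-map R S φ φ-homo (a ∷ f) (suc k) = coeff-map R S φ φ-homo f k

-- The data of the theorem over arbitrary rings in place of 𝔽ₚ[α] and 𝔽ₚ(α).
module Abstract (p : ℕ) (p-prime : Prime p) (𝔸 𝕂 : CommutativeRing 0ℓ 0ℓ)
  (h : ℤ → CommutativeRing.Carrier 𝔸) (α : CommutativeRing.Carrier 𝔸)
  (ι : CommutativeRing.Carrier 𝔸 → CommutativeRing.Carrier 𝕂)
  (_⁻¹ : CommutativeRing.Carrier 𝕂 → CommutativeRing.Carrier 𝕂) where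

  private
    module F where
      open Field (PrimeField.𝔽 p p-prime) public
      open Ranges (IntegersMod.ℤ/ₚ p) public using (_^_)
    module A where
      open CommutativeRing 𝔸 public
      open Ranges 𝔸 public
    module AX where
      open CommutativeRing (Polynomial.polynomialRing 𝔸) public
      open Ranges (Polynomial.polynomialRing 𝔸) public
      open Polynomial 𝔸 public using (C; X)
    module KX where
      open CommutativeRing (Polynomial.polynomialRing 𝕂) public
      open Ranges (Polynomial.polynomialRing 𝕂) public
      open Polynomial 𝕂 public using (C; X; _⟨_⟩; DegreeBelow)

  binom : A.Carrier → ℕ → A.Carrier
  binom x m = A.∏ 0 m (λ j → x A.- h (+ j)) A.* h ((+ (m !)) F.⁻¹)

  L : AX.Carrier
  L = AX.∑ 0 p λ k →
    AX.C (binom (α A.- A.1#) (p ∸ 1 ∸ k)) AX.* (((AX.- AX.X) AX.^ k) AX.* AX.C (h ((+ (k !)) F.⁻¹)))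

  b : ℕ → ℕ → A.Carrier
  b r s = A.∑ 0 p λ k →
    h ((F.- (+ r F.* (+ s) F.⁻¹)) F.^ k)
      A.* (binom (h (+ r) A.* α A.- A.1#) (p ∸ 1 ∸ k) A.* binom (h (+ s) A.* α A.- A.1#) k)

  IsInverseOfL : KX.Carrier → Set
  IsInverseOfL G = KX.DegreeBelow p G ×
    ((KX.X KX.^ p) KX.- KX.C (ι ((α A.^ p) A.- α))) KX.∣ ((G KX.⟨ map ι L ⟩) KX.- KX.X)

  G₀ : KX.Carrier
  G₀ = KX.- KX.∑ 1 p λ k →
    KX.C (ι (h ((+ k) F.⁻¹))) KX.* ((KX.X KX.^ k) KX.* KX.C ((ι (A.∏ 1 k λ s → b 1 s)) ⁻¹))

  Statement : Set
  Statement = (∀ s → 1 ≤ s → s + 1 < p → ¬ (b 1 s A.≈ A.0#)) × ∃! KX._≈_ IsInverseOfL × IsInverseOfL G₀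

-- For a variable p, so that the sums below have no numeral bound to unfold at.
concretely : (p : ℕ) (p-prime : Prime p) → let open Laguerre p p-prime in
  Abstract.Statement p p-prime A.commutativeRing K.commutativeRing Aᴾ.C α ι K._⁻¹ →
  (∀ s → 1 ≤ s → s + 1 < p → ¬ (b 1 s A.≈ A.0#)) × ∃! KX._≈_ IsInverseOfL × IsInverseOfL G₀
concretely p p-prime statement = statement

module AbstractProof (q : ℕ) (0<q : 0 < q) (p-prime : Prime (suc (suc q)))
  (𝔸 : CommutativeRing 0ℓ 0ℓ) (𝕂 : Field 0ℓ 0ℓ)
  (h : ℤ → CommutativeRing.Carrier 𝔸)
  (h-homo : IsRingHomomorphism (ℤₚ (suc (suc q))) (CommutativeRing.rawRing 𝔸) h)
  (α : CommutativeRing.Carrier 𝔸)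
  (ε : CommutativeRing.Carrier 𝔸 → ℤ)
  (ε-homo : IsRingHomomorphism (CommutativeRing.rawRing 𝔸) (ℤₚ (suc (suc q))) ε)
  (εα≈0 : IntegersMod._≈ₚ_ (suc (suc q)) (ε α) (+ 0))
  (ι : CommutativeRing.Carrier 𝔸 → Field.Carrier 𝕂)
  (ι-homo : IsRingHomomorphism (CommutativeRing.rawRing 𝔸) (Field.rawRing 𝕂) ι)
  (ι-injective : ∀ {a b} → Field._≈_ 𝕂 (ι a) (ι b) → CommutativeRing._≈_ 𝔸 a b)
  (ια≉0 : ¬ Field._≈_ 𝕂 (ι α) (Field.0# 𝕂))
  where

  private
    n p : ℕ
    n = suc q
    p = suc n
    module F = Field (PrimeField.𝔽 p p-prime)

  module K = Field 𝕂
  open Abstract p p-prime 𝔸 K.commutativeRing h α ι K._⁻¹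

  module A where
    open CommutativeRing 𝔸 public
    open Ranges 𝔸 public using (_^_)
    open RangeProperties 𝔸 public
    open Polynomial 𝔸 public
    open PolynomialProperties 𝔸 public
    open Characteristic q p-prime 𝔸 h h-homo public
    open Coefficients q p-prime 𝔸 h h-homo α public
    open IsRingHomomorphism C-homo public using () renaming (⟦⟧-cong to C-cong; *-homo to C-*)

  binom≈ : ∀ x m → binom x m A.≈ A.binomial x m
  binom≈ x m = A.*-congʳ (A.reflexive (A.∏≡∏< 0 m _))

  b≈ : ∀ s → b 1 s A.≈ A.connection s
  b≈ s = A.trans (A.reflexive (A.∑≡∑< 0 p _)) (A.∑-cong p λ k _ → A.*-congˡ
    (A.*-cong (binom≈ (A.ν 1 A.* α A.- A.1#) (n ∸ k)) (binom≈ (A.ν s A.* α A.- A.1#) k)))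

  -- Under `ε`, which sends α to 0, a vanishing b_{1,s} would force 1 = 0 in 𝔽ₚ. The range of s
  -- makes both s and s + 1 prime to p, the latter excluding the ratio 1 in the geometric sum.
  b≉0 : ∀ s → 1 ≤ s → s < n → ¬ b 1 s A.≈ A.0#
  b≉0 s 1≤s s<n e = F.1≉0 (At0.connection-nonzero εα≈0
    (A.p∤ 1≤s (ℕ.m<n⇒m<1+n s<n)) (A.p∤ (s≤s z≤n) (s≤s s<n)) (A.trans (A.sym (b≈ s)) e))
    where
    module At0 = Naturality q p-prime 𝔸 h h-homo α (IntegersMod.ℤ/ₚ p) ε ε-homo

  L-Lag : L A.≋ A.tabulate p (A.lag 1)
  L-Lag = begin
    L
      ≡⟨ A.P.∑≡∑< 0 p _ ⟩
    A.P.∑< p (λ k → A.C (binom (α A.- A.1#) (n ∸ k)) A.⊛ ((A.⊖ A.X) A.P.^ k A.⊛ A.C (A.invfact k)))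
      ≈⟨ A.P.∑-cong p (λ k _ → term k) ⟩
    A.P.∑< p (λ k → A.C (A.lag 1 k) A.⊛ A.X A.P.^ k)
      ≈⟨ A.∑-monomials p (A.lag 1) A.X ⟨
    A.tabulate p (A.lag 1) A.⟨ A.X ⟩
      ≈⟨ A.tabulate-⟨X⟩ p (A.lag 1) ⟩
    A.tabulate p (A.lag 1) ∎
    where
    open Relation.Binary.Reasoning.Setoid A.P.setoid
    open Algebra.Properties.CommutativeSemigroup A.P.*-commutativeSemigroup
    open Algebra.Properties.CommutativeSemiring.Exp A.P.commutativeSemiring using (^-congˡ; ^-distrib-*)
    module H = HomProperties 𝔸 (Polynomial.polynomialRing 𝔸) A.C A.C-homo
    open Algebra.Properties.Ring A.P.ring using (-1*x≈-x)

    power : ∀ k → (A.⊖ A.X) A.P.^ k A.≋ A.C ((A.- A.ν 1) A.^ k) A.⊛ A.X A.P.^ k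
    power k = begin
      (A.⊖ A.X) A.P.^ k
        ≈⟨ ^-congˡ k (-1*x≈-x A.X) ⟨
      (A.C (A.- A.1#) A.⊛ A.X) A.P.^ k
        ≈⟨ ^-distrib-* (A.C (A.- A.1#)) A.X k ⟩
      A.C (A.- A.1#) A.P.^ k A.⊛ A.X A.P.^ k
        ≈⟨ A.P.*-congʳ {A.X A.P.^ k} (^-congˡ k (A.C-cong (A.-‿cong A.ν-1))) ⟨
      A.C (A.- A.ν 1) A.P.^ k A.⊛ A.X A.P.^ k
        ≈⟨ A.P.*-congʳ {A.X A.P.^ k} (H.^-homo (A.- A.ν 1) k) ⟨
      A.C ((A.- A.ν 1) A.^ k) A.⊛ A.X A.P.^ k ∎

    term : ∀ k → A.C (binom (α A.- A.1#) (n ∸ k)) A.⊛ ((A.⊖ A.X) A.P.^ k A.⊛ A.C (A.invfact k))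
                 A.≋ A.C (A.lag 1 k) A.⊛ A.X A.P.^ k
    term k = begin
      A.C B A.⊛ ((A.⊖ A.X) A.P.^ k A.⊛ A.C f)
        ≈⟨ A.P.*-cong (A.C-cong (A.trans (binom≈ (α A.- A.1#) (n ∸ k)) (A.binomial-cong (n ∸ k)
             (A.+-congʳ (A.sym (A.trans (A.*-congʳ A.ν-1) (A.*-identityˡ α)))))))
             (A.P.*-congʳ {A.C f} (power k)) ⟩
      A.C B′ A.⊛ (A.C u A.⊛ A.X A.P.^ k A.⊛ A.C f)
        ≈⟨ A.P.*-congˡ {A.C B′} (xy∙z≈xz∙y (A.C u) (A.X A.P.^ k) (A.C f)) ⟩
      A.C B′ A.⊛ (A.C u A.⊛ A.C f A.⊛ A.X A.P.^ k)
        ≈⟨ A.P.*-assoc (A.C B′) (A.C u A.⊛ A.C f) (A.X A.P.^ k) ⟨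
      A.C B′ A.⊛ (A.C u A.⊛ A.C f) A.⊛ A.X A.P.^ k
        ≈⟨ A.P.*-congʳ {A.X A.P.^ k} (A.P.trans (A.C-* B′ (u A.* f)) (A.P.*-congˡ {A.C B′} (A.C-* u f))) ⟨
      A.C (A.lag 1 k) A.⊛ A.X A.P.^ k ∎
      where
      B  = binom (α A.- A.1#) (n ∸ k)
      B′ = A.binomial (A.ν 1 A.* α A.- A.1#) (n ∸ k)
      u  = (A.- A.ν 1) A.^ k
      f  = A.invfact k

  private
    module ToK = Naturality q p-prime 𝔸 h h-homo α K.commutativeRing ι ι-homo
    module Hι = HomProperties 𝔸 K.commutativeRing ι ι-homo
    module CK where
      open Characteristic q p-prime K.commutativeRing (ι ∘ h) ToK.φ∘h-homo public
      open Coefficients q p-prime K.commutativeRing (ι ∘ h) ToK.φ∘h-homo (ι α) public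
      open Ranges K.commutativeRing public using (_^_)
  open IsRingHomomorphism ι-homo

  ι-b : ∀ s → ι (b 1 s) K.≈ CK.connection s
  ι-b s = K.trans (⟦⟧-cong (b≈ s)) (ToK.connection-homo s)

  connection-cancel : ∀ s → 1 ≤ s → s < n → ∀ {x} → CK.connection s K.* x K.≈ K.0# → x K.≈ K.0#
  connection-cancel s 1≤s s<n e with Domain.noZeroDivisors K.domain e
  ... | inj₁ c≈0 = ⊥-elim (b≉0 s 1≤s s<n (ι-injective (K.trans (ι-b s) (K.trans c≈0 (K.sym 0#-homo)))))
  ... | inj₂ x≈0 = x≈0

  ι-T : ι (α A.^ p A.- α) K.≈ ι α CK.^ p K.- ι α
  ι-T = K.trans (+-homo _ _) (K.+-cong (Hι.^-homo α p) (-‿homo α))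

  open Polynomial K.commutativeRing
  open PolynomialProperties K.commutativeRing
  open RangeProperties K.commutativeRing
  open Inversion q 0<q p-prime K.commutativeRing (ι ∘ h) ToK.φ∘h-homo (ι α) (ι α K.⁻¹)
    (ι (α A.^ p A.- α)) (K.*-inverse ια≉0) ι-T connection-cancel
  open Congruence p polynomialRing (C ∘ (ι ∘ h)) Ch-homo M using (mk; _≅_; divides; ≈⇒≅)

  ιL : map ι L ≋ Lag 1
  ιL = mk λ k → K.trans (coeff-map 𝔸 K.commutativeRing ι ι-homo L k)
    (K.trans (⟦⟧-cong (A.at L-Lag k)) (go k (ℕ.<-≤-connex k p)))
    where
    go : ∀ k → k < p ⊎ p ≤ k → ι (A.coeff (A.tabulate p (A.lag 1)) k) K.≈ coeff (Lag 1) k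
    go k (inj₁ k<p) = K.trans (⟦⟧-cong (A.coeff-tabulate (A.lag 1) k<p))
      (K.trans (ToK.lag-homo 1 k) (K.sym (coeff-Lag 1 k<p)))
    go k (inj₂ p≤k) = K.trans (⟦⟧-cong (A.tabulate-degree p (A.lag 1) k p≤k))
      (K.trans 0#-homo (K.sym (Lag-degree 1 k p≤k)))

  ⟨ιL⟩ : ∀ G → G ⟨ map ι L ⟩ ≋ G ⟨ Lag 1 ⟩
  ⟨ιL⟩ G = ⟨⟩-congʳ G ιL

  u v g : ℕ → K.Carrier
  u k = ι (h ((+ suc k) F.⁻¹))
  v k = ι (Ranges.∏ 𝔸 1 (suc k) (λ s → b 1 s)) K.⁻¹
  g zero    = K.0#
  g (suc k) = K.- K.1# K.* (u k K.* v k)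

  G₀≋ : G₀ ≋ tabulate p g
  G₀≋ = begin
    G₀
      ≡⟨ ≡.cong ⊖_ (P.∑≡∑< 1 n (λ k → C (ι (h ((+ k) F.⁻¹))) ⊛ (X P.^ k ⊛ C (ι (Ranges.∏ 𝔸 1 k (λ s → b 1 s)) K.⁻¹)))) ⟩
    ⊖ P.∑< n (λ k → C (u k) ⊛ (X P.^ suc k ⊛ C (v k)))
      ≈⟨ -1*x≈-x (P.∑< n (λ k → C (u k) ⊛ (X P.^ suc k ⊛ C (v k)))) ⟨
    C (K.- K.1#) ⊛ P.∑< n (λ k → C (u k) ⊛ (X P.^ suc k ⊛ C (v k)))
      ≈⟨ P.∑-*ˡ n (C (K.- K.1#)) _ ⟩
    P.∑< n (λ k → C (K.- K.1#) ⊛ (C (u k) ⊛ (X P.^ suc k ⊛ C (v k))))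
      ≈⟨ P.∑-cong n (λ k _ → term k) ⟩
    P.∑< n (λ k → C (g (suc k)) ⊛ X P.^ suc k)
      ≈⟨ P.trans (P.+-congʳ {P.∑< n (λ k → C (g (suc k)) ⊛ X P.^ suc k)}
           (P.trans (P.*-identityʳ (C K.0#)) (C-zero K.refl)))
           (P.+-identityˡ (P.∑< n (λ k → C (g (suc k)) ⊛ X P.^ suc k))) ⟨
    C (g 0) ⊛ C K.1# ⊕ P.∑< n (λ k → C (g (suc k)) ⊛ X P.^ suc k)
      ≡⟨ P.∑-first n _ ⟨
    P.∑< p (λ k → C (g k) ⊛ X P.^ k)
      ≈⟨ ∑-monomials p g X ⟨
    tabulate p g ⟨ X ⟩
      ≈⟨ tabulate-⟨X⟩ p g ⟩
    tabulate p g ∎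
    where
    open Relation.Binary.Reasoning.Setoid P.setoid
    open Algebra.Properties.Ring P.ring using (-1*x≈-x)
    open Algebra.Properties.CommutativeSemigroup P.*-commutativeSemigroup
    term : ∀ k → C (K.- K.1#) ⊛ (C (u k) ⊛ (X P.^ suc k ⊛ C (v k))) ≋ C (g (suc k)) ⊛ X P.^ suc k
    term k = begin
      C (K.- K.1#) ⊛ (C (u k) ⊛ (X P.^ suc k ⊛ C (v k)))
        ≈⟨ P.*-congˡ {C (K.- K.1#)} (x∙yz≈xz∙y (C (u k)) (X P.^ suc k) (C (v k))) ⟩
      C (K.- K.1#) ⊛ (C (u k) ⊛ C (v k) ⊛ X P.^ suc k)
        ≈⟨ P.*-assoc (C (K.- K.1#)) (C (u k) ⊛ C (v k)) (X P.^ suc k) ⟨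
      C (K.- K.1#) ⊛ (C (u k) ⊛ C (v k)) ⊛ X P.^ suc k
        ≈⟨ P.*-congʳ {X P.^ suc k} (P.trans (C-* (K.- K.1#) (u k K.* v k)) (P.*-congˡ {C (K.- K.1#)} (C-* (u k) (v k)))) ⟨
      C (g (suc k)) ⊛ X P.^ suc k ∎

  G₀-degree : DegreeBelow p G₀
  G₀-degree k p≤k = K.trans (at G₀≋ k) (tabulate-degree p g k p≤k)

  -- The total reciprocal is a true inverse here: if the product of the b_{1,s} vanished, cancelling
  -- it from its product with 1 would give 1 = 0.
  v-inverse : ∀ k → k < n → v k K.* connections k K.≈ K.1#
  v-inverse k k<n = K.trans (K.*-comm _ _) (K.trans (K.*-congʳ (K.sym ∏≈)) (K.*-inverse λ ∏≈0 →
    K.1≉0 (connections-cancel k k<n (K.trans (K.*-identityʳ _) (K.trans (K.sym ∏≈) ∏≈0)))))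
    where
    ∏≈ : ι (Ranges.∏ 𝔸 1 (suc k) (λ s → b 1 s)) K.≈ connections k
    ∏≈ = K.trans (K.reflexive (≡.cong ι (A.∏≡∏< 1 k (b 1)))) (K.trans (Hι.∏-homo k _)
      (∏-cong k λ i _ → ι-b (suc i)))

  G₀-inverse : G₀ ⟨ Lag 1 ⟩ ≅ X
  G₀-inverse = inverse {G₀} G₀-degree (at G₀≋ 0) λ k k<n → begin
    coeff G₀ (suc k) K.* connections k
      ≈⟨ K.*-congʳ (K.trans (at G₀≋ (suc k)) (coeff-tabulate g (s≤s k<n))) ⟩
    K.- K.1# K.* (u k K.* v k) K.* connections k
      ≈⟨ K.trans (K.*-assoc _ _ _) (K.*-congˡ (K.*-assoc _ _ _)) ⟩
    K.- K.1# K.* (u k K.* (v k K.* connections k))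
      ≈⟨ K.*-congˡ (K.trans (K.*-congˡ (v-inverse k k<n)) (K.*-identityʳ _)) ⟩
    K.- K.1# K.* u k
      ≈⟨ -1*x≈-x (u k) ⟩
    K.- u k ∎
    where
    open Relation.Binary.Reasoning.Setoid K.setoid
    open Algebra.Properties.Ring K.ring using (-1*x≈-x)

  statement : Statement
  statement = (λ s 1≤s s+1<p → b≉0 s 1≤s (ℕ.s≤s⁻¹ (≡.subst (_< p) (ℕ.+-comm s 1) s+1<p)))
    , (G₀ , isInverse , λ {G} (dG , d) → unique {G₀} {G} G₀-degree dG
        (S.trans G₀-inverse (S.sym (S.trans (≈⇒≅ (P.sym (⟨ιL⟩ G))) (mk d)))))
    , isInverse
    where
    isInverse : IsInverseOfL G₀
    isInverse = G₀-degree , divides (S.trans (≈⇒≅ (⟨ιL⟩ G₀)) G₀-inverse)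

module _ (q : ℕ) (0<q : 0 < q) (p-prime : Prime (suc (suc q))) where
  open Laguerre (suc (suc q)) p-prime
  private
    module FP = PolynomialProperties F.commutativeRing
    module AF = FractionProperties (PolynomialDomain.polynomialDomain F.domain)

  -- The map back to 𝔽ₚ is the constant term, which is zero for α; and α is nonzero in 𝔽ₚ(α) because
  -- its linear coefficient is 1.
  abstract-statement : Abstract.Statement (suc (suc q)) p-prime A.commutativeRing K.commutativeRing Aᴾ.C α ι K._⁻¹
  abstract-statement = AbstractProof.statement q 0<q p-prime A.commutativeRing fractionField
    Aᴾ.C FP.C-homo α (λ f → Aᴾ.coeff f 0) FP.coeff₀-homo F.refl ι AF.ι-homo AF.ι-injective
    λ ια≃0 → F.1≉0 (Aᴾ.at (AF.ι-injective {α} {A.0#} ια≃0) 1)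

theorem2 : (p : ℕ) (p-prime : Prime p) → ¬ (2 ∣ p) →
    let open Laguerre p p-prime in
    (∀ s → 1 ≤ s → s + 1 < p → ¬ (b 1 s A.≈ A.0#))
    × ∃! KX._≈_ IsInverseOfL
    × IsInverseOfL G₀
theorem2 0               p-prime odd = contradiction p-prime ¬prime[0]
theorem2 1               p-prime odd = contradiction p-prime ¬prime[1]
theorem2 2               p-prime odd = contradiction ℕ∣.∣-refl odd
theorem2 (suc (suc q@(suc _))) p-prime odd = concretely (suc (suc q)) p-prime (abstract-statement q (s≤s z≤n) p-prime)
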